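{- There exist a sequence $(n_i)_{i=1}^{\infty}$ of positive integers and absolute constants $c>0$, $C>0$ such that, for each $i \geq 1$, there is a triangle-free graph $G_i$ on $n_i$ vertices which is $(p_i, \beta_i)$-jumbled with $p_i \geq c\, n_i^{ -1/3}$ and $\beta_i \leq C\sqrt{p_i n_i}\,\log n_i$.
   Context: All graphs are finite and simple. For a graph $G$ and $X \subseteq V(G)$, $e(X)$ denotes the number of edges of $G$ with both endpoints in $X$. A graph $G$ is said to be $(p,\beta)$-jumbled if $\left|e(X) - p\binom{|X|}{2}\right| \leq \beta |X|$ for all $X \subseteq V(G)$. -}

module Defs where

import Algebra.Definitions.RawSemiring
open import Data.Fin.Base using (Fin)
import Data.Fin.Properties as Fin
open import Data.Fin.Subset as Subset using (Subset; _∈_)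
open import Data.Fin.Subset.Properties using (_∈?_)
open import Data.Integer.Base as ℤ using (+_)
import Data.Integer.Properties as ℤ
open import Data.List.Base using (List; length; filter; allFin; cartesianProduct)
open import Data.Nat.Base as ℕ using (ℕ; zero; suc; NonZero)
open import Data.Nat.Combinatorics using (_C_)
import Data.Nat.Properties as ℕ
open import Data.Nat.Solver using () renaming (module +-*-Solver to ℕ-Solver)
open import Data.Product.Base using (∃-syntax; _×_; _,_; proj₁; proj₂)
open import Data.Rational.Base as ℚ using (ℚ; 0ℚ; 1ℚ; ½; toℚᵘ)
import Data.Rational.Properties as ℚ
open import Data.Rational.Solver using () renaming (module +-*-Solver to ℚ-Solver)
import Data.Rational.Unnormalised.Base as ℚᵘ
import Data.Rational.Unnormalised.Properties as ℚᵘ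
open import Data.Sum.Base using (_⊎_; inj₁; inj₂)
open import Level using (0ℓ)
open import Relation.Binary.Core using (Rel)
open import Relation.Binary.Definitions using (Decidable; Symmetric; Irreflexive)
open import Relation.Binary.PropositionalEquality
open import Relation.Nullary using (¬_; Dec; yes; no)
open import Relation.Nullary.Decidable using (_×-dec_)

open Algebra.Definitions.RawSemiring ℚ.+-*-rawSemiring using () renaming (_^_ to _^ℚ_)

private
  variable
    a b c d ε δ : ℚ

fromℕℚ : ℕ → ℚ
fromℕℚ n = + n ℚ./ 1

1/1+_ : ℕ → ℚ
1/1+ m = + 1 ℚ./ suc m

module ℚ-Lemmas where
 abstract

  toℚᵘ-/ : ∀ n m → toℚᵘ (+ n ℚ./ suc m) ℚᵘ.≃ ℚᵘ.mkℚᵘ (+ n) m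
  toℚᵘ-/ n m = ℚ.toℚᵘ-fromℚᵘ (ℚᵘ.mkℚᵘ (+ n) m)

  /-mono : ∀ {k l m n} → k ℕ.* suc n ℕ.≤ l ℕ.* suc m → + k ℚ./ suc m ℚ.≤ + l ℚ./ suc n
  /-mono {k} {l} {m} {n} h = ℚ.toℚᵘ-cancel-≤ (begin
    toℚᵘ (+ k ℚ./ suc m) ≃⟨ toℚᵘ-/ k m ⟩
    ℚᵘ.mkℚᵘ (+ k) m      ≤⟨ ℚᵘ.*≤* (subst₂ ℤ._≤_ (ℤ.pos-* k (suc n)) (ℤ.pos-* l (suc m)) (ℤ.+≤+ h)) ⟩
    ℚᵘ.mkℚᵘ (+ l) n      ≃⟨ ℚᵘ.≃-sym (toℚᵘ-/ l n) ⟩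
    toℚᵘ (+ l ℚ./ suc n) ∎)
    where open ℚᵘ.≤-Reasoning

  /-cong-≡ : ∀ {k l m n} → k ℕ.* suc n ≡ l ℕ.* suc m → + k ℚ./ suc m ≡ + l ℚ./ suc n
  /-cong-≡ {k} {l} {m} {n} e = ℚ.≤-antisym
    (/-mono {k} {l} {m} {n} (ℕ.≤-reflexive e)) (/-mono {l} {k} {n} {m} (ℕ.≤-reflexive (sym e)))

  0≤/ : ∀ k m → 0ℚ ℚ.≤ + k ℚ./ suc m
  0≤/ k m = /-mono {0} {k} {0} {m} ℕ.z≤n

  /-suc : ∀ k m → + suc k ℚ./ suc m ≡ + k ℚ./ suc m ℚ.+ 1/1+ m
  /-suc k m = ℚ.toℚᵘ-injective (begin
    toℚᵘ (+ suc k ℚ./ suc m)                    ≈⟨ toℚᵘ-/ (suc k) m ⟩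
    ℚᵘ.mkℚᵘ (+ suc k) m                         ≈⟨ ℚᵘ.*≡* lemma ⟩
    ℚᵘ.mkℚᵘ (+ k) m ℚᵘ.+ ℚᵘ.mkℚᵘ (+ 1) m        ≈⟨ ℚᵘ.+-cong (ℚᵘ.≃-sym (toℚᵘ-/ k m)) (ℚᵘ.≃-sym (toℚᵘ-/ 1 m)) ⟩
    toℚᵘ (+ k ℚ./ suc m) ℚᵘ.+ toℚᵘ (1/1+ m)     ≈⟨ ℚᵘ.≃-sym (ℚ.toℚᵘ-homo-+ (+ k ℚ./ suc m) (1/1+ m)) ⟩
    toℚᵘ (+ k ℚ./ suc m ℚ.+ 1/1+ m)             ∎)
    where
    open import Relation.Binary.Reasoning.Setoid ℚᵘ.≃-setoid
    lemma : + suc k ℤ.* (+ suc m ℤ.* + suc m) ≡ (+ k ℤ.* + suc m ℤ.+ + 1 ℤ.* + suc m) ℤ.* + suc m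
    lemma = trans (cong (ℤ._* (+ suc m ℤ.* + suc m)) {+ suc k} {+ k ℤ.+ + 1} (cong +_ (ℕ.+-comm 1 k)))
           (trans (sym (ℤ.*-assoc (+ k ℤ.+ + 1) (+ suc m) (+ suc m)))
                  (cong (ℤ._* + suc m) (ℤ.*-distribʳ-+ (+ suc m) (+ k) (+ 1))))

  archimedean : 0ℚ ℚ.< ε → ∃[ N ] 1/1+ N ℚ.≤ ε
  archimedean {ε@(ℚ.mkℚ (+ suc n) d-1 _)} _ = d-1 , ℚ.toℚᵘ-cancel-≤
    (ℚᵘ.≤-respˡ-≃ (ℚᵘ.≃-sym (toℚᵘ-/ 1 d-1)) (ℚᵘ.*≤* (ℤ.*-monoʳ-≤-nonNeg (+ suc d-1) {+ 1} {+ suc n} (ℤ.+≤+ (ℕ.s≤s ℕ.z≤n)))))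
  archimedean {ℚ.mkℚ (+ 0) _ _} (ℚ.*<* (ℤ.+<+ ()))
  archimedean {ℚ.mkℚ (ℤ.-[1+ _ ]) _ _} (ℚ.*<* ())

  1/1+-antitone : ∀ m n → m ℕ.≤ n → 1/1+ n ℚ.≤ 1/1+ m
  1/1+-antitone m n h = /-mono {1} {1} {n} {m} (ℕ.*-monoʳ-≤ 1 (ℕ.s≤s h))

  <-numerator : ∀ y → y ℚ.< fromℕℚ (suc ℤ.∣ ℚ.↥ y ∣)
  <-numerator y@(ℚ.mkℚ n d-1 _) = ℚ.toℚᵘ-cancel-<
    (ℚᵘ.<-respʳ-≃ (ℚᵘ.≃-sym (toℚᵘ-/ (suc ℤ.∣ n ∣) 0)) (ℚᵘ.*<* (lemma n)))
    where
    lemma : ∀ n → n ℤ.* + 1 ℤ.< + suc ℤ.∣ n ∣ ℤ.* + suc d-1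
    lemma (+ n) = subst₂ ℤ._<_ (sym (ℤ.*-identityʳ (+ n))) (ℤ.pos-* (suc n) (suc d-1))
      (ℤ.+<+ (ℕ.m≤m*n (suc n) (suc d-1)))
    lemma (ℤ.-[1+ n ]) = ℤ.-<+

  shrink : 0ℚ ℚ.< ε → 0ℚ ℚ.< δ → ∃[ η ] 0ℚ ℚ.< η × η ℚ.* δ ≡ ε
  shrink {ε} {δ} 0<ε 0<δ = ε ℚ.* 1/δ , ℚ.positive⁻¹ _ {{ℚ.pos*pos⇒pos ε {{ℚ.positive 0<ε}} 1/δ {{ℚ.1/pos⇒pos δ}}}} ,
    trans (ℚ.*-assoc ε 1/δ δ) (trans (cong (ε ℚ.*_) (ℚ.*-inverseˡ δ)) (ℚ.*-identityʳ ε))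
    where
    instance
      δ-pos : ℚ.Positive δ
      δ-pos = ℚ.positive 0<δ
      δ-nz : ℚ.NonZero δ
      δ-nz = ℚ.pos⇒nonZero δ
    1/δ : ℚ
    1/δ = ℚ.1/ δ

  0<1 : 0ℚ ℚ.< 1ℚ
  0<1 = ℚ.positive⁻¹ 1ℚ

  0<½* : 0ℚ ℚ.< ε → 0ℚ ℚ.< ½ ℚ.* ε
  0<½* {ε} 0<ε = ℚ.positive⁻¹ _ {{ℚ.pos*pos⇒pos ½ ε {{ℚ.positive 0<ε}}}}

  ½+½ : ∀ ε → ½ ℚ.* ε ℚ.+ ½ ℚ.* ε ≡ ε
  ½+½ = solve 1 (λ e → con ½ :* e :+ con ½ :* e := e) refl where open ℚ-Solver

  *-mono-≤ : 0ℚ ℚ.≤ a → a ℚ.≤ b → 0ℚ ℚ.≤ c → c ℚ.≤ d → a ℚ.* c ℚ.≤ b ℚ.* d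
  *-mono-≤ {a} {b} {c} {d} 0≤a a≤b 0≤c c≤d = ℚ.≤-trans
    (ℚ.*-monoʳ-≤-nonNeg c {{ℚ.nonNegative 0≤c}} a≤b)
    (ℚ.*-monoˡ-≤-nonNeg b {{ℚ.nonNegative (ℚ.≤-trans 0≤a a≤b)}} c≤d)

  0≤+ : 0ℚ ℚ.≤ a → 0ℚ ℚ.≤ b → 0ℚ ℚ.≤ a ℚ.+ b
  0≤+ = ℚ.+-mono-≤

  0≤* : 0ℚ ℚ.≤ a → 0ℚ ℚ.≤ b → 0ℚ ℚ.≤ a ℚ.* b
  0≤* {a} {b} 0≤a 0≤b = ℚ.≤-trans (ℚ.≤-reflexive (sym (ℚ.*-zeroˡ 0ℚ))) (*-mono-≤ ℚ.≤-refl 0≤a ℚ.≤-refl 0≤b)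

  ≤-+ʳ : ∀ a b → 0ℚ ℚ.≤ b → a ℚ.≤ a ℚ.+ b
  ≤-+ʳ a b 0≤b = subst (ℚ._≤ a ℚ.+ b) (ℚ.+-identityʳ a) (ℚ.+-monoʳ-≤ a 0≤b)

  ≤-+ˡ : ∀ a b → 0ℚ ℚ.≤ b → a ℚ.≤ b ℚ.+ a
  ≤-+ˡ a b 0≤b = subst (a ℚ.≤_) (ℚ.+-comm a b) (≤-+ʳ a b 0≤b)

  ≤∣∣ : ∀ a → a ℚ.≤ ℚ.∣ a ∣
  ≤∣∣ a with ℚ.≤-total 0ℚ a
  ... | inj₁ 0≤a = ℚ.≤-reflexive (sym (ℚ.0≤p⇒∣p∣≡p 0≤a))
  ... | inj₂ a≤0 = ℚ.≤-trans a≤0 (ℚ.0≤∣p∣ a)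

  ∣-∣-comm : ∀ a b → ℚ.∣ a ℚ.- b ∣ ≡ ℚ.∣ b ℚ.- a ∣
  ∣-∣-comm a b = trans (cong ℚ.∣_∣ (eq a b)) (ℚ.∣-p∣≡∣p∣ (b ℚ.- a))
    where
    open ℚ-Solver
    eq : ∀ a b → a ℚ.- b ≡ ℚ.- (b ℚ.- a)
    eq = solve 2 (λ a b → a :- b := :- (b :- a)) refl

  ∣-∣⇒≤ : ∀ a b ε → ℚ.∣ a ℚ.- b ∣ ℚ.≤ ε → a ℚ.≤ b ℚ.+ ε
  ∣-∣⇒≤ a b ε h = subst (ℚ._≤ b ℚ.+ ε) (eq a b) (ℚ.+-monoʳ-≤ b (ℚ.≤-trans (≤∣∣ (a ℚ.- b)) h))
    where
    open ℚ-Solver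
    eq : ∀ a b → b ℚ.+ (a ℚ.- b) ≡ a
    eq = solve 2 (λ a b → b :+ (a :- b) := a) refl

  ≤⇒∣-∣ : ∀ a b ε → a ℚ.≤ b ℚ.+ ε → b ℚ.≤ a ℚ.+ ε → ℚ.∣ a ℚ.- b ∣ ℚ.≤ ε
  ≤⇒∣-∣ a b ε h₁ h₂ with ℚ.∣p∣≡p∨∣p∣≡-p (a ℚ.- b)
  ... | inj₁ e = subst (ℚ._≤ ε) (sym e) (move a b h₁)
    where
    open ℚ-Solver
    move : ∀ a b → a ℚ.≤ b ℚ.+ ε → a ℚ.- b ℚ.≤ ε
    move a b h = subst (a ℚ.- b ℚ.≤_) (solve 2 (λ b e → (b :+ e) :- b := e) refl b ε) (ℚ.+-monoˡ-≤ (ℚ.- b) h)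
  ... | inj₂ e = subst (ℚ._≤ ε) (trans (solve 2 (λ a b → b :- a := :- (a :- b)) refl a b) (sym e)) (move b a h₂)
    where
    open ℚ-Solver
    move : ∀ a b → a ℚ.≤ b ℚ.+ ε → a ℚ.- b ℚ.≤ ε
    move a b h = subst (a ℚ.- b ℚ.≤_) (solve 2 (λ b e → (b :+ e) :- b := e) refl b ε) (ℚ.+-monoˡ-≤ (ℚ.- b) h)

  ^-nonNeg : ∀ k → 0ℚ ℚ.≤ a → 0ℚ ℚ.≤ a ^ℚ k
  ^-nonNeg zero    _ = 0≤/ 1 0
  ^-nonNeg (suc k) h = 0≤* h (^-nonNeg k h)

  ^-pos : ∀ k → 0ℚ ℚ.< a → 0ℚ ℚ.< a ^ℚ k
  ^-pos zero    _ = ℚ.positive⁻¹ 1ℚ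
  ^-pos {a} (suc k) h = ℚ.positive⁻¹ _ {{ℚ.pos*pos⇒pos a {{ℚ.positive h}} (a ^ℚ k) {{ℚ.positive (^-pos k h)}}}}

  ^-mono-≤ : ∀ k → 0ℚ ℚ.≤ a → a ℚ.≤ b → a ^ℚ k ℚ.≤ b ^ℚ k
  ^-mono-≤ zero    _   _   = ℚ.≤-refl
  ^-mono-≤ (suc k) 0≤a a≤b = *-mono-≤ 0≤a a≤b (^-nonNeg k 0≤a) (^-mono-≤ k 0≤a a≤b)

  1≤^ : ∀ k → 1ℚ ℚ.≤ a → 1ℚ ℚ.≤ a ^ℚ k
  1≤^ zero    _ = ℚ.≤-refl
  1≤^ {a} (suc k) h = ℚ.≤-trans (ℚ.≤-reflexive (sym (ℚ.*-identityˡ 1ℚ)))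
    (*-mono-≤ (0≤/ 1 0) h (0≤/ 1 0) (1≤^ k h))

  ≤^ : ∀ k .{{_ : NonZero k}} → 1ℚ ℚ.≤ a → a ℚ.≤ a ^ℚ k
  ≤^ {a} (suc k) h = ℚ.≤-trans (ℚ.≤-reflexive (sym (ℚ.*-identityʳ a)))
    (*-mono-≤ (ℚ.≤-trans (0≤/ 1 0) h) ℚ.≤-refl (0≤/ 1 0) (1≤^ k h))

  ^-superadditive : ∀ k .{{_ : NonZero k}} → 0ℚ ℚ.≤ a → 0ℚ ℚ.≤ b →
                    a ^ℚ k ℚ.+ b ^ℚ k ℚ.≤ (a ℚ.+ b) ^ℚ k
  ^-superadditive {a} {b} (suc zero) _ _ = ℚ.≤-reflexive (sym (ℚ.*-distribʳ-+ 1ℚ a b))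
  ^-superadditive {a} {b} (suc k@(suc _)) 0≤a 0≤b = begin
    a ℚ.* a ^ℚ k ℚ.+ b ℚ.* b ^ℚ k
      ≤⟨ ℚ.+-mono-≤ (*-mono-≤ 0≤a ℚ.≤-refl (^-nonNeg k 0≤a) (≤-+ʳ (a ^ℚ k) (b ^ℚ k) (^-nonNeg k 0≤b)))
                    (*-mono-≤ 0≤b ℚ.≤-refl (^-nonNeg k 0≤b) (≤-+ˡ (b ^ℚ k) (a ^ℚ k) (^-nonNeg k 0≤a))) ⟩
    a ℚ.* (a ^ℚ k ℚ.+ b ^ℚ k) ℚ.+ b ℚ.* (a ^ℚ k ℚ.+ b ^ℚ k)
      ≡⟨ sym (ℚ.*-distribʳ-+ (a ^ℚ k ℚ.+ b ^ℚ k) a b) ⟩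
    (a ℚ.+ b) ℚ.* (a ^ℚ k ℚ.+ b ^ℚ k)
      ≤⟨ *-mono-≤ (0≤+ 0≤a 0≤b) ℚ.≤-refl (0≤+ (^-nonNeg k 0≤a) (^-nonNeg k 0≤b)) (^-superadditive k 0≤a 0≤b) ⟩
    (a ℚ.+ b) ℚ.* (a ℚ.+ b) ^ℚ k ∎
    where open ℚ.≤-Reasoning

open ℚ-Lemmas

------------------------------------------------------------------------
-- Real numbers as Cauchy sequences of rationals

Cauchy : (ℕ → ℚ) → Set
Cauchy x = ∀ {ε} → 0ℚ ℚ.< ε → ∃[ N ] ∀ {m n} → N ℕ.≤ m → N ℕ.≤ n → ℚ.∣ x m ℚ.- x n ∣ ℚ.≤ ε

record ℝ : Set where
  constructor mkℝ
  field
    seq    : ℕ → ℚ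
    cauchy : Cauchy seq

open ℝ public

infix 4 _≤_ _<_

_≤_ : Rel ℝ 0ℓ
x ≤ y = ∀ {ε} → 0ℚ ℚ.< ε → ∃[ N ] ∀ {n} → N ℕ.≤ n → seq x n ℚ.≤ seq y n ℚ.+ ε

_<_ : Rel ℝ 0ℓ
x < y = ∃[ ε ] (0ℚ ℚ.< ε × ∃[ N ] ∀ {n} → N ℕ.≤ n → seq x n ℚ.+ ε ℚ.≤ seq y n)

module Cauchy-Lemmas where
 abstract

  private
    variable
      x y : ℕ → ℚ

  const-cauchy : ∀ q → Cauchy (λ _ → q)
  const-cauchy q {ε} 0<ε = 0 , λ _ _ → ≤⇒∣-∣ q q ε (≤-+ʳ q ε (ℚ.<⇒≤ 0<ε)) (≤-+ʳ q ε (ℚ.<⇒≤ 0<ε))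

  +-cauchy : Cauchy x → Cauchy y → Cauchy (λ n → x n ℚ.+ y n)
  +-cauchy {x} {y} cx cy {ε} 0<ε with cx (0<½* 0<ε) | cy (0<½* 0<ε)
  ... | M , hx | N , hy = M ℕ.⊔ N , λ {m} {n} p q → begin
    ℚ.∣ (x m ℚ.+ y m) ℚ.- (x n ℚ.+ y n) ∣      ≡⟨ cong ℚ.∣_∣ (eq (x m) (y m) (x n) (y n)) ⟩
    ℚ.∣ (x m ℚ.- x n) ℚ.+ (y m ℚ.- y n) ∣      ≤⟨ ℚ.∣p+q∣≤∣p∣+∣q∣ (x m ℚ.- x n) (y m ℚ.- y n) ⟩
    ℚ.∣ x m ℚ.- x n ∣ ℚ.+ ℚ.∣ y m ℚ.- y n ∣    ≤⟨ ℚ.+-mono-≤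
        (hx (ℕ.m⊔n≤o⇒m≤o M N p) (ℕ.m⊔n≤o⇒m≤o M N q)) (hy (ℕ.m⊔n≤o⇒n≤o M N p) (ℕ.m⊔n≤o⇒n≤o M N q)) ⟩
    ½ ℚ.* ε ℚ.+ ½ ℚ.* ε                        ≡⟨ ½+½ ε ⟩
    ε                                          ∎
    where
    open ℚ.≤-Reasoning
    open ℚ-Solver
    eq : ∀ a b c d → (a ℚ.+ b) ℚ.- (c ℚ.+ d) ≡ (a ℚ.- c) ℚ.+ (b ℚ.- d)
    eq = solve 4 (λ a b c d → (a :+ b) :- (c :+ d) := (a :- c) :+ (b :- d)) refl

  neg-cauchy : Cauchy x → Cauchy (λ n → ℚ.- x n)
  neg-cauchy {x} cx {ε} 0<ε with cx 0<ε
  ... | N , hx = N , λ {m} {n} p q →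
    subst (ℚ._≤ ε) (trans (∣-∣-comm (x m) (x n)) (cong ℚ.∣_∣ (eq (x m) (x n)))) (hx p q)
    where
    open ℚ-Solver
    eq : ∀ a b → b ℚ.- a ≡ ℚ.- a ℚ.- (ℚ.- b)
    eq = solve 2 (λ a b → b :- a := (:- a) :- (:- b)) refl

  abs-cauchy : Cauchy x → Cauchy (λ n → ℚ.∣ x n ∣)
  abs-cauchy {x} cx {ε} 0<ε with cx 0<ε
  ... | N , hx = N , λ {m} {n} p q → ≤⇒∣-∣ ℚ.∣ x m ∣ ℚ.∣ x n ∣ ε (reverse (x m) (x n) (hx p q)) (reverse (x n) (x m) (hx q p))
    where
    open ℚ-Solver
    eq : ∀ a b → b ℚ.+ (a ℚ.- b) ≡ a
    eq = solve 2 (λ a b → b :+ (a :- b) := a) refl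
    reverse : ∀ a b → ℚ.∣ a ℚ.- b ∣ ℚ.≤ ε → ℚ.∣ a ∣ ℚ.≤ ℚ.∣ b ∣ ℚ.+ ε
    reverse a b h = subst (λ z → ℚ.∣ z ∣ ℚ.≤ ℚ.∣ b ∣ ℚ.+ ε) (eq a b)
      (ℚ.≤-trans (ℚ.∣p+q∣≤∣p∣+∣q∣ b (a ℚ.- b)) (ℚ.+-monoʳ-≤ ℚ.∣ b ∣ h))

  Bounded : (ℕ → ℚ) → Set
  Bounded x = ∃[ B ] (0ℚ ℚ.< B × ∃[ N ] ∀ {n} → N ℕ.≤ n → ℚ.∣ x n ∣ ℚ.≤ B)

  bounded : Cauchy x → Bounded x
  bounded {x} cx = go (abs-cauchy {x} cx {1ℚ} 0<1)
    where
    go : ∃[ N ] (∀ {m n} → N ℕ.≤ m → N ℕ.≤ n → ℚ.∣ ℚ.∣ x m ∣ ℚ.- ℚ.∣ x n ∣ ∣ ℚ.≤ 1ℚ) → Bounded x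
    go (N , h) = ℚ.∣ x N ∣ ℚ.+ 1ℚ ,
      ℚ.<-≤-trans {0ℚ} {1ℚ} {ℚ.∣ x N ∣ ℚ.+ 1ℚ} 0<1 (≤-+ˡ 1ℚ ℚ.∣ x N ∣ (ℚ.0≤∣p∣ (x N))) ,
      N , λ {n} p → ∣-∣⇒≤ ℚ.∣ x n ∣ ℚ.∣ x N ∣ 1ℚ (h {n} {N} p ℕ.≤-refl)

  *-cauchy : Cauchy x → Cauchy y → Cauchy (λ n → x n ℚ.* y n)
  *-cauchy {x} {y} cx cy {ε} 0<ε = go (bounded {x} cx) (bounded {y} cy)
    where
    close : ∀ {A B K L} → (∀ {n} → K ℕ.≤ n → ℚ.∣ x n ∣ ℚ.≤ A) → (∀ {n} → L ℕ.≤ n → ℚ.∣ y n ∣ ℚ.≤ B) →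
            ∃[ η ] (0ℚ ℚ.< η × η ℚ.* A ≡ ½ ℚ.* ε) → ∃[ θ ] (0ℚ ℚ.< θ × θ ℚ.* B ≡ ½ ℚ.* ε) →
            ∃[ N ] ∀ {m n} → N ℕ.≤ m → N ℕ.≤ n → ℚ.∣ x m ℚ.* y m ℚ.- x n ℚ.* y n ∣ ℚ.≤ ε
    close {A} {B} {K} {L} hA hB (η , 0<η , ηA≡) (θ , 0<θ , θB≡) =
      K ℕ.⊔ L ℕ.⊔ (M ℕ.⊔ N) , λ {m} {n} p q → begin
        ℚ.∣ x m ℚ.* y m ℚ.- x n ℚ.* y n ∣
          ≡⟨ cong ℚ.∣_∣ (eq (x m) (y m) (x n) (y n)) ⟩
        ℚ.∣ (y m ℚ.- y n) ℚ.* x m ℚ.+ (x m ℚ.- x n) ℚ.* y n ∣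
          ≤⟨ ℚ.∣p+q∣≤∣p∣+∣q∣ ((y m ℚ.- y n) ℚ.* x m) ((x m ℚ.- x n) ℚ.* y n) ⟩
        ℚ.∣ (y m ℚ.- y n) ℚ.* x m ∣ ℚ.+ ℚ.∣ (x m ℚ.- x n) ℚ.* y n ∣
          ≡⟨ cong₂ ℚ._+_ (ℚ.∣p*q∣≡∣p∣*∣q∣ (y m ℚ.- y n) (x m)) (ℚ.∣p*q∣≡∣p∣*∣q∣ (x m ℚ.- x n) (y n)) ⟩
        ℚ.∣ y m ℚ.- y n ∣ ℚ.* ℚ.∣ x m ∣ ℚ.+ ℚ.∣ x m ℚ.- x n ∣ ℚ.* ℚ.∣ y n ∣
          ≤⟨ ℚ.+-mono-≤
               (*-mono-≤ (ℚ.0≤∣p∣ (y m ℚ.- y n)) (proj₂ (cy 0<η) (N≤ p) (N≤ q)) (ℚ.0≤∣p∣ (x m)) (hA (K≤ p)))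
               (*-mono-≤ (ℚ.0≤∣p∣ (x m ℚ.- x n)) (proj₂ (cx 0<θ) (M≤ p) (M≤ q)) (ℚ.0≤∣p∣ (y n)) (hB (L≤ q))) ⟩
        η ℚ.* A ℚ.+ θ ℚ.* B
          ≡⟨ cong₂ ℚ._+_ ηA≡ θB≡ ⟩
        ½ ℚ.* ε ℚ.+ ½ ℚ.* ε
          ≡⟨ ½+½ ε ⟩
        ε ∎
      where
      open ℚ.≤-Reasoning
      open ℚ-Solver
      M N : ℕ
      M = proj₁ (cx 0<θ)
      N = proj₁ (cy 0<η)
      eq : ∀ a b c d → a ℚ.* b ℚ.- c ℚ.* d ≡ (b ℚ.- d) ℚ.* a ℚ.+ (a ℚ.- c) ℚ.* d
      eq = solve 4 (λ a b c d → a :* b :- c :* d := (b :- d) :* a :+ (a :- c) :* d) refl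
      K≤ : ∀ {m} → K ℕ.⊔ L ℕ.⊔ (M ℕ.⊔ N) ℕ.≤ m → K ℕ.≤ m
      K≤ p = ℕ.m⊔n≤o⇒m≤o K L (ℕ.m⊔n≤o⇒m≤o (K ℕ.⊔ L) (M ℕ.⊔ N) p)
      L≤ : ∀ {m} → K ℕ.⊔ L ℕ.⊔ (M ℕ.⊔ N) ℕ.≤ m → L ℕ.≤ m
      L≤ p = ℕ.m⊔n≤o⇒n≤o K L (ℕ.m⊔n≤o⇒m≤o (K ℕ.⊔ L) (M ℕ.⊔ N) p)
      M≤ : ∀ {m} → K ℕ.⊔ L ℕ.⊔ (M ℕ.⊔ N) ℕ.≤ m → M ℕ.≤ m
      M≤ p = ℕ.m⊔n≤o⇒m≤o M N (ℕ.m⊔n≤o⇒n≤o (K ℕ.⊔ L) (M ℕ.⊔ N) p)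
      N≤ : ∀ {m} → K ℕ.⊔ L ℕ.⊔ (M ℕ.⊔ N) ℕ.≤ m → N ℕ.≤ m
      N≤ p = ℕ.m⊔n≤o⇒n≤o M N (ℕ.m⊔n≤o⇒n≤o (K ℕ.⊔ L) (M ℕ.⊔ N) p)

    go : Bounded x → Bounded y →
         ∃[ N ] ∀ {m n} → N ℕ.≤ m → N ℕ.≤ n → ℚ.∣ x m ℚ.* y m ℚ.- x n ℚ.* y n ∣ ℚ.≤ ε
    go (A , 0<A , K , hA) (B , 0<B , L , hB) =
      close hA hB (shrink (0<½* 0<ε) 0<A) (shrink (0<½* 0<ε) 0<B)

open Cauchy-Lemmas

fromℚ : ℚ → ℝ
fromℚ q = mkℝ (λ _ → q) (const-cauchy q)

fromℕ : ℕ → ℝ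
fromℕ n = fromℚ (fromℕℚ n)

0ℝ : ℝ
0ℝ = fromℕ 0

infix  8 -_
infixl 7 _*_
infixl 6 _+_ _-_

_+_ : ℝ → ℝ → ℝ
x + y = mkℝ (λ n → seq x n ℚ.+ seq y n) (+-cauchy {seq x} {seq y} (cauchy x) (cauchy y))

-_ : ℝ → ℝ
- x = mkℝ (λ n → ℚ.- seq x n) (neg-cauchy {seq x} (cauchy x))

_-_ : ℝ → ℝ → ℝ
x - y = x + - y

_*_ : ℝ → ℝ → ℝ
x * y = mkℝ (λ n → seq x n ℚ.* seq y n) (*-cauchy {seq x} {seq y} (cauchy x) (cauchy y))

∣_∣ : ℝ → ℝ
∣ x ∣ = mkℝ (λ n → ℚ.∣ seq x n ∣) (abs-cauchy {seq x} (cauchy x))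

------------------------------------------------------------------------
-- Roots

-- The largest j ≤ k satisfying P, or 0 if there is none.
largest : {P : ℕ → Set} → (∀ j → Dec (P j)) → ℕ → ℕ
largest P? zero    = 0
largest P? (suc k) with P? (suc k)
... | yes _ = suc k
... | no  _ = largest P? k

-- The d-th root of y, rounded down to a multiple j / (m + 1) of 1 / (m + 1); it
-- is 0 for y < 0.  The bound on j loses nothing since y < ∣ numerator y ∣ + 1.
rootNumerator : (d : ℕ) (y : ℚ) (m : ℕ) → ℕ
rootNumerator d y m =
  largest (λ j → (+ j ℚ./ suc m) ^ℚ d ℚ.≤? y) (suc ℤ.∣ ℚ.↥ y ∣ ℕ.* suc m)

rootApprox : (d : ℕ) (y : ℚ) (m : ℕ) → ℚ
rootApprox d y m = + rootNumerator d y m ℚ./ suc m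

module Root-Lemmas where
 abstract

  largest-lower : ∀ {P : ℕ → Set} (P? : ∀ j → Dec (P j)) k → largest P? k ≡ 0 ⊎ P (largest P? k)
  largest-lower P? zero = inj₁ refl
  largest-lower P? (suc k) with P? (suc k)
  ... | yes p = inj₂ p
  ... | no  _ = largest-lower P? k

  largest-upper : ∀ {P : ℕ → Set} (P? : ∀ j → Dec (P j)) k → ¬ P (suc k) → ¬ P (suc (largest P? k))
  largest-upper P? zero ¬p = ¬p
  largest-upper P? (suc k) ¬p with P? (suc k)
  ... | yes _  = ¬p
  ... | no ¬p′ = largest-upper P? k ¬p′

  rootApprox-nonNeg : ∀ d y m → 0ℚ ℚ.≤ rootApprox d y m
  rootApprox-nonNeg d y m = 0≤/ (rootNumerator d y m) m

  rootApprox-lower : ∀ d y m → rootApprox d y m ≡ 0ℚ ⊎ rootApprox d y m ^ℚ d ℚ.≤ y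
  rootApprox-lower d y m =
    go (largest-lower (λ j → (+ j ℚ./ suc m) ^ℚ d ℚ.≤? y) (suc ℤ.∣ ℚ.↥ y ∣ ℕ.* suc m))
    where
    go : ∀ {j} → j ≡ 0 ⊎ (+ j ℚ./ suc m) ^ℚ d ℚ.≤ y →
         + j ℚ./ suc m ≡ 0ℚ ⊎ (+ j ℚ./ suc m) ^ℚ d ℚ.≤ y
    go (inj₁ refl) = inj₁ (/-cong-≡ {0} {0} {m} {0} refl)
    go (inj₂ h)    = inj₂ h

  rootApprox-upper : ∀ d .{{_ : NonZero d}} y m → y ℚ.< (rootApprox d y m ℚ.+ 1/1+ m) ^ℚ d
  rootApprox-upper d y m = subst (λ z → y ℚ.< z ^ℚ d) (/-suc (rootNumerator d y m) m)
    (ℚ.≰⇒> (largest-upper (λ j → (+ j ℚ./ suc m) ^ℚ d ℚ.≤? y) K (λ h → ℚ.<-irrefl refl (ℚ.<-≤-trans y< h))))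
    where
    open ℚ.≤-Reasoning
    B K : ℕ
    B = suc ℤ.∣ ℚ.↥ y ∣
    K = B ℕ.* suc m
    y< : y ℚ.< (+ suc K ℚ./ suc m) ^ℚ d
    y< = begin-strict
      y                          <⟨ <-numerator y ⟩
      fromℕℚ B                   ≤⟨ ≤^ d (/-mono {1} {B} {0} {0} (ℕ.s≤s ℕ.z≤n)) ⟩
      fromℕℚ B ^ℚ d              ≤⟨ ^-mono-≤ d (0≤/ B 0) (/-mono {B} {suc K} {0} {m}
                                      (ℕ.≤-trans (ℕ.n≤1+n K) (ℕ.≤-reflexive (sym (ℕ.*-identityʳ (suc K)))))) ⟩
      (+ suc K ℚ./ suc m) ^ℚ d   ∎

  rootApprox-close : ∀ d .{{_ : NonZero d}} y z m n ε → 0ℚ ℚ.≤ ε → z ℚ.≤ y ℚ.+ ε ^ℚ d →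
                     rootApprox d z n ℚ.≤ rootApprox d y m ℚ.+ (1/1+ m ℚ.+ ε)
  rootApprox-close d y z m n ε 0≤ε z≤ = go (rootApprox d y m) (1/1+ m) (rootApprox d z n)
    (rootApprox-nonNeg d y m) (0≤/ 1 m) (rootApprox-upper d y m) (rootApprox-lower d z n)
    where
    open ℚ.≤-Reasoning
    go : ∀ α η β → 0ℚ ℚ.≤ α → 0ℚ ℚ.≤ η → y ℚ.< (α ℚ.+ η) ^ℚ d → β ≡ 0ℚ ⊎ β ^ℚ d ℚ.≤ z →
         β ℚ.≤ α ℚ.+ (η ℚ.+ ε)
    go α η β 0≤α 0≤η y< (inj₁ refl) = 0≤+ 0≤α (0≤+ 0≤η 0≤ε)
    go α η β 0≤α 0≤η y< (inj₂ h)    = ℚ.≮⇒≥ λ lt → ℚ.<-irrefl refl (begin-strict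
      β ^ℚ d                        ≤⟨ h ⟩
      z                             ≤⟨ z≤ ⟩
      y ℚ.+ ε ^ℚ d                  <⟨ ℚ.+-monoˡ-< (ε ^ℚ d) y< ⟩
      (α ℚ.+ η) ^ℚ d ℚ.+ ε ^ℚ d     ≤⟨ ^-superadditive d (0≤+ 0≤α 0≤η) 0≤ε ⟩
      ((α ℚ.+ η) ℚ.+ ε) ^ℚ d        ≡⟨ cong (_^ℚ d) (ℚ.+-assoc α η ε) ⟩
      (α ℚ.+ (η ℚ.+ ε)) ^ℚ d        ≤⟨ ^-mono-≤ d (0≤+ 0≤α (0≤+ 0≤η 0≤ε)) (ℚ.<⇒≤ lt) ⟩
      β ^ℚ d                        ∎)

  root-cauchy : ∀ d .{{_ : NonZero d}} {x} → Cauchy x → Cauchy (λ m → rootApprox d (x m) m)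
  root-cauchy d {x} cx {ε} 0<ε = M ℕ.⊔ N , λ {m} {n} p q →
    ≤⇒∣-∣ (rootApprox d (x m) m) (rootApprox d (x n) n) ε (close q p) (close p q)
    where
    0<½ε : 0ℚ ℚ.< ½ ℚ.* ε
    0<½ε = 0<½* 0<ε
    M N : ℕ
    M = proj₁ (cx (^-pos d 0<½ε))
    N = proj₁ (archimedean 0<½ε)
    close : ∀ {m n} → M ℕ.⊔ N ℕ.≤ m → M ℕ.⊔ N ℕ.≤ n →
            rootApprox d (x n) n ℚ.≤ rootApprox d (x m) m ℚ.+ ε
    close {m} {n} p q = ℚ.≤-trans
      (rootApprox-close d (x m) (x n) m n (½ ℚ.* ε) (ℚ.<⇒≤ 0<½ε)
        (∣-∣⇒≤ (x n) (x m) ((½ ℚ.* ε) ^ℚ d)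
          (proj₂ (cx (^-pos d 0<½ε)) (ℕ.m⊔n≤o⇒m≤o M N q) (ℕ.m⊔n≤o⇒m≤o M N p))))
      (ℚ.+-monoʳ-≤ (rootApprox d (x m) m) (ℚ.≤-trans
        (ℚ.+-monoˡ-≤ (½ ℚ.* ε)
          (ℚ.≤-trans (1/1+-antitone N m (ℕ.m⊔n≤o⇒n≤o M N p)) (proj₂ (archimedean 0<½ε))))
        (ℚ.≤-reflexive (½+½ ε))))

open Root-Lemmas

-- The non-negative d-th root (0 on negative reals).
root : (d : ℕ) .{{_ : NonZero d}} → ℝ → ℝ
root d x = mkℝ (λ m → rootApprox d (seq x m) m) (root-cauchy d {seq x} (cauchy x))

infix 9 √_
infix 10 _^-⅓

√_ : ℝ → ℝ
√ x = root 2 x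

_^-⅓ : (n : ℕ) .{{_ : NonZero n}} → ℝ
n ^-⅓ = root 3 (fromℚ (+ 1 ℚ./ n))

------------------------------------------------------------------------
-- The natural logarithm

sumℚ : ℕ → (ℕ → ℚ) → ℚ
sumℚ zero    f = 0ℚ
sumℚ (suc k) f = sumℚ k f ℚ.+ f k

-- The lower Riemann sum of ∫ dx / x over [ 1 , w + 1 ] with mesh h = 2 ^ -t,
-- whose j-th term is h * 1 / (1 + (j + 1) * h).
logApprox : (w t : ℕ) → ℚ
logApprox w t = sumℚ (w ℕ.* 2 ℕ.^ t) (λ j → 1/1+ (2 ℕ.^ t ℕ.+ j))

module Log-Lemmas where
 abstract

  1/1+-halve : ∀ m → 1/1+ m ≡ 1/1+ (suc (2 ℕ.* m)) ℚ.+ 1/1+ (suc (2 ℕ.* m))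
  1/1+-halve m = trans
    (/-cong-≡ {1} {2} {m} {suc (2 ℕ.* m)} (solve 1 (λ m → con 1 :* (con 2 :+ con 2 :* m) := con 2 :* (con 1 :+ m)) refl m))
    (/-suc 1 (suc (2 ℕ.* m)))
    where open ℕ-Solver

  private
    fine coarse : ℕ → ℕ → ℚ
    fine   M k = sumℚ (k ℕ.* 2) (λ i → 1/1+ (2 ℕ.* suc M ℕ.+ i))
    coarse M k = sumℚ k (λ j → 1/1+ (suc M ℕ.+ j))

    index₁ : ∀ M k → 2 ℕ.* suc M ℕ.+ k ℕ.* 2 ≡ 2 ℕ.+ 2 ℕ.* (M ℕ.+ k)
    index₁ = solve 2 (λ M k → con 2 :* (con 1 :+ M) :+ k :* con 2 := con 2 :+ con 2 :* (M :+ k)) refl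
      where open ℕ-Solver

    index₂ : ∀ M k → 2 ℕ.* suc M ℕ.+ suc (k ℕ.* 2) ≡ suc (2 ℕ.* suc (M ℕ.+ k))
    index₂ = solve 2 (λ M k → con 2 :* (con 1 :+ M) :+ (con 1 :+ k :* con 2) := con 1 :+ con 2 :* (con 1 :+ (M :+ k))) refl
      where open ℕ-Solver

    fine-suc : ∀ M k → fine M (suc k) ≡
      fine M k ℚ.+ 1/1+ (2 ℕ.+ 2 ℕ.* (M ℕ.+ k)) ℚ.+ 1/1+ (suc (2 ℕ.* suc (M ℕ.+ k)))
    fine-suc M k = cong₂ (λ i j → fine M k ℚ.+ 1/1+ i ℚ.+ 1/1+ j) (index₁ M k) (index₂ M k)

    coarse-suc : ∀ M k → coarse M (suc k) ≡
      coarse M k ℚ.+ (1/1+ (suc (2 ℕ.* suc (M ℕ.+ k))) ℚ.+ 1/1+ (suc (2 ℕ.* suc (M ℕ.+ k))))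
    coarse-suc M k = cong (coarse M k ℚ.+_) (1/1+-halve (suc (M ℕ.+ k)))

    coarse≤fine : ∀ M k → coarse M k ℚ.≤ fine M k
    coarse≤fine M zero = ℚ.≤-refl
    coarse≤fine M (suc k) = begin
      coarse M (suc k)                 ≡⟨ coarse-suc M k ⟩
      coarse M k ℚ.+ (s ℚ.+ s)         ≤⟨ ℚ.+-mono-≤ (coarse≤fine M k) (ℚ.+-monoˡ-≤ s (1/1+-antitone i j i≤j)) ⟩
      fine M k ℚ.+ (r ℚ.+ s)           ≡⟨ sym (ℚ.+-assoc (fine M k) r s) ⟩
      fine M k ℚ.+ r ℚ.+ s             ≡⟨ sym (fine-suc M k) ⟩
      fine M (suc k)                   ∎
      where
      open ℚ.≤-Reasoning
      i j : ℕ
      i = 2 ℕ.+ 2 ℕ.* (M ℕ.+ k)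
      j = suc (2 ℕ.* suc (M ℕ.+ k))
      r s : ℚ
      r = 1/1+ i
      s = 1/1+ j
      i≤j : i ℕ.≤ j
      i≤j = ℕ.≤-trans (ℕ.≤-reflexive (sym (ℕ.*-suc 2 (M ℕ.+ k)))) (ℕ.n≤1+n _)

    fine≤coarse : ∀ M k → fine M k ℚ.+ 1/1+ (suc (2 ℕ.* (M ℕ.+ k))) ℚ.≤ coarse M k ℚ.+ 1/1+ (suc (2 ℕ.* M))
    fine≤coarse M zero = ℚ.≤-reflexive (cong (λ m → 0ℚ ℚ.+ 1/1+ (suc (2 ℕ.* m))) (ℕ.+-identityʳ M))
    fine≤coarse M (suc k) = begin
      fine M (suc k) ℚ.+ 1/1+ (suc (2 ℕ.* (M ℕ.+ suc k)))
        ≡⟨ cong₂ ℚ._+_ (fine-suc M k) (cong (λ m → 1/1+ (suc (2 ℕ.* m))) (ℕ.+-suc M k)) ⟩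
      fine M k ℚ.+ r ℚ.+ s ℚ.+ s
        ≤⟨ ℚ.+-monoˡ-≤ s (ℚ.+-monoˡ-≤ s (ℚ.+-monoʳ-≤ (fine M k) (1/1+-antitone (suc (2 ℕ.* (M ℕ.+ k))) (2 ℕ.+ 2 ℕ.* (M ℕ.+ k)) (ℕ.n≤1+n _)))) ⟩
      fine M k ℚ.+ 1/1+ (suc (2 ℕ.* (M ℕ.+ k))) ℚ.+ s ℚ.+ s
        ≤⟨ ℚ.+-monoˡ-≤ s (ℚ.+-monoˡ-≤ s (fine≤coarse M k)) ⟩
      coarse M k ℚ.+ u ℚ.+ s ℚ.+ s
        ≡⟨ solve 3 (λ c u s → c :+ u :+ s :+ s := c :+ (s :+ s) :+ u) refl (coarse M k) u s ⟩
      coarse M k ℚ.+ (s ℚ.+ s) ℚ.+ u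
        ≡⟨ cong (ℚ._+ u) (sym (coarse-suc M k)) ⟩
      coarse M (suc k) ℚ.+ u ∎
      where
      open ℚ.≤-Reasoning
      open ℚ-Solver
      r s u : ℚ
      r = 1/1+ (2 ℕ.+ 2 ℕ.* (M ℕ.+ k))
      s = 1/1+ (suc (2 ℕ.* suc (M ℕ.+ k)))
      u = 1/1+ (suc (2 ℕ.* M))

    pred-2^ : ℕ → ℕ
    pred-2^ t = ℕ.pred (2 ℕ.^ t)

    suc-pred-2^ : ∀ t → 2 ℕ.^ t ≡ suc (pred-2^ t)
    suc-pred-2^ t = sym (ℕ.suc-pred (2 ℕ.^ t) {{ℕ.m^n≢0 2 t}})

    pred-2^-suc : ∀ t → pred-2^ (suc t) ≡ suc (2 ℕ.* pred-2^ t)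
    pred-2^-suc t = cong ℕ.pred (trans (cong (2 ℕ.*_) (suc-pred-2^ t)) (ℕ.*-suc 2 (pred-2^ t)))

    logApprox≡coarse : ∀ w t → logApprox w t ≡ coarse (pred-2^ t) (w ℕ.* 2 ℕ.^ t)
    logApprox≡coarse w t = cong (λ z → sumℚ (w ℕ.* 2 ℕ.^ t) (λ j → 1/1+ (z ℕ.+ j))) (suc-pred-2^ t)

    logApprox≡fine : ∀ w t → logApprox w (suc t) ≡ fine (pred-2^ t) (w ℕ.* 2 ℕ.^ t)
    logApprox≡fine w t = cong₂ (λ k z → sumℚ k (λ j → 1/1+ (2 ℕ.* z ℕ.+ j)))
      (solve 2 (λ w z → w :* (con 2 :* z) := w :* z :* con 2) refl w (2 ℕ.^ t)) (suc-pred-2^ t)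
      where open ℕ-Solver

  logApprox-mono-suc : ∀ w t → logApprox w t ℚ.≤ logApprox w (suc t)
  logApprox-mono-suc w t = subst₂ ℚ._≤_ (sym (logApprox≡coarse w t)) (sym (logApprox≡fine w t))
    (coarse≤fine (pred-2^ t) (w ℕ.* 2 ℕ.^ t))

  logApprox-upper-suc : ∀ w t → logApprox w (suc t) ℚ.+ 1/1+ (ℕ.pred (2 ℕ.^ suc t)) ℚ.≤
                                logApprox w t ℚ.+ 1/1+ (ℕ.pred (2 ℕ.^ t))
  logApprox-upper-suc w t = begin
    logApprox w (suc t) ℚ.+ 1/1+ (pred-2^ (suc t))   ≡⟨ cong₂ ℚ._+_ (logApprox≡fine w t) (cong 1/1+_ (pred-2^-suc t)) ⟩
    fine P k ℚ.+ u                                   ≤⟨ ℚ.+-monoˡ-≤ u (≤-+ʳ (fine P k) (1/1+ (suc (2 ℕ.* (P ℕ.+ k)))) (0≤/ 1 (suc (2 ℕ.* (P ℕ.+ k))))) ⟩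
    fine P k ℚ.+ 1/1+ (suc (2 ℕ.* (P ℕ.+ k))) ℚ.+ u  ≤⟨ ℚ.+-monoˡ-≤ u (fine≤coarse P k) ⟩
    coarse P k ℚ.+ u ℚ.+ u                           ≡⟨ ℚ.+-assoc (coarse P k) u u ⟩
    coarse P k ℚ.+ (u ℚ.+ u)                         ≡⟨ cong₂ ℚ._+_ (sym (logApprox≡coarse w t)) (sym (1/1+-halve P)) ⟩
    logApprox w t ℚ.+ 1/1+ P                         ∎
    where
    open ℚ.≤-Reasoning
    P k : ℕ
    P = pred-2^ t
    k = w ℕ.* 2 ℕ.^ t
    u : ℚ
    u = 1/1+ (suc (2 ℕ.* P))

  logApprox-mono : ∀ w t s → logApprox w t ℚ.≤ logApprox w (s ℕ.+ t)
  logApprox-mono w t zero    = ℚ.≤-refl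
  logApprox-mono w t (suc s) = ℚ.≤-trans (logApprox-mono w t s) (logApprox-mono-suc w (s ℕ.+ t))

  logApprox-upper : ∀ w t s → logApprox w (s ℕ.+ t) ℚ.≤ logApprox w t ℚ.+ 1/1+ (ℕ.pred (2 ℕ.^ t))
  logApprox-upper w t s = ℚ.≤-trans (≤-+ʳ (logApprox w (s ℕ.+ t)) (1/1+ (ℕ.pred (2 ℕ.^ (s ℕ.+ t)))) (0≤/ 1 (ℕ.pred (2 ℕ.^ (s ℕ.+ t))))) (go s)
    where
    go : ∀ s → logApprox w (s ℕ.+ t) ℚ.+ 1/1+ (ℕ.pred (2 ℕ.^ (s ℕ.+ t))) ℚ.≤ logApprox w t ℚ.+ 1/1+ (ℕ.pred (2 ℕ.^ t))
    go zero    = ℚ.≤-refl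
    go (suc s) = ℚ.≤-trans (logApprox-upper-suc w (s ℕ.+ t)) (go s)

  ≤pred-2^ : ∀ t → t ℕ.≤ ℕ.pred (2 ℕ.^ t)
  ≤pred-2^ zero    = ℕ.z≤n
  ≤pred-2^ (suc t) = ℕ.≤-trans (ℕ.s≤s (ℕ.≤-trans (≤pred-2^ t) (ℕ.m≤m+n _ _))) (ℕ.≤-reflexive (sym (pred-2^-suc t)))

  log-cauchy : ∀ w → Cauchy (logApprox w)
  log-cauchy w {ε} 0<ε with archimedean 0<ε
  ... | N , hN = N , λ {m} {n} p q → ordered m n p q (ℕ.≤-total m n)
    where
    close : ∀ {m} s → N ℕ.≤ m → ℚ.∣ logApprox w m ℚ.- logApprox w (s ℕ.+ m) ∣ ℚ.≤ ε
    close {m} s p = ≤⇒∣-∣ (logApprox w m) (logApprox w (s ℕ.+ m)) ε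
      (ℚ.≤-trans (logApprox-mono w m s) (≤-+ʳ (logApprox w (s ℕ.+ m)) ε (ℚ.<⇒≤ 0<ε)))
      (ℚ.≤-trans (logApprox-upper w m s) (ℚ.+-monoʳ-≤ (logApprox w m)
        (ℚ.≤-trans (1/1+-antitone N (ℕ.pred (2 ℕ.^ m)) (ℕ.≤-trans p (≤pred-2^ m))) hN)))
    ordered : ∀ m n → N ℕ.≤ m → N ℕ.≤ n → m ℕ.≤ n ⊎ n ℕ.≤ m → ℚ.∣ logApprox w m ℚ.- logApprox w n ∣ ℚ.≤ ε
    ordered m n p q (inj₁ m≤n) = subst (λ z → ℚ.∣ logApprox w m ℚ.- logApprox w z ∣ ℚ.≤ ε)
      (ℕ.m∸n+n≡m m≤n) (close (n ℕ.∸ m) p)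
    ordered m n p q (inj₂ n≤m) = subst (ℚ._≤ ε) (∣-∣-comm (logApprox w n) (logApprox w m))
      (subst (λ z → ℚ.∣ logApprox w n ℚ.- logApprox w z ∣ ℚ.≤ ε) (ℕ.m∸n+n≡m n≤m) (close (m ℕ.∸ n) q))

open Log-Lemmas

-- log n = ∫₁ⁿ dx / x
log : (n : ℕ) .{{_ : NonZero n}} → ℝ
log n = mkℝ (logApprox (ℕ.pred n)) (log-cauchy (ℕ.pred n))

------------------------------------------------------------------------
-- Graphs

record Graph (n : ℕ) : Set₁ where
  field
    Adj         : Rel (Fin n) 0ℓ
    adj?        : Decidable Adj
    symmetric   : Symmetric Adj
    irreflexive : Irreflexive _≡_ Adj

open Graph public

TriangleFree : ∀ {n} → Graph n → Set
TriangleFree G = ∀ {u v w} → Adj G u v → Adj G v w → ¬ Adj G w u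

-- Every edge {u , v} is listed once, as the pair with u < v.
edgesIn : ∀ {n} → Graph n → Subset n → List (Fin n × Fin n)
edgesIn {n} G X = filter
  (λ (u , v) → u Fin.<? v ×-dec u ∈? X ×-dec v ∈? X ×-dec adj? G u v)
  (cartesianProduct (allFin n) (allFin n))

e : ∀ {n} → Graph n → Subset n → ℕ
e G X = length (edgesIn G X)

Jumbled : ∀ {n} → Graph n → ℝ → ℝ → Set
Jumbled G p β = ∀ X →
  ∣ fromℕ (e G X) - p * fromℕ (Subset.∣ X ∣ C 2) ∣ ≤ β * fromℕ Subset.∣ X ∣

TendsToInfinity : (ℕ → ℕ) → Set
TendsToInfinity n = ∀ N → ∃[ i₀ ] ∀ {i} → i₀ ℕ.≤ i → N ℕ.≤ n i

{-# OPTIONS --safe #-}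
module Submission where

-- Let F be the field with q = 2^k elements and ℓ : F → 𝔽₂ additive with ℓ 1 = 1.  The
-- graph is the Cayley graph on F³ whose connection set consists of the points
-- (t , t w , t w²) with ℓ (t w³) = 1.  Three of these cannot sum to zero: ∑ tᵢ, ∑ tᵢ wᵢ
-- and ∑ tᵢ wᵢ² would vanish, hence so would ∑ tᵢ wᵢ³ by Newton's identity, while
-- ℓ (∑ tᵢ wᵢ³) = 1 + 1 + 1 = 1.
--
-- With the characters χ_a(z) = (-1)^ℓ(a ∙ z), the eigenvalue at a = (a₀ , a₁ , a₂) is
-- (q / 2) (Z - O), where Z and O count the roots w of h = a₀ + a₁ w + a₂ w² and of
-- h + w³.  As O ≤ 3 and Z ≤ 2 unless a = 0, where Z = q, Parseval's identity bounds the
-- discrepancy of X from ∣X∣² / 4q edges by a multiple of q ∣X∣.  So n = q³, p = 1 / 2q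
-- and β = q will do.

open import Defs
open import Data.Nat.Base using (ℕ; NonZero)
open import Data.Product.Base using (Σ-syntax; ∃-syntax; _×_)

open import Algebra.Bundles using (CommutativeRing; RawRing)
open import Algebra.Core using (Op₂)
import Algebra.Definitions.RawSemiring
import Algebra.Properties.Semiring.Sum
import Algebra.Solver.Ring
open import Algebra.Solver.Ring.AlmostCommutativeRing
  using (fromCommutativeRing; _-Raw-AlmostCommutative⟶_; Induced-equivalence)
open import Algebra.Structures using (IsCommutativeRing)
open import Data.Bool.Base using (Bool; true; false; if_then_else_; _xor_)
import Data.Bool.Properties as Bool
open import Data.Fin.Base using (Fin; zero; suc)
import Data.Fin.Properties as Fin
open import Data.Fin.Subset as Subset using (Subset)
open import Data.Fin.Subset.Properties using (_∈?_)
open import Data.Integer.Base as ℤ using (ℤ; +_; 0ℤ; 1ℤ)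
import Data.Integer.Properties as ℤ
open import Data.Integer.Solver using () renaming (module +-*-Solver to ℤS)
open import Data.List.Base
  using (List; []; _∷_; _++_; map; foldr; tabulate; length; filter; allFin; cartesianProduct)
open import Data.Maybe.Base using (just; nothing)
open import Data.Nat.Base as ℕ using (zero; suc)
open import Data.Nat.Combinatorics using (_C_; nC1≡n; nCk+nC[k+1]≡[n+1]C[k+1])
import Data.Nat.Properties as ℕ
open import Data.Nat.Solver using () renaming (module +-*-Solver to ℕ-Solver)
open import Data.Product.Base using (∃; _,_; proj₁; proj₂)
open import Data.Product.Function.NonDependent.Propositional using (_×-↔_)
open import Data.Rational.Base as ℚ using (ℚ; 0ℚ; 1ℚ; ½)
import Data.Rational.Properties as ℚ
open import Data.Rational.Solver using () renaming (module +-*-Solver to ℚ-Solver)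
open import Data.Sum.Base using (_⊎_; inj₁; inj₂)
open import Data.Vec.Base using (Vec; []; _∷_)
open import Function.Base using (_∘_; id)
open import Function.Bundles using (_↔_; mk↔ₛ′; module Inverse)
open import Function.Construct.Identity using (↔-id)
open import Function.Properties.Inverse using (↔-sym; ↔⇒↣; ↔-trans)
open import Relation.Binary.Definitions using (DecidableEquality; WeaklyDecidable; tri<; tri≈; tri>)
open import Relation.Binary.PropositionalEquality
open import Relation.Nullary using (¬_; Dec; yes; no; does; contradiction)
open import Relation.Nullary.Decidable using (_×-dec_; map′; via-injection; dec-true; dec-false)

-- Finite sums of integers

-- Each of three parameters `wᵢ` satisfies the same cubic recurrence, which needs three consecutive
-- moments to yield the next one; this fixes the number of coordinates at three. About half of the
-- q² pairs (t , w) are used, so the degree is about q² / 2 on q³ vertices, a density of order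
-- n^(-1/3), while the nontrivial eigenvalues have order q, the order of the square root of the
-- degree.
--
-- The additive group has exponent 2, so every character has values 1 and -1 and no complex numbers
-- occur. With indicators doubled and identities multiplied by `N`, the Fourier analysis stays
-- inside ℤ; denominators return only with p = 1 / 2q.
--
-- Only infinitely many values of q are required. Repeated quadratic Artin-Schreier extensions of 𝔽₂
-- supply them explicitly, with no search for irreducible polynomials of high degree.
--
-- As p is half of n^(-1/3), c = 1/2 works; C = 8 pays for rounding the square root and for bounding
-- the logarithm below by 1/2.

module Sum = Algebra.Properties.Semiring.Sum ℤ.+-*-semiring

𝟙 : {P : Set} → Dec P → ℤ
𝟙 d = if does d then 1ℤ else 0ℤ

module _ {P : Set} where

  𝟙-yes : (d : Dec P) → P → 𝟙 d ≡ 1ℤ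
  𝟙-yes d p = cong (if_then 1ℤ else 0ℤ) (dec-true d p)

  𝟙-no : (d : Dec P) → ¬ P → 𝟙 d ≡ 0ℤ
  𝟙-no d ¬p = cong (if_then 1ℤ else 0ℤ) (dec-false d ¬p)

  0≤𝟙 : (d : Dec P) → 0ℤ ℤ.≤ 𝟙 d
  0≤𝟙 (yes _) = ℤ.+≤+ ℕ.z≤n
  0≤𝟙 (no _)  = ℤ.≤-refl

module _ {P Q : Set} where

  𝟙-⇔ : (P → Q) → (Q → P) → (d : Dec P) (d′ : Dec Q) → 𝟙 d ≡ 𝟙 d′
  𝟙-⇔ f g (yes p) d′ = sym (𝟙-yes d′ (f p))
  𝟙-⇔ f g (no ¬p) d′ = sym (𝟙-no d′ (¬p ∘ g))

  𝟙-×-dec : (d : Dec P) (d′ : Dec Q) → 𝟙 (d ×-dec d′) ≡ 𝟙 d ℤ.* 𝟙 d′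
  𝟙-×-dec (yes _) d′ = sym (ℤ.*-identityˡ (𝟙 d′))
  𝟙-×-dec (no _)  d′ = refl

-- A bijection with `Fin size`, not a list without repetitions: equality, exhaustive search and
-- re-indexing of sums all transport along it.
record Finite (A : Set) : Set where
  field
    size        : ℕ
    enumeration : Fin size ↔ A

  open Inverse enumeration public using () renaming
    (to to element; from to index; strictlyInverseˡ to element-index; strictlyInverseʳ to index-element)

  infix 4 _≟_

  abstract
    _≟_ : DecidableEquality A
    _≟_ = via-injection (↔⇒↣ (↔-sym enumeration)) Fin._≟_

    ∃? : {P : A → Set} → (∀ a → Dec (P a)) → Dec (∃ P)
    ∃? {P} P? = map′ (λ (i , p) → element i , p) (λ (a , p) → index a , subst P (sym (element-index a)) p)
      (Fin.any? (P? ∘ element))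

open Finite using (size)

finite-Fin : ∀ n → Finite (Fin n)
finite-Fin n = record { enumeration = ↔-id (Fin n) }

finite-Bool : Finite Bool
finite-Bool = record { enumeration = Fin.2↔Bool }

finite-× : ∀ {A B} → Finite A → Finite B → Finite (A × B)
finite-× 𝐀 𝐁 = record
  { enumeration = ↔-trans Fin.*↔× (Finite.enumeration 𝐀 ×-↔ Finite.enumeration 𝐁) }

infixl 8 ∑
syntax ∑ 𝐀 (λ a → x) = ∑[ a ∈ 𝐀 ] x

abstract
  ∑ : ∀ {A} → Finite A → (A → ℤ) → ℤ
  ∑ 𝐀 f = Sum.sum (f ∘ Finite.element 𝐀)

  ∑-Fin : ∀ {n} (f : Fin n → ℤ) → ∑ (finite-Fin n) f ≡ Sum.sum f
  ∑-Fin f = refl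

  ∑-element : ∀ {A} (𝐀 : Finite A) (f : A → ℤ) → ∑ 𝐀 f ≡ ∑[ i ∈ finite-Fin (size 𝐀) ] f (Finite.element 𝐀 i)
  ∑-element 𝐀 f = refl

sum-𝟙 : ∀ {n} (j : Fin n) (f : Fin n → ℤ) → Sum.sum (λ i → 𝟙 (i Fin.≟ j) ℤ.* f i) ≡ f j
sum-𝟙 {suc n} zero f = begin
  1ℤ ℤ.* f zero ℤ.+ Sum.sum {n} (λ _ → 0ℤ)  ≡⟨ cong₂ ℤ._+_ (ℤ.*-identityˡ (f zero)) (Sum.sum-replicate-zero n) ⟩
  f zero ℤ.+ 0ℤ                             ≡⟨ ℤ.+-identityʳ (f zero) ⟩
  f zero                                    ∎
  where open ≡-Reasoning
sum-𝟙 {suc n} (suc j) f = trans (ℤ.+-identityˡ _) (sum-𝟙 j (f ∘ suc))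

sum-mono : ∀ {n} {f g : Fin n → ℤ} → (∀ i → f i ℤ.≤ g i) → Sum.sum f ℤ.≤ Sum.sum g
sum-mono {zero}  f≤g = ℤ.≤-refl
sum-mono {suc n} f≤g = ℤ.+-mono-≤ (f≤g zero) (sum-mono (f≤g ∘ suc))

sum-const : ∀ n (c : ℤ) → Sum.sum {n} (λ _ → c) ≡ + n ℤ.* c
sum-const zero    c = refl
sum-const (suc n) c = begin
  c ℤ.+ Sum.sum {n} (λ _ → c)  ≡⟨ cong (ℤ._+_ c) (sum-const n c) ⟩
  c ℤ.+ + n ℤ.* c              ≡⟨ ℤ.suc-* (+ n) c ⟨
  + suc n ℤ.* c                ∎
  where open ≡-Reasoning

module _ {A : Set} {𝐀 : Finite A} where

 open Finite 𝐀 using (element; index; element-index; index-element; _≟_)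

 abstract
  ∑-cong : {f g : A → ℤ} → (∀ a → f a ≡ g a) → ∑ 𝐀 f ≡ ∑ 𝐀 g
  ∑-cong f≗g = Sum.sum-cong-≗ (f≗g ∘ element)

  ∑-+ : (f g : A → ℤ) → ∑[ a ∈ 𝐀 ] (f a ℤ.+ g a) ≡ ∑ 𝐀 f ℤ.+ ∑ 𝐀 g
  ∑-+ f g = Sum.∑-distrib-+ (f ∘ element) (g ∘ element)

  ∑-*ˡ : (c : ℤ) (f : A → ℤ) → ∑[ a ∈ 𝐀 ] (c ℤ.* f a) ≡ c ℤ.* ∑ 𝐀 f
  ∑-*ˡ c f = sym (Sum.*-distribˡ-sum c (f ∘ element))

  ∑-*ʳ : (c : ℤ) (f : A → ℤ) → ∑[ a ∈ 𝐀 ] (f a ℤ.* c) ≡ ∑ 𝐀 f ℤ.* c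
  ∑-*ʳ c f = sym (Sum.*-distribʳ-sum c (f ∘ element))

  ∑-neg : (f : A → ℤ) → ∑[ a ∈ 𝐀 ] (ℤ.- f a) ≡ ℤ.- ∑ 𝐀 f
  ∑-neg f = begin
    ∑[ a ∈ 𝐀 ] (ℤ.- f a)           ≡⟨ ∑-cong (λ a → ℤ.-1*i≡-i (f a)) ⟨
    ∑[ a ∈ 𝐀 ] (ℤ.-1ℤ ℤ.* f a)     ≡⟨ ∑-*ˡ ℤ.-1ℤ f ⟩
    ℤ.-1ℤ ℤ.* ∑ 𝐀 f                ≡⟨ ℤ.-1*i≡-i (∑ 𝐀 f) ⟩
    ℤ.- ∑ 𝐀 f                      ∎
    where open ≡-Reasoning

  ∑-- : (f g : A → ℤ) → ∑[ a ∈ 𝐀 ] (f a ℤ.- g a) ≡ ∑ 𝐀 f ℤ.- ∑ 𝐀 g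
  ∑-- f g = trans (∑-+ f (λ a → ℤ.- g a)) (cong (ℤ._+_ (∑ 𝐀 f)) (∑-neg g))

  ∑-mono : {f g : A → ℤ} → (∀ a → f a ℤ.≤ g a) → ∑ 𝐀 f ℤ.≤ ∑ 𝐀 g
  ∑-mono f≤g = sum-mono (f≤g ∘ element)

  ∑-const : (c : ℤ) → ∑[ _ ∈ 𝐀 ] c ≡ + size 𝐀 ℤ.* c
  ∑-const = sum-const (size 𝐀)

  ∑-zero : {f : A → ℤ} → (∀ a → f a ≡ 0ℤ) → ∑ 𝐀 f ≡ 0ℤ
  ∑-zero f≗0 = trans (∑-cong f≗0) (Sum.sum-replicate-zero (size 𝐀))

  ∑-𝟙 : (b : A) (f : A → ℤ) → ∑[ a ∈ 𝐀 ] (𝟙 (a ≟ b) ℤ.* f a) ≡ f b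
  ∑-𝟙 b f = begin
    ∑[ a ∈ 𝐀 ] (𝟙 (a ≟ b) ℤ.* f a)
      ≡⟨ Sum.sum-cong-≗ (λ i → cong (ℤ._* f (element i)) (𝟙-⇔
           (λ a≡b → trans (sym (index-element i)) (cong index a≡b))
           (λ i≡b → trans (cong element i≡b) (element-index b))
           (element i ≟ b) (i Fin.≟ index b))) ⟩
    Sum.sum (λ i → 𝟙 (i Fin.≟ index b) ℤ.* f (element i))
      ≡⟨ sum-𝟙 (index b) (f ∘ element) ⟩
    f (element (index b))
      ≡⟨ cong f (element-index b) ⟩
    f b ∎
    where open ≡-Reasoning

  -- Turns the existential quantifiers of `S` into sums over t and w, the form that Fourier analysis
  -- can handle.
  ∑-unique : {P : A → Set} (P? : ∀ a → Dec (P a)) → (∀ {a b} → P a → P b → a ≡ b) →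
             (d : Dec (∃ P)) → ∑[ a ∈ 𝐀 ] 𝟙 (P? a) ≡ 𝟙 d
  ∑-unique {P} P? unique (no ¬∃) = ∑-zero (λ a → 𝟙-no (P? a) (λ p → ¬∃ (a , p)))
  ∑-unique {P} P? unique (yes (b , p)) = begin
    ∑[ a ∈ 𝐀 ] 𝟙 (P? a)           
          ≡⟨ ∑-cong (λ a → 𝟙-⇔ (λ p′ → unique p′ p) (λ e → subst P (sym e) p) (P? a) (a ≟ b)) ⟩
    ∑[ a ∈ 𝐀 ] 𝟙 (a ≟ b)           ≡⟨ ∑-cong (λ a → ℤ.*-identityʳ (𝟙 (a ≟ b))) ⟨
    ∑[ a ∈ 𝐀 ] (𝟙 (a ≟ b) ℤ.* 1ℤ)  ≡⟨ ∑-𝟙 b (λ _ → 1ℤ) ⟩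
    1ℤ                             ∎
    where open ≡-Reasoning

  -- Conjugating `σ` by the enumeration gives a permutation of `Fin`. Involutions suffice here
  -- because translations in characteristic 2 are their own inverses.
  ∑-involution : (σ : A → A) → (∀ a → σ (σ a) ≡ a) → (f : A → ℤ) → ∑ 𝐀 (f ∘ σ) ≡ ∑ 𝐀 f
  ∑-involution σ σσ f = sym (trans
    (Sum.sum-permute (f ∘ element) (mk↔ₛ′ τ τ ττ ττ))
    (Sum.sum-cong-≗ (λ i → cong f (element-index (σ (element i))))))
    where
    τ : Fin (size 𝐀) → Fin (size 𝐀)
    τ = index ∘ σ ∘ element
    ττ : ∀ i → τ (τ i) ≡ i
    ττ i = trans (cong (index ∘ σ) (element-index (σ (element i))))
      (trans (cong index (σσ (element i))) (index-element i))

  -- This is how nontrivial character sums vanish: translation by an element on which the character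
  -- is -1 negates every term, so the sum equals its own negative.
  ∑-antiinvariant : (σ : A → A) → (∀ a → σ (σ a) ≡ a) → {f : A → ℤ} → (∀ a → f (σ a) ≡ ℤ.- f a) →
                    ∑ 𝐀 f ≡ 0ℤ
  ∑-antiinvariant σ σσ {f} anti = i≡-i⇒i≡0 (begin
    ∑ 𝐀 f                 ≡⟨ ∑-involution σ σσ f ⟨
    ∑ 𝐀 (f ∘ σ)           ≡⟨ ∑-cong anti ⟩
    ∑[ a ∈ 𝐀 ] (ℤ.- f a)  ≡⟨ ∑-neg f ⟩
    ℤ.- ∑ 𝐀 f             ∎)
    where
    open ≡-Reasoning
    i≡-i⇒i≡0 : ∀ {i} → i ≡ ℤ.- i → i ≡ 0ℤ
    i≡-i⇒i≡0 {+ zero} _ = refl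
    i≡-i⇒i≡0 {+ suc _} ()
    i≡-i⇒i≡0 {ℤ.-[1+ _ ]} ()

abstract
  ∑-swap : ∀ {A B} {𝐀 : Finite A} {𝐁 : Finite B} (f : A → B → ℤ) →
           ∑[ a ∈ 𝐀 ] (∑[ b ∈ 𝐁 ] f a b) ≡ ∑[ b ∈ 𝐁 ] (∑[ a ∈ 𝐀 ] f a b)
  ∑-swap {𝐀 = 𝐀} {𝐁} f = Sum.∑-comm (λ i j → f (Finite.element 𝐀 i) (Finite.element 𝐁 j))

-- Finite fields of characteristic 2

-- A commutative ring of characteristic 2 is one whose negation is the identity.
-- Its solver takes coefficients in 𝔽₂, so that it cancels x ⊕ x.
module Characteristic2 {A : Set} {_⊕_ _·_ : Op₂ A} {0# 1# : A}
  (isCommutativeRing : IsCommutativeRing _≡_ _⊕_ _·_ id 0# 1#) where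

  open IsCommutativeRing isCommutativeRing public
    using (zeroˡ; zeroʳ; *-identityˡ; *-identityʳ; +-identityˡ; +-identityʳ)
    renaming (-‿inverseˡ to x⊕x≡0; *-assoc to ·-assoc; +-comm to ⊕-comm; +-assoc to ⊕-assoc)

  private
    ring : CommutativeRing _ _
    ring = record { isCommutativeRing = isCommutativeRing }

    𝔽₂ : RawRing _ _
    𝔽₂ = CommutativeRing.rawRing Bool.xor-∧-commutativeRing

    embed : Bool → A
    embed b = if b then 1# else 0#

    morphism : 𝔽₂ -Raw-AlmostCommutative⟶ fromCommutativeRing ring
    morphism = record
      { ⟦_⟧    = embed
      ; +-homo = λ where
          false y     → sym (+-identityˡ (embed y))
          true  false → sym (+-identityʳ 1#)
          true  true  → sym (x⊕x≡0 1#)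
      ; *-homo = λ where
          false y → sym (zeroˡ (embed y))
          true  y → sym (*-identityˡ (embed y))
      ; -‿homo = λ _ → refl
      ; 0-homo = refl
      ; 1-homo = refl
      }

    _coeff≟_ : WeaklyDecidable (Induced-equivalence morphism)
    false coeff≟ false = just refl
    true  coeff≟ true  = just refl
    _     coeff≟ _     = nothing

  open Algebra.Solver.Ring 𝔽₂ (fromCommutativeRing ring) morphism _coeff≟_ public
    using (solve; con; _:=_; _:+_; _:*_)

  x⊕y≡0⇒x≡y : ∀ {x y} → x ⊕ y ≡ 0# → x ≡ y
  x⊕y≡0⇒x≡y {x} {y} h = begin
    x            ≡⟨ solve 2 (λ x y → x := (x :+ y) :+ y) refl x y ⟩
    (x ⊕ y) ⊕ y  ≡⟨ cong (_⊕ y) h ⟩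
    0# ⊕ y       ≡⟨ +-identityˡ y ⟩
    y            ∎
    where open ≡-Reasoning

-- The functional `ℓ` stands where the trace usually does: the maps x ↦ (-1)^ℓ(y x) serve as the
-- additive characters. The normalisation at 1 makes the pairing ℓ(y x) nondegenerate, see `detect`.
record BinaryField : Set₁ where
  infixl 6 _⊕_
  infixl 7 _·_
  field
    Carrier           : Set
    𝐅                 : Finite Carrier
    _⊕_ _·_           : Op₂ Carrier
    0# 1#             : Carrier
    isCommutativeRing : IsCommutativeRing _≡_ _⊕_ _·_ id 0# 1#
    inverse           : ∀ x → x ≢ 0# → ∃[ y ] y · x ≡ 1#
    ℓ                 : Carrier → Bool
    ℓ-⊕               : ∀ x y → ℓ (x ⊕ y) ≡ ℓ x xor ℓ y
    ℓ-1#              : ℓ 1# ≡ true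

  open Finite 𝐅 public using (_≟_) renaming (size to q)
  open Characteristic2 isCommutativeRing public

  ·-cancelˡ : ∀ {x y z} → x ≢ 0# → x · y ≡ x · z → y ≡ z
  ·-cancelˡ {x} {y} {z} x≢0 xy≡xz with inverse x x≢0
  ... | x⁻¹ , x⁻¹x≡1 = trans (sym (recover y)) (trans (cong (x⁻¹ ·_) xy≡xz) (recover z))
    where
    recover : ∀ w → x⁻¹ · (x · w) ≡ w
    recover w = trans (sym (·-assoc x⁻¹ x w)) (trans (cong (_· w) x⁻¹x≡1) (*-identityˡ w))

  ·-zero : ∀ {x y} → x ≢ 0# → x · y ≡ 0# → y ≡ 0#
  ·-zero {x} x≢0 xy≡0 = ·-cancelˡ x≢0 (trans xy≡0 (sym (zeroʳ x)))

  ℓ-0# : ℓ 0# ≡ false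
  ℓ-0# = trans (cong ℓ (sym (x⊕x≡0 0#))) (trans (ℓ-⊕ 0# 0#) (Bool.xor-same (ℓ 0#)))

-- The invariant of the recursion: besides the field it carries the constant term of an
-- Artin-Schreier polynomial x² + x + κ without a root, so that the next quadratic extension exists.
record TowerLevel : Set₁ where
  field
    K : BinaryField
  open BinaryField K
  field
    κ           : Carrier
    irreducible : ∀ b → b · b ⊕ b ≢ κ

-- The quadratic extension K[x] / (x² + x + κ), whose elements are the pairs
-- (a , b) = a + b x.  It is a field as κ is not of the form b² + b, and κ x is not of
-- this form in it: the coefficient of x in (a + b x)² + (a + b x) is b² + b ≠ κ.
module Extension (level : TowerLevel) where

  open TowerLevel level
  open BinaryField K

  L : Set
  L = Carrier × Carrier

  _⊞_ _⊠_ : Op₂ L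
  (a , b) ⊞ (c , d) = a ⊕ c , b ⊕ d
  (a , b) ⊠ (c , d) = a · c ⊕ b · d · κ , a · d ⊕ b · c ⊕ b · d

  0L 1L κ′ : L
  0L = 0# , 0#
  1L = 1# , 0#
  κ′ = 0# , κ

  isCommutativeRing′ : IsCommutativeRing _≡_ _⊞_ _⊠_ id 0L 1L
  isCommutativeRing′ = record
    { isRing = record
      { +-isAbelianGroup = record
        { isGroup = record
          { isMonoid = record
            { isSemigroup = record
              { isMagma = record { isEquivalence = isEquivalence ; ∙-cong = cong₂ _⊞_ }
              ; assoc   = λ (a , b) (c , d) (e , f) → cong₂ _,_ (⊕-assoc a c e) (⊕-assoc b d f)
              }
            ; identity = (λ (a , b) → cong₂ _,_ (+-identityˡ a) (+-identityˡ b))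
                       , (λ (a , b) → cong₂ _,_ (+-identityʳ a) (+-identityʳ b))
            }
          ; inverse = (λ (a , b) → cong₂ _,_ (x⊕x≡0 a) (x⊕x≡0 b))
                    , (λ (a , b) → cong₂ _,_ (x⊕x≡0 a) (x⊕x≡0 b))
          ; ⁻¹-cong = cong id
          }
        ; comm = λ (a , b) (c , d) → cong₂ _,_ (⊕-comm a c) (⊕-comm b d)
        }
      ; *-cong     = cong₂ _⊠_
      ; *-assoc    = ⊠-assoc
      ; *-identity = ⊠-identityˡ , λ u → trans (⊠-comm u 1L) (⊠-identityˡ u)
      ; distrib    = ⊠-distribˡ-⊞ , λ u v w → trans (⊠-comm (v ⊞ w) u)
                       (trans (⊠-distribˡ-⊞ u v w) (cong₂ _⊞_ (⊠-comm u v) (⊠-comm u w)))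
      }
    ; *-comm = ⊠-comm
    }
    where
    ⊠-comm : ∀ u v → u ⊠ v ≡ v ⊠ u
    ⊠-comm (a , b) (c , d) = cong₂ _,_
      (solve 5 (λ a b c d k → a :* c :+ b :* d :* k := c :* a :+ d :* b :* k) refl a b c d κ)
      (solve 4 (λ a b c d → a :* d :+ b :* c :+ b :* d := c :* b :+ d :* a :+ d :* b) refl a b c d)
    ⊠-identityˡ : ∀ u → 1L ⊠ u ≡ u
    ⊠-identityˡ (a , b) = cong₂ _,_
      (solve 3 (λ a b k → con true :* a :+ con false :* b :* k := a) refl a b κ)
      (solve 2 (λ a b → con true :* b :+ con false :* a :+ con false :* b := b) refl a b)
    ⊠-distribˡ-⊞ : ∀ u v w → u ⊠ (v ⊞ w) ≡ (u ⊠ v) ⊞ (u ⊠ w)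
    ⊠-distribˡ-⊞ (a , b) (c , d) (e , f) = cong₂ _,_
      (solve 7 (λ a b c d e f k → a :* (c :+ e) :+ b :* (d :+ f) :* k :=
        (a :* c :+ b :* d :* k) :+ (a :* e :+ b :* f :* k)) refl a b c d e f κ)
      (solve 6 (λ a b c d e f → a :* (d :+ f) :+ b :* (c :+ e) :+ b :* (d :+ f) :=
        (a :* d :+ b :* c :+ b :* d) :+ (a :* f :+ b :* e :+ b :* f)) refl a b c d e f)
    ⊠-assoc : ∀ u v w → (u ⊠ v) ⊠ w ≡ u ⊠ (v ⊠ w)
    ⊠-assoc (a , b) (c , d) (e , f) = cong₂ _,_
      (solve 7 (λ a b c d e f k →
        (a :* c :+ b :* d :* k) :* e :+ (a :* d :+ b :* c :+ b :* d) :* f :* k :=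
        a :* (c :* e :+ d :* f :* k) :+ b :* (c :* f :+ d :* e :+ d :* f) :* k) refl a b c d e f κ)
      (solve 7 (λ a b c d e f k →
        (a :* c :+ b :* d :* k) :* f :+ (a :* d :+ b :* c :+ b :* d) :* e :+ (a :* d :+ b :* c :+ b :* d) :* f :=
        a :* (c :* f :+ d :* e :+ d :* f) :+ b :* (c :* e :+ d :* f :* k) :+ b :* (c :* f :+ d :* e :+ d :* f))
        refl a b c d e f κ)

  -- The product of a + b x and its conjugate a + b (x + 1).
  norm : L → Carrier
  norm (a , b) = a · a ⊕ a · b ⊕ b · b · κ

  -- For b = 0 the norm is a². For b ≠ 0, dividing it by b² gives (a/b)² + a/b + κ, which is nonzero
  -- by `irreducible`.
  norm≢0 : ∀ u → u ≢ 0L → norm u ≢ 0#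
  norm≢0 (a , b) u≢0 N≡0 with b ≟ 0#
  ... | yes refl with a ≟ 0#
  ...   | yes refl = u≢0 refl
  ...   | no a≢0   = a≢0 (·-zero a≢0 (trans
    (solve 2 (λ a k → a :* a := a :* a :+ a :* con false :+ con false :* con false :* k) refl a κ) N≡0))
  norm≢0 (a , b) u≢0 N≡0 | no b≢0 with inverse b b≢0
  ... | b⁻¹ , b⁻¹b≡1 = irreducible (b⁻¹ · a) (x⊕y≡0⇒x≡y (begin
    b⁻¹ · a · (b⁻¹ · a) ⊕ b⁻¹ · a ⊕ κ
      ≡⟨ solve 3 (λ a i k → i :* a :* (i :* a) :+ i :* a :+ k :=
           i :* a :* (i :* a) :+ i :* a :* con true :+ con true :* con true :* k) refl a b⁻¹ κ ⟩
    b⁻¹ · a · (b⁻¹ · a) ⊕ b⁻¹ · a · 1# ⊕ 1# · 1# · κ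
      ≡⟨ cong (λ z → b⁻¹ · a · (b⁻¹ · a) ⊕ b⁻¹ · a · z ⊕ z · z · κ) (sym b⁻¹b≡1) ⟩
    b⁻¹ · a · (b⁻¹ · a) ⊕ b⁻¹ · a · (b⁻¹ · b) ⊕ b⁻¹ · b · (b⁻¹ · b) · κ
      ≡⟨ solve 4 (λ a b i k → i :* a :* (i :* a) :+ i :* a :* (i :* b) :+ i :* b :* (i :* b) :* k :=
           i :* i :* (a :* a :+ a :* b :+ b :* b :* k)) refl a b b⁻¹ κ ⟩
    b⁻¹ · b⁻¹ · norm (a , b)
      ≡⟨ cong (b⁻¹ · b⁻¹ ·_) N≡0 ⟩
    b⁻¹ · b⁻¹ · 0#
      ≡⟨ zeroʳ (b⁻¹ · b⁻¹) ⟩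
    0# ∎))
    where open ≡-Reasoning

  inverse′ : ∀ u → u ≢ 0L → ∃[ v ] v ⊠ u ≡ 1L
  inverse′ u@(a , b) u≢0 with inverse (norm u) (norm≢0 u u≢0)
  -- The conjugate a + b (x + 1) has coordinates (a ⊕ b , b); the inverse is the conjugate divided
  -- by the norm.
  ... | N⁻¹ , N⁻¹N≡1 = (N⁻¹ · (a ⊕ b) , N⁻¹ · b) , cong₂ _,_
    (trans (solve 4 (λ a b i k → i :* (a :+ b) :* a :+ i :* b :* b :* k :=
              i :* (a :* a :+ a :* b :+ b :* b :* k)) refl a b N⁻¹ κ) N⁻¹N≡1)
    (solve 3 (λ a b i → i :* (a :+ b) :* b :+ i :* b :* a :+ i :* b :* b := con false) refl a b N⁻¹)

  extension : BinaryField
  extension = record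
    { Carrier           = L
    ; 𝐅                 = finite-× 𝐅 𝐅
    ; isCommutativeRing = isCommutativeRing′
    ; inverse           = inverse′
    -- The absolute trace would not do: it vanishes at 1 in a field of even degree over 𝔽₂. The
    -- first coordinate keeps the value at 1.
    ; ℓ                 = ℓ ∘ proj₁
    ; ℓ-⊕               = λ (a , _) (c , _) → ℓ-⊕ a c
    ; ℓ-1#              = ℓ-1#
    }

  irreducible′ : ∀ u → (u ⊠ u) ⊞ u ≢ κ′
  irreducible′ (a , b) h = irreducible b (trans
    (solve 2 (λ a b → b :* b :+ b := a :* b :+ b :* a :+ b :* b :+ b) refl a b) (cong proj₂ h))

𝔽₂ : BinaryField
𝔽₂ = record
  { Carrier           = Bool
  ; 𝐅                 = finite-Bool
  ; isCommutativeRing = CommutativeRing.isCommutativeRing Bool.xor-∧-commutativeRing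
  ; inverse           = λ where
      true  _   → true , refl
      false 0≢0 → contradiction refl 0≢0
  ; ℓ                 = id
  ; ℓ-⊕               = λ _ _ → refl
  ; ℓ-1#              = refl
  }

-- Each step squares the order, so level i has 2^(2^i) elements. The start is x² + x + 1 over 𝔽₂.
tower : ℕ → TowerLevel
tower zero    = record
  { K           = 𝔽₂
  ; κ           = true
  ; irreducible = λ where
      false ()
      true  ()
  }
tower (suc i) = record { K = extension ; κ = κ′ ; irreducible = irreducible′ }
  where open Extension (tower i)

𝔽 : ℕ → BinaryField
𝔽 i = TowerLevel.K (tower i)

-- Spectrum of the Cayley graph

sign : Bool → ℤ
sign b = if b then ℤ.-1ℤ else 1ℤ

sign-xor : ∀ b c → sign (b xor c) ≡ sign b ℤ.* sign c
sign-xor false c     = sym (ℤ.*-identityˡ (sign c))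
sign-xor true  false = refl
sign-xor true  true  = refl

-- The indicator as a combination of the two characters of 𝔽₂, doubled to stay integral.
2𝟙-true : ∀ b → + 2 ℤ.* 𝟙 (b Bool.≟ true) ≡ 1ℤ ℤ.- sign b
2𝟙-true false = refl
2𝟙-true true  = refl

-- A kernel that is a weighted sum of products φ a u φ a v has a quadratic form that is a weighted
-- sum of squares. The weight m = 1 gives `parseval`, and m = q μ gives `spectral-form`.
∑-gram : ∀ {A B} (𝐀 : Finite A) (𝐁 : Finite B) (m : A → ℤ) (φ : A → B → ℤ) (ξ : B → ℤ) →
  ∑[ u ∈ 𝐁 ] (∑[ v ∈ 𝐁 ] (ξ u ℤ.* ξ v ℤ.* (∑[ a ∈ 𝐀 ] (m a ℤ.* (φ a u ℤ.* φ a v))))) ≡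
  ∑[ a ∈ 𝐀 ] (m a ℤ.* ((∑[ u ∈ 𝐁 ] (ξ u ℤ.* φ a u)) ℤ.* (∑[ u ∈ 𝐁 ] (ξ u ℤ.* φ a u))))
∑-gram {A} 𝐀 𝐁 m φ ξ = begin
  ∑[ u ∈ 𝐁 ] (∑[ v ∈ 𝐁 ] (ξ u ℤ.* ξ v ℤ.* (∑[ a ∈ 𝐀 ] (m a ℤ.* (φ a u ℤ.* φ a v)))))
    ≡⟨ ∑-cong (λ u → ∑-cong (λ v → sym (∑-*ˡ (ξ u ℤ.* ξ v) (λ a → m a ℤ.* (φ a u ℤ.* φ a v))))) ⟩
  ∑[ u ∈ 𝐁 ] (∑[ v ∈ 𝐁 ] (∑[ a ∈ 𝐀 ] (ξ u ℤ.* ξ v ℤ.* (m a ℤ.* (φ a u ℤ.* φ a v)))))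
    ≡⟨ ∑-cong (λ u → ∑-swap (λ v a → ξ u ℤ.* ξ v ℤ.* (m a ℤ.* (φ a u ℤ.* φ a v)))) ⟩
  ∑[ u ∈ 𝐁 ] (∑[ a ∈ 𝐀 ] (∑[ v ∈ 𝐁 ] (ξ u ℤ.* ξ v ℤ.* (m a ℤ.* (φ a u ℤ.* φ a v)))))
    ≡⟨ ∑-swap (λ u a → ∑[ v ∈ 𝐁 ] (ξ u ℤ.* ξ v ℤ.* (m a ℤ.* (φ a u ℤ.* φ a v)))) ⟩
  ∑[ a ∈ 𝐀 ] (∑[ u ∈ 𝐁 ] (∑[ v ∈ 𝐁 ] (ξ u ℤ.* ξ v ℤ.* (m a ℤ.* (φ a u ℤ.* φ a v)))))
    ≡⟨ ∑-cong (λ a → ∑-cong (λ u → ∑-cong (λ v →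
         solve 5 (λ x y m p q → x :* y :* (m :* (p :* q)) := m :* (x :* p) :* (y :* q))
               refl (ξ u) (ξ v) (m a) (φ a u) (φ a v)))) ⟩
  ∑[ a ∈ 𝐀 ] (∑[ u ∈ 𝐁 ] (∑[ v ∈ 𝐁 ] (m a ℤ.* (ξ u ℤ.* φ a u) ℤ.* (ξ v ℤ.* φ a v))))
    ≡⟨ ∑-cong (λ a → ∑-cong (λ u → ∑-*ˡ (m a ℤ.* (ξ u ℤ.* φ a u)) (λ v → ξ v ℤ.* φ a v))) ⟩
  ∑[ a ∈ 𝐀 ] (∑[ u ∈ 𝐁 ] (m a ℤ.* (ξ u ℤ.* φ a u) ℤ.* F a))
    ≡⟨ ∑-cong (λ a → ∑-*ʳ (F a) (λ u → m a ℤ.* (ξ u ℤ.* φ a u))) ⟩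
  ∑[ a ∈ 𝐀 ] ((∑[ u ∈ 𝐁 ] (m a ℤ.* (ξ u ℤ.* φ a u))) ℤ.* F a)
    ≡⟨ ∑-cong (λ a → cong (ℤ._* F a) (∑-*ˡ (m a) (λ u → ξ u ℤ.* φ a u))) ⟩
  ∑[ a ∈ 𝐀 ] (m a ℤ.* F a ℤ.* F a)
    ≡⟨ ∑-cong (λ a → ℤ.*-assoc (m a) (F a) (F a)) ⟩
  ∑[ a ∈ 𝐀 ] (m a ℤ.* (F a ℤ.* F a)) ∎
  where
  open ≡-Reasoning
  open ℤS
  F : A → ℤ
  F a = ∑[ u ∈ 𝐁 ] (ξ u ℤ.* φ a u)

-- Counting roots of polynomials over a finite field.

module Roots (K : BinaryField) where

  open BinaryField K

  -- The polynomial with leading coefficient l and the lower coefficients in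
  -- increasing order of degree.
  eval : ∀ {d} → Carrier → Vec Carrier d → Carrier → Carrier
  eval l []       w = l
  eval l (c ∷ cs) w = c ⊕ w · eval l cs w

  -- Synthetic division by w ⊕ r.
  quotient : ∀ {d} → Carrier → Vec Carrier (suc d) → Carrier → Vec Carrier d
  quotient l (c ∷ [])          r = []
  quotient l (c ∷ cs@(_ ∷ _)) r = eval l cs r ∷ quotient l cs r

  -- The remainder of the division is the value at `r`, moved to the left. The induction needs this
  -- form for arbitrary `r`, since a root of the whole polynomial need not be a root of its tail
  -- `cs`.
  factor : ∀ {d} l (cs : Vec Carrier (suc d)) r w →
           eval l cs w ⊕ eval l cs r ≡ (w ⊕ r) · eval l (quotient l cs r) w
  factor l (c ∷ []) r w = solve 4 (λ l c r w → (c :+ w :* l) :+ (c :+ r :* l) := (w :+ r) :* l) refl l c r w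
  factor l (c ∷ cs@(_ ∷ _)) r w = begin
    (c ⊕ w · eval l cs w) ⊕ (c ⊕ r · eval l cs r)
      ≡⟨ solve 5 (λ c r w p q → (c :+ w :* p) :+ (c :+ r :* q) := (w :+ r) :* q :+ w :* (p :+ q))
           refl c r w (eval l cs w) (eval l cs r) ⟩
    (w ⊕ r) · eval l cs r ⊕ w · (eval l cs w ⊕ eval l cs r)
      ≡⟨ cong (λ z → (w ⊕ r) · eval l cs r ⊕ w · z) (factor l cs r w) ⟩
    (w ⊕ r) · eval l cs r ⊕ w · ((w ⊕ r) · eval l (quotient l cs r) w)
      ≡⟨ solve 4 (λ r w q s → (w :+ r) :* q :+ w :* ((w :+ r) :* s) := (w :+ r) :* (q :+ w :* s))
           refl r w (eval l cs r) (eval l (quotient l cs r) w) ⟩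
    (w ⊕ r) · (eval l cs r ⊕ w · eval l (quotient l cs r) w) ∎
    where open ≡-Reasoning

  -- Induction on the degree: search for a root `r`; by `factor` every other root is a root of the
  -- quotient, which has the same leading coefficient.
  root-count : ∀ {d l} → l ≢ 0# → (cs : Vec Carrier d) → ∑[ w ∈ 𝐅 ] 𝟙 (eval l cs w ≟ 0#) ℤ.≤ + d
  root-count {l = l} l≢0 [] = ℤ.≤-reflexive (∑-zero (λ w → 𝟙-no (l ≟ 0#) l≢0))
  root-count {suc d} {l} l≢0 cs@(_ ∷ _) with Finite.∃? 𝐅 (λ w → eval l cs w ≟ 0#)
  ... | no ¬∃ = ℤ.≤-trans (ℤ.≤-reflexive (∑-zero (λ w → 𝟙-no (eval l cs w ≟ 0#) (λ h → ¬∃ (w , h))))) (ℤ.+≤+ ℕ.z≤n)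
  ... | yes (r , r-root) = begin
    ∑[ w ∈ 𝐅 ] 𝟙 (eval l cs w ≟ 0#)
      ≤⟨ ∑-mono split ⟩
    ∑[ w ∈ 𝐅 ] (𝟙 (w ≟ r) ℤ.* 1ℤ ℤ.+ 𝟙 (eval l qs w ≟ 0#))
      ≡⟨ ∑-+ (λ w → 𝟙 (w ≟ r) ℤ.* 1ℤ) (λ w → 𝟙 (eval l qs w ≟ 0#)) ⟩
    ∑[ w ∈ 𝐅 ] (𝟙 (w ≟ r) ℤ.* 1ℤ) ℤ.+ ∑[ w ∈ 𝐅 ] 𝟙 (eval l qs w ≟ 0#)
      ≤⟨ ℤ.+-mono-≤ (ℤ.≤-reflexive (∑-𝟙 r (λ _ → 1ℤ))) (root-count l≢0 qs) ⟩
    + suc d ∎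
    where
    open ℤ.≤-Reasoning
    qs : Vec Carrier d
    qs = quotient l cs r
    factored : ∀ w → eval l cs w ≡ 0# → (w ⊕ r) · eval l qs w ≡ 0#
    factored w w-root = trans (sym (factor l cs r w)) (trans (cong₂ _⊕_ w-root r-root) (x⊕x≡0 0#))
    split : ∀ w → 𝟙 (eval l cs w ≟ 0#) ℤ.≤ 𝟙 (w ≟ r) ℤ.* 1ℤ ℤ.+ 𝟙 (eval l qs w ≟ 0#)
    split w with eval l cs w ≟ 0# | w ≟ r
    ... | no _       | yes _  = ℤ.+-mono-≤ (ℤ.+≤+ (ℕ.z≤n {1})) (0≤𝟙 (eval l qs w ≟ 0#))
    ... | no _       | no _   = ℤ.+-mono-≤ (ℤ.≤-refl {0ℤ}) (0≤𝟙 (eval l qs w ≟ 0#))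
    ... | yes _      | yes _  = ℤ.+-mono-≤ (ℤ.≤-refl {1ℤ}) (0≤𝟙 (eval l qs w ≟ 0#))
    ... | yes w-root | no w≢r = ℤ.≤-reflexive (sym (trans (ℤ.+-identityˡ _) (𝟙-yes (eval l qs w ≟ 0#)
      (·-zero (w≢r ∘ x⊕y≡0⇒x≡y) (factored w w-root)))))

-- The connection set, its characters and its eigenvalues.

module Spectrum (K : BinaryField) where

  open BinaryField K
  open Roots K

  V : Set
  V = Carrier × Carrier × Carrier

  abstract
    𝐕 : Finite V
    𝐕 = finite-× 𝐅 (finite-× 𝐅 𝐅)

    size-𝐕 : Finite.size 𝐕 ≡ q ℕ.* (q ℕ.* q)
    size-𝐕 = refl

  open Finite 𝐕 using () renaming (_≟_ to _≟V_)

  0V : V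
  0V = 0# , 0# , 0#

  infixl 6 _⊞_

  _⊞_ : V → V → V
  (a , b , c) ⊞ (a′ , b′ , c′) = a ⊕ a′ , b ⊕ b′ , c ⊕ c′

  _∙_ : V → V → Carrier
  (a , b , c) ∙ (x , y , z) = a · x ⊕ b · y ⊕ c · z

  point : Carrier → Carrier → V
  point t w = t , t · w , t · w · w

  S : V → Set
  S z = ∃[ t ] ∃[ w ] (z ≡ point t w × ℓ (t · (w · w · w)) ≡ true)

  S? : ∀ z → Dec (S z)
  S? z = Finite.∃? 𝐅 λ t → Finite.∃? 𝐅 λ w → (z ≟V point t w) ×-dec (ℓ (t · (w · w · w)) Bool.≟ true)

  ⊞-comm : ∀ u v → u ⊞ v ≡ v ⊞ u
  ⊞-comm (a , b , c) (a′ , b′ , c′) = cong₂ _,_ (⊕-comm a a′) (cong₂ _,_ (⊕-comm b b′) (⊕-comm c c′))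

  ⊞-cancelʳ : ∀ u v → (u ⊞ v) ⊞ v ≡ u
  ⊞-cancelʳ (a , b , c) (a′ , b′ , c′) = cong₂ _,_ (cancel a a′) (cong₂ _,_ (cancel b b′) (cancel c c′))
    where
    cancel : ∀ x y → (x ⊕ y) ⊕ y ≡ x
    cancel = solve 2 (λ x y → (x :+ y) :+ y := x) refl

  u⊞u≡0 : ∀ u → u ⊞ u ≡ 0V
  u⊞u≡0 (a , b , c) = cong₂ _,_ (x⊕x≡0 a) (cong₂ _,_ (x⊕x≡0 b) (x⊕x≡0 c))

  ⊞-identityˡ : ∀ u → 0V ⊞ u ≡ u
  ⊞-identityˡ (a , b , c) = cong₂ _,_ (+-identityˡ a) (cong₂ _,_ (+-identityˡ b) (+-identityˡ c))

  0∉S : ¬ S 0V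
  0∉S (t , w , z≡ , ℓ≡) with cong proj₁ z≡
  ... | refl with trans (sym ℓ≡) (trans (cong ℓ (zeroˡ (w · w · w))) ℓ-0#)
  ...   | ()

  -- The cubic with roots w₁, w₂, w₃ expresses ∑ tᵢ wᵢ³ through ∑ tᵢ wᵢ², ∑ tᵢ wᵢ and
  -- ∑ tᵢ, which all vanish, so that 0 = ℓ (∑ tᵢ wᵢ³) = 1 + 1 + 1.
  no-zero-sum : ∀ z₁ z₂ z₃ → S z₁ → S z₂ → S z₃ → z₁ ⊞ z₂ ⊞ z₃ ≢ 0V
  no-zero-sum _ _ _ (t₁ , w₁ , refl , ℓ₁) (t₂ , w₂ , refl , ℓ₂) (t₃ , w₃ , refl , ℓ₃) sum≡0 = contradiction
    (begin
      true                            ≡⟨ cong₂ _xor_ (cong₂ _xor_ ℓ₁ ℓ₂) ℓ₃ ⟨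
      (ℓ c₁ xor ℓ c₂) xor ℓ c₃        ≡⟨ cong (_xor ℓ c₃) (ℓ-⊕ c₁ c₂) ⟨
      ℓ (c₁ ⊕ c₂) xor ℓ c₃            ≡⟨ ℓ-⊕ (c₁ ⊕ c₂) c₃ ⟨
      ℓ (c₁ ⊕ c₂ ⊕ c₃)                ≡⟨ cong ℓ newton ⟩
      ℓ (e₁ · s₂ ⊕ e₂ · s₁ ⊕ e₃ · s₀) ≡⟨ cong ℓ (cong₂ _⊕_ (cong₂ _⊕_
                                           (cong (e₁ ·_) (cong (proj₂ ∘ proj₂) sum≡0))
                                           (cong (e₂ ·_) (cong (proj₁ ∘ proj₂) sum≡0)))
                                           (cong (e₃ ·_) (cong proj₁ sum≡0))) ⟩
      ℓ (e₁ · 0# ⊕ e₂ · 0# ⊕ e₃ · 0#)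
            ≡⟨ cong ℓ (solve 3 (λ a b c → a :* con false :+ b :* con false :+ c :* con false := con false)
                  refl e₁ e₂ e₃) ⟩
      ℓ 0#                            ≡⟨ ℓ-0# ⟩
      false                           ∎)
    (λ ())
    where
    open ≡-Reasoning
    c₁ c₂ c₃ e₁ e₂ e₃ s₀ s₁ s₂ : Carrier
    c₁ = t₁ · (w₁ · w₁ · w₁)
    c₂ = t₂ · (w₂ · w₂ · w₂)
    c₃ = t₃ · (w₃ · w₃ · w₃)
    e₁ = w₁ ⊕ w₂ ⊕ w₃
    e₂ = w₁ · w₂ ⊕ w₂ · w₃ ⊕ w₃ · w₁
    e₃ = w₁ · w₂ · w₃
    s₀ = t₁ ⊕ t₂ ⊕ t₃
    s₁ = t₁ · w₁ ⊕ t₂ · w₂ ⊕ t₃ · w₃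
    s₂ = t₁ · w₁ · w₁ ⊕ t₂ · w₂ · w₂ ⊕ t₃ · w₃ · w₃
    newton : c₁ ⊕ c₂ ⊕ c₃ ≡ e₁ · s₂ ⊕ e₂ · s₁ ⊕ e₃ · s₀
    newton = solve 6 (λ t u v x y z →
      t :* (x :* x :* x) :+ u :* (y :* y :* y) :+ v :* (z :* z :* z) :=
      (x :+ y :+ z) :* (t :* x :* x :+ u :* y :* y :+ v :* z :* z) :+
      (x :* y :+ y :* z :+ z :* x) :* (t :* x :+ u :* y :+ v :* z) :+
      x :* y :* z :* (t :+ u :+ v)) refl t₁ t₂ t₃ w₁ w₂ w₃

  χ : Carrier → ℤ
  χ x = sign (ℓ x)

  χ-⊕ : ∀ x y → χ (x ⊕ y) ≡ χ x ℤ.* χ y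
  χ-⊕ x y = trans (cong sign (ℓ-⊕ x y)) (sign-xor (ℓ x) (ℓ y))

  χ-0# : χ 0# ≡ 1ℤ
  χ-0# = cong sign ℓ-0#

  χ-flip : ∀ x y → ℓ y ≡ true → χ (x ⊕ y) ≡ ℤ.- χ x
  χ-flip x y ℓy = begin
    χ (x ⊕ y)      ≡⟨ χ-⊕ x y ⟩
    χ x ℤ.* χ y    ≡⟨ cong (λ b → χ x ℤ.* sign b) ℓy ⟩
    χ x ℤ.* ℤ.-1ℤ  ≡⟨ ℤ.*-comm (χ x) ℤ.-1ℤ ⟩
    ℤ.-1ℤ ℤ.* χ x  ≡⟨ ℤ.-1*i≡-i (χ x) ⟩
    ℤ.- χ x        ∎
    where open ≡-Reasoning

  -- Take the inverse of g, since `ℓ` is 1 at 1. So a nonzero g gives a nontrivial character t ↦ `χ`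
  -- (t · g).
  detect : ∀ {g} → g ≢ 0# → ∃[ y ] ℓ (y · g) ≡ true
  detect {g} g≢0 with inverse g g≢0
  ... | y , yg≡1 = y , trans (cong ℓ yg≡1) ℓ-1#

  ∑χ : ∀ g → ∑[ t ∈ 𝐅 ] χ (t · g) ≡ + q ℤ.* 𝟙 (g ≟ 0#)
  ∑χ g with g ≟ 0#
  ... | yes refl = trans (∑-cong (λ t → trans (cong χ (zeroʳ t)) χ-0#)) (∑-const 1ℤ)
  ... | no g≢0 with detect g≢0
  ...   | y , ℓyg = trans
    (∑-antiinvariant (_⊕ y) (λ t → solve 2 (λ t y → (t :+ y) :+ y := t) refl t y)
      (λ t → trans (cong χ (solve 3 (λ t y g → (t :+ y) :* g := t :* g :+ y :* g)
            refl t y g)) (χ-flip (t · g) (y · g) ℓyg)))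
    (sym (ℤ.*-zeroʳ (+ q)))

  ∙-⊞ˡ : ∀ a b z → (a ⊞ b) ∙ z ≡ a ∙ z ⊕ b ∙ z
  ∙-⊞ˡ (a , b , c) (a′ , b′ , c′) (x , y , z) = solve 9 (λ a b c a′ b′ c′ x y z →
    (a :+ a′) :* x :+ (b :+ b′) :* y :+ (c :+ c′) :* z :=
    (a :* x :+ b :* y :+ c :* z) :+ (a′ :* x :+ b′ :* y :+ c′ :* z)) refl a b c a′ b′ c′ x y z

  ∙-⊞ʳ : ∀ a u v → a ∙ (u ⊞ v) ≡ a ∙ u ⊕ a ∙ v
  ∙-⊞ʳ (a , b , c) (x , y , z) (x′ , y′ , z′) = solve 9 (λ a b c x y z x′ y′ z′ →
    a :* (x :+ x′) :+ b :* (y :+ y′) :+ c :* (z :+ z′) :=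
    (a :* x :+ b :* y :+ c :* z) :+ (a :* x′ :+ b :* y′ :+ c :* z′)) refl a b c x y z x′ y′ z′

  0∙z≡0 : ∀ z → 0V ∙ z ≡ 0#
  0∙z≡0 (x , y , z) = solve 3 (λ x y z → con false :* x :+ con false :* y :+ con false :* z := con false) refl x y z

  a∙0≡0 : ∀ a → a ∙ 0V ≡ 0#
  a∙0≡0 (x , y , z) = solve 3 (λ x y z → x :* con false :+ y :* con false :+ z :* con false := con false) refl x y z

  detectV : ∀ z → z ≢ 0V → ∃[ b ] ℓ (b ∙ z) ≡ true
  detectV (x , y , z) ≢0 with x ≟ 0# | y ≟ 0# | z ≟ 0#
  ... | no x≢0   | _        | _        = let t , ℓt = detect x≢0 in (t , 0# , 0#) ,
    trans (cong ℓ (solve 4 (λ t x y z → t :* x :+ con false :* y :+ con false :* z := t :* x) refl t x y z)) ℓt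
  ... | yes _    | no y≢0   | _        = let t , ℓt = detect y≢0 in (0# , t , 0#) ,
    trans (cong ℓ (solve 4 (λ t x y z → con false :* x :+ t :* y :+ con false :* z := t :* y) refl t x y z)) ℓt
  ... | yes _    | yes _    | no z≢0   = let t , ℓt = detect z≢0 in (0# , 0# , t) ,
    trans (cong ℓ (solve 4 (λ t x y z → con false :* x :+ con false :* y :+ t :* z := t :* z) refl t x y z)) ℓt
  ... | yes refl | yes refl | yes refl = contradiction refl ≢0

  N : ℕ
  N = Finite.size 𝐕

  ∑χV : ∀ z → ∑[ a ∈ 𝐕 ] χ (a ∙ z) ≡ + N ℤ.* 𝟙 (z ≟V 0V)
  ∑χV z with z ≟V 0V
  ... | yes refl = trans (∑-cong (λ a → trans (cong χ (a∙0≡0 a)) χ-0#)) (∑-const {𝐀 = 𝐕} 1ℤ)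
  ... | no z≢0 with detectV z z≢0
  ...   | b , ℓbz = trans
    (∑-antiinvariant (_⊞ b) (λ a → ⊞-cancelʳ a b)
      (λ a → trans (cong χ (∙-⊞ˡ a b z)) (χ-flip (a ∙ z) (b ∙ z) ℓbz)))
    (sym (ℤ.*-zeroʳ (+ N)))

  -- The characters are real, so no conjugate appears, and u = v exactly when u ⊞ v vanishes. This
  -- reduces the sum to a single character sum.
  orthogonality : ∀ u v → ∑[ a ∈ 𝐕 ] (χ (a ∙ u) ℤ.* χ (a ∙ v)) ≡ + N ℤ.* 𝟙 (u ≟V v)
  orthogonality u v = begin
    ∑[ a ∈ 𝐕 ] (χ (a ∙ u) ℤ.* χ (a ∙ v))  ≡⟨ ∑-cong (λ a → trans (cong χ (∙-⊞ʳ a u v)) (χ-⊕ (a ∙ u) (a ∙ v))) ⟨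
    ∑[ a ∈ 𝐕 ] χ (a ∙ (u ⊞ v))            ≡⟨ ∑χV (u ⊞ v) ⟩
    + N ℤ.* 𝟙 (u ⊞ v ≟V 0V)                ≡⟨ cong (+ N ℤ.*_) (𝟙-⇔
      (λ u⊞v≡0 → trans (sym (⊞-cancelʳ u v)) (trans (cong (_⊞ v) u⊞v≡0) (⊞-identityˡ v)))
      (λ { refl → u⊞u≡0 u }) (u ⊞ v ≟V 0V) (u ≟V v)) ⟩
    + N ℤ.* 𝟙 (u ≟V v)                     ∎
    where open ≡-Reasoning

  -- (a ∙ point t w) = t · h a w  and  (a ∙ point t w) ⊕ t · w³ = t · g a w.
  h g : V → Carrier → Carrier
  h (a , b , c) = eval c (a ∷ b ∷ [])
  g (a , b , c) = eval 1# (a ∷ b ∷ c ∷ [])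

  Z O μ : V → ℤ
  Z a = ∑[ w ∈ 𝐅 ] 𝟙 (h a w ≟ 0#)
  O a = ∑[ w ∈ 𝐅 ] 𝟙 (g a w ≟ 0#)
  μ a = Z a ℤ.- O a

  Z-0V : Z 0V ≡ + q
  Z-0V = trans (∑-cong (λ w → 𝟙-yes (h 0V w ≟ 0#)
    (solve 1 (λ w → con false :+ w :* (con false :+ w :* con false) := con false) refl w)))
    (trans (∑-const 1ℤ) (ℤ.*-identityʳ (+ q)))

  -- The degree of `h a` depends on a, so the cases follow its highest nonzero coefficient.
  Z≤2 : ∀ a → a ≢ 0V → Z a ℤ.≤ + 2
  Z≤2 (a , b , c) a≢0 with c ≟ 0# | b ≟ 0# | a ≟ 0#
  ... | no c≢0   | _        | _        = root-count c≢0 (a ∷ b ∷ [])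
  ... | yes refl | no b≢0   | _        = begin
    ∑[ w ∈ 𝐅 ] 𝟙 (a ⊕ w · (b ⊕ w · 0#) ≟ 0#)  ≡⟨ ∑-cong (λ w → cong (λ z → 𝟙 (z ≟ 0#))
      (solve 3 (λ a b w → a :+ w :* (b :+ w :* con false) := a :+ w :* b) refl a b w)) ⟩
    ∑[ w ∈ 𝐅 ] 𝟙 (a ⊕ w · b ≟ 0#)             ≤⟨ root-count b≢0 (a ∷ []) ⟩
    + 1                                             ≤⟨ ℤ.+≤+ (ℕ.s≤s ℕ.z≤n) ⟩
    + 2                                             ∎
    where open ℤ.≤-Reasoning
  ... | yes refl | yes refl | no a₀≢0 = begin
    ∑[ w ∈ 𝐅 ] 𝟙 (a ⊕ w · (0# ⊕ w · 0#) ≟ 0#)  ≡⟨ ∑-cong (λ w → cong (λ z → 𝟙 (z ≟ 0#))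
      (solve 2 (λ a w → a :+ w :* (con false :+ w :* con false) := a) refl a w)) ⟩
    ∑[ w ∈ 𝐅 ] 𝟙 (a ≟ 0#)                      ≤⟨ root-count a₀≢0 [] ⟩
    + 0                                              ≤⟨ ℤ.+≤+ ℕ.z≤n ⟩
    + 2                                              ∎
    where open ℤ.≤-Reasoning
  ... | yes refl | yes refl | yes refl = contradiction refl a≢0

  0≤∑𝟙 : {P : Carrier → Set} (P? : ∀ w → Dec (P w)) → 0ℤ ℤ.≤ ∑[ w ∈ 𝐅 ] 𝟙 (P? w)
  0≤∑𝟙 P? = ℤ.≤-trans (ℤ.≤-reflexive (sym (∑-zero (λ _ → refl)))) (∑-mono (λ w → 0≤𝟙 (P? w)))

  1≢0 : 1# ≢ 0#
  1≢0 1≡0 with trans (sym ℓ-1#) (trans (cong ℓ 1≡0) ℓ-0#)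
  ... | ()

  -- The term w³ makes `g a` monic for every a, so the zero vector needs no exception here.
  O≤3 : ∀ a → O a ℤ.≤ + 3
  O≤3 (a , b , c) = root-count 1≢0 (a ∷ b ∷ c ∷ [])

  -- Both cases in one formula, with the trivial character split off as an indicator, so that `∑μF²`
  -- can sum it against `F²`.
  Z≤ : ∀ a → Z a ℤ.≤ + q ℤ.* 𝟙 (a ≟V 0V) ℤ.+ + 2
  Z≤ a with a ≟V 0V
  ... | yes refl = begin
    Z 0V                ≡⟨ trans Z-0V (sym (ℤ.*-identityʳ (+ q))) ⟩
    + q ℤ.* 1ℤ          ≤⟨ ℤ.i≤i+j (+ q ℤ.* 1ℤ) (+ 2) ⟩
    + q ℤ.* 1ℤ ℤ.+ + 2  ∎
    where open ℤ.≤-Reasoning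
  ... | no a≢0 = begin
    Z a                 ≤⟨ Z≤2 a a≢0 ⟩
    + 2                 ≡⟨ cong (ℤ._+ + 2) (sym (ℤ.*-zeroʳ (+ q))) ⟩
    + q ℤ.* 0ℤ ℤ.+ + 2  ∎
    where open ℤ.≤-Reasoning

  ≤Z : ∀ a → + q ℤ.* 𝟙 (a ≟V 0V) ℤ.≤ Z a
  ≤Z a with a ≟V 0V
  ... | yes refl = ℤ.≤-reflexive (trans (ℤ.*-identityʳ (+ q)) (sym Z-0V))
  ... | no _     = ℤ.≤-trans (ℤ.≤-reflexive (ℤ.*-zeroʳ (+ q))) (0≤∑𝟙 (λ w → h a w ≟ 0#))

  μ≤ : ∀ a → μ a ℤ.≤ + q ℤ.* 𝟙 (a ≟V 0V) ℤ.+ + 2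
  μ≤ a = ℤ.≤-trans (ℤ.+-monoʳ-≤ (Z a) (ℤ.neg-mono-≤ (0≤∑𝟙 (λ w → g a w ≟ 0#))))
    (ℤ.≤-trans (ℤ.≤-reflexive (ℤ.+-identityʳ (Z a))) (Z≤ a))

  ≤μ : ∀ a → + q ℤ.* 𝟙 (a ≟V 0V) ℤ.- + 3 ℤ.≤ μ a
  ≤μ a = ℤ.+-mono-≤ (≤Z a) (ℤ.neg-mono-≤ (O≤3 a))

  -- Twice the indicator of ℓ (t w³) = 1.
  weight : Carrier → Carrier → ℤ
  weight t w = 1ℤ ℤ.- χ (t · (w · w · w))

  -- The Fourier transform of the connection set is (q / 2) μ.
  eigenvalue : ∀ a → ∑[ t ∈ 𝐅 ] (∑[ w ∈ 𝐅 ] (χ (a ∙ point t w) ℤ.* weight t w)) ≡ + q ℤ.* μ a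
  eigenvalue a = begin
    ∑[ t ∈ 𝐅 ] (∑[ w ∈ 𝐅 ] (χ (a ∙ point t w) ℤ.* weight t w))
      -- For fixed w both exponents are linear in t, with slopes `h a w` and `g a w`. Summing over t
      -- first therefore detects the zeros of these slopes.
      ≡⟨ ∑-swap (λ t w → χ (a ∙ point t w) ℤ.* weight t w) ⟩
    ∑[ w ∈ 𝐅 ] (∑[ t ∈ 𝐅 ] (χ (a ∙ point t w) ℤ.* weight t w))
      ≡⟨ ∑-cong (λ w → ∑-cong (λ t → term t w)) ⟩
    ∑[ w ∈ 𝐅 ] (∑[ t ∈ 𝐅 ] (χ (t · h a w) ℤ.- χ (t · g a w)))
      ≡⟨ ∑-cong (λ w → trans (∑-- (λ t → χ (t · h a w)) (λ t →
            χ (t · g a w))) (cong₂ ℤ._-_ (∑χ (h a w)) (∑χ (g a w)))) ⟩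
    ∑[ w ∈ 𝐅 ] (+ q ℤ.* 𝟙 (h a w ≟ 0#) ℤ.- + q ℤ.* 𝟙 (g a w ≟ 0#))
      ≡⟨ ∑-- (λ w → + q ℤ.* 𝟙 (h a w ≟ 0#)) (λ w → + q ℤ.* 𝟙 (g a w ≟ 0#)) ⟩
    ∑[ w ∈ 𝐅 ] (+ q ℤ.* 𝟙 (h a w ≟ 0#)) ℤ.- ∑[ w ∈ 𝐅 ] (+ q ℤ.* 𝟙 (g a w ≟ 0#))
      ≡⟨ cong₂ ℤ._-_ (∑-*ˡ (+ q) (λ w → 𝟙 (h a w ≟ 0#))) (∑-*ˡ (+ q) (λ w → 𝟙 (g a w ≟ 0#))) ⟩
    + q ℤ.* Z a ℤ.- + q ℤ.* O a
      ≡⟨ ℤS.solve 3 (λ q z o → q ℤS.:* z ℤS.:- q ℤS.:* o ℤS.:= q ℤS.:* (z ℤS.:- o)) refl (+ q) (Z a) (O a) ⟩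
    + q ℤ.* μ a ∎
    where
    open ≡-Reasoning
    dot-point : ∀ a t w → a ∙ point t w ≡ t · h a w
    dot-point (a , b , c) t w = solve 5 (λ a b c t w →
      a :* t :+ b :* (t :* w) :+ c :* (t :* w :* w) := t :* (a :+ w :* (b :+ w :* c))) refl a b c t w
    dot-point-⊕ : ∀ a t w → a ∙ point t w ⊕ t · (w · w · w) ≡ t · g a w
    dot-point-⊕ (a , b , c) t w = solve 5 (λ a b c t w →
      a :* t :+ b :* (t :* w) :+ c :* (t :* w :* w) :+ t :* (w :* w :* w) :=
      t :* (a :+ w :* (b :+ w :* (c :+ w :* con true)))) refl a b c t w
    term : ∀ t w → χ (a ∙ point t w) ℤ.* weight t w ≡ χ (t · h a w) ℤ.- χ (t · g a w)
    term t w = begin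
      x ℤ.* (1ℤ ℤ.- y)              
            ≡⟨ ℤS.solve 2 (λ x y → x ℤS.:* (ℤS.con 1ℤ ℤS.:- y) ℤS.:= x ℤS.:- x ℤS.:* y) refl x y ⟩
      x ℤ.- x ℤ.* y                  ≡⟨ cong (ℤ._-_ x) (χ-⊕ (a ∙ point t w) (t · (w · w · w))) ⟨
      x ℤ.- χ (a ∙ point t w ⊕ t · (w · w · w))
            ≡⟨ cong₂ ℤ._-_ (cong χ (dot-point a t w)) (cong χ (dot-point-⊕ a t w)) ⟩
      χ (t · h a w) ℤ.- χ (t · g a w) ∎
      where
      x y : ℤ
      x = χ (a ∙ point t w)
      y = χ (t · (w · w · w))

  -- Each element of `S` comes from exactly one pair: t is its first coordinate, and t ≠ 0, forced
  -- by the condition on `ℓ`, lets w be recovered from the second.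
  2𝟙-S : ∀ z → + 2 ℤ.* 𝟙 (S? z) ≡
    ∑[ t ∈ 𝐅 ] (∑[ w ∈ 𝐅 ] (𝟙 (z ≟V point t w) ℤ.* weight t w))
  2𝟙-S z = begin
    + 2 ℤ.* 𝟙 (S? z)
      ≡⟨ cong (+ 2 ℤ.*_) (∑-unique (λ t → Finite.∃? 𝐅 (R? t)) (λ { (_ , z≡ , _) (_ , z≡′ , _) →
            trans (sym (cong proj₁ z≡)) (cong proj₁ z≡′) }) (S? z)) ⟨
    + 2 ℤ.* ∑[ t ∈ 𝐅 ] 𝟙 (Finite.∃? 𝐅 (R? t))
      ≡⟨ cong (+ 2 ℤ.*_) (∑-cong (λ t → ∑-unique (R? t) (unique t) (Finite.∃? 𝐅 (R? t)))) ⟨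
    + 2 ℤ.* ∑[ t ∈ 𝐅 ] (∑[ w ∈ 𝐅 ] 𝟙 (R? t w))
      ≡⟨ ∑-*ˡ (+ 2) (λ t → ∑[ w ∈ 𝐅 ] 𝟙 (R? t w)) ⟨
    ∑[ t ∈ 𝐅 ] (+ 2 ℤ.* ∑[ w ∈ 𝐅 ] 𝟙 (R? t w))
      ≡⟨ ∑-cong (λ t → ∑-*ˡ (+ 2) (λ w → 𝟙 (R? t w))) ⟨
    ∑[ t ∈ 𝐅 ] (∑[ w ∈ 𝐅 ] (+ 2 ℤ.* 𝟙 (R? t w)))
      ≡⟨ ∑-cong (λ t → ∑-cong (λ w → term t w)) ⟩
    ∑[ t ∈ 𝐅 ] (∑[ w ∈ 𝐅 ] (𝟙 (z ≟V point t w) ℤ.* weight t w)) ∎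
    where
    open ≡-Reasoning
    R : Carrier → Carrier → Set
    R t w = z ≡ point t w × ℓ (t · (w · w · w)) ≡ true
    R? : ∀ t w → Dec (R t w)
    R? t w = (z ≟V point t w) ×-dec (ℓ (t · (w · w · w)) Bool.≟ true)
    unique : ∀ t {w w′} → R t w → R t w′ → w ≡ w′
    unique t {w} (z≡ , ℓ≡) (z≡′ , _) = ·-cancelˡ t≢0 (trans (sym (cong (proj₁ ∘ proj₂) z≡)) (cong
          (proj₁ ∘ proj₂) z≡′))
      where
      t≢0 : t ≢ 0#
      t≢0 refl with trans (sym ℓ≡) (trans (cong ℓ (zeroˡ (w · w · w))) ℓ-0#)
      ... | ()
    term : ∀ t w → + 2 ℤ.* 𝟙 (R? t w) ≡ 𝟙 (z ≟V point t w) ℤ.* weight t w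
    term t w = begin
      + 2 ℤ.* 𝟙 (R? t w)     ≡⟨ cong (+ 2 ℤ.*_) (𝟙-×-dec (z ≟V point t w) (ℓ (t · (w · w · w)) Bool.≟ true)) ⟩
      + 2 ℤ.* (x ℤ.* y)     
            ≡⟨ ℤS.solve 2 (λ x y → ℤS.con (+ 2) ℤS.:* (x ℤS.:* y) ℤS.:= x ℤS.:* (ℤS.con (+ 2) ℤS.:* y)) refl x y ⟩
      x ℤ.* (+ 2 ℤ.* y)      ≡⟨ cong (x ℤ.*_) (2𝟙-true (ℓ (t · (w · w · w)))) ⟩
      x ℤ.* weight t w ∎
      where
      x y : ℤ
      x = 𝟙 (z ≟V point t w)
      y = 𝟙 (ℓ (t · (w · w · w)) Bool.≟ true)

  -- Fourier inversion, multiplied by `N` in place of a division: `orthogonality` replaces the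
  -- indicator of z = `point t w` by a character sum, and the sums over t and w then collect into
  -- `eigenvalue`.
  fourier-S : ∀ z → + N ℤ.* (+ 2 ℤ.* 𝟙 (S? z)) ≡ ∑[ a ∈ 𝐕 ] (+ q ℤ.* μ a ℤ.* χ (a ∙ z))
  fourier-S z = begin
    + N ℤ.* (+ 2 ℤ.* 𝟙 (S? z))
      ≡⟨ cong (+ N ℤ.*_) (2𝟙-S z) ⟩
    + N ℤ.* ∑[ t ∈ 𝐅 ] (∑[ w ∈ 𝐅 ] (𝟙 (z ≟V point t w) ℤ.* weight t w))
      ≡⟨ ∑-*ˡ (+ N) (λ t → ∑[ w ∈ 𝐅 ] (𝟙 (z ≟V point t w) ℤ.* weight t w)) ⟨
    ∑[ t ∈ 𝐅 ] (+ N ℤ.* ∑[ w ∈ 𝐅 ] (𝟙 (z ≟V point t w) ℤ.* weight t w))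
      ≡⟨ ∑-cong (λ t → ∑-*ˡ (+ N) (λ w → 𝟙 (z ≟V point t w) ℤ.* weight t w)) ⟨
    ∑[ t ∈ 𝐅 ] (∑[ w ∈ 𝐅 ] (+ N ℤ.* (𝟙 (z ≟V point t w) ℤ.* weight t w)))
      ≡⟨ ∑-cong (λ t → ∑-cong (λ w → term t w)) ⟩
    ∑[ t ∈ 𝐅 ] (∑[ w ∈ 𝐅 ] (∑[ a ∈ 𝐕 ] (χ (a ∙ z) ℤ.* (χ (a ∙ point t w) ℤ.* weight t w))))
      ≡⟨ ∑-cong (λ t → ∑-swap (λ w a → χ (a ∙ z) ℤ.* (χ (a ∙ point t w) ℤ.* weight t w))) ⟩
    ∑[ t ∈ 𝐅 ] (∑[ a ∈ 𝐕 ] (∑[ w ∈ 𝐅 ] (χ (a ∙ z) ℤ.* (χ (a ∙ point t w) ℤ.* weight t w))))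
      ≡⟨ ∑-swap (λ t a → ∑[ w ∈ 𝐅 ] (χ (a ∙ z) ℤ.* (χ (a ∙ point t w) ℤ.* weight t w))) ⟩
    ∑[ a ∈ 𝐕 ] (∑[ t ∈ 𝐅 ] (∑[ w ∈ 𝐅 ] (χ (a ∙ z) ℤ.* (χ (a ∙ point t w) ℤ.* weight t w))))
      ≡⟨ ∑-cong (λ a → ∑-cong (λ t → ∑-*ˡ (χ (a ∙ z)) (λ w → χ (a ∙ point t w) ℤ.* weight t w))) ⟩
    ∑[ a ∈ 𝐕 ] (∑[ t ∈ 𝐅 ] (χ (a ∙ z) ℤ.* ∑[ w ∈ 𝐅 ] (χ (a ∙ point t w) ℤ.* weight t w)))
      ≡⟨ ∑-cong (λ a → ∑-*ˡ (χ (a ∙ z)) (λ t → ∑[ w ∈ 𝐅 ] (χ (a ∙ point t w) ℤ.* weight t w))) ⟩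
    ∑[ a ∈ 𝐕 ] (χ (a ∙ z) ℤ.* ∑[ t ∈ 𝐅 ] (∑[ w ∈ 𝐅 ] (χ (a ∙ point t w) ℤ.* weight t w)))
      ≡⟨ ∑-cong (λ a → trans (cong (χ (a ∙ z) ℤ.*_) (eigenvalue a)) (ℤ.*-comm (χ (a ∙ z)) (+ q ℤ.* μ a))) ⟩
    ∑[ a ∈ 𝐕 ] (+ q ℤ.* μ a ℤ.* χ (a ∙ z)) ∎
    where
    open ≡-Reasoning
    term : ∀ t w → + N ℤ.* (𝟙 (z ≟V point t w) ℤ.* weight t w)
          ≡ ∑[ a ∈ 𝐕 ] (χ (a ∙ z) ℤ.* (χ (a ∙ point t w) ℤ.* weight t w))
    term t w = begin
      + N ℤ.* (𝟙 (z ≟V point t w) ℤ.* weight t w)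
        ≡⟨ ℤ.*-assoc (+ N) (𝟙 (z ≟V point t w)) (weight t w) ⟨
      + N ℤ.* 𝟙 (z ≟V point t w) ℤ.* weight t w
        ≡⟨ cong (ℤ._* weight t w) (orthogonality z (point t w)) ⟨
      ∑[ a ∈ 𝐕 ] (χ (a ∙ z) ℤ.* χ (a ∙ point t w)) ℤ.* weight t w
        ≡⟨ ∑-*ʳ (weight t w) (λ a → χ (a ∙ z) ℤ.* χ (a ∙ point t w)) ⟨
      ∑[ a ∈ 𝐕 ] (χ (a ∙ z) ℤ.* χ (a ∙ point t w) ℤ.* weight t w)
        ≡⟨ ∑-cong (λ a → ℤ.*-assoc (χ (a ∙ z)) (χ (a ∙ point t w)) (weight t w)) ⟩
      ∑[ a ∈ 𝐕 ] (χ (a ∙ z) ℤ.* (χ (a ∙ point t w) ℤ.* weight t w)) ∎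

  q-nonZero : ℕ.NonZero q
  q-nonZero = inhabited (Finite.index 𝐅 0#)
    where
    inhabited : ∀ {n} → Fin n → ℕ.NonZero n
    inhabited {suc n} _ = _

  cancel-q² : ∀ {i j} → + q ℤ.* + q ℤ.* i ℤ.≤ + q ℤ.* + q ℤ.* j → i ℤ.≤ j
  cancel-q² {i} {j} = ℤ.*-cancelˡ-≤-pos i j (+ q ℤ.* + q) {{ℤ.positive
    (subst (0ℤ ℤ.<_) (ℤ.pos-* q q) (ℤ.+<+ (ℕ.>-nonZero⁻¹ (q ℕ.* q) {{ℕ.m*n≢0 q q {{q-nonZero}} {{q-nonZero}}}})))}}

  N≡q³ : + N ≡ + q ℤ.* (+ q ℤ.* + q)
  N≡q³ = trans (cong +_ size-𝐕) (trans (ℤ.pos-* q (q ℕ.* q)) (cong (+ q ℤ.*_) (ℤ.pos-* q q)))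

  -- Spectral bounds on the quadratic form of the adjacency matrix.

  module _ (ξ : V → ℤ) where

    M E Q : ℤ
    M = ∑[ u ∈ 𝐕 ] ξ u
    E = ∑[ u ∈ 𝐕 ] (ξ u ℤ.* ξ u)
    Q = ∑[ u ∈ 𝐕 ] (∑[ v ∈ 𝐕 ] (ξ u ℤ.* ξ v ℤ.* 𝟙 (S? (u ⊞ v))))

    F F² : V → ℤ
    F a = ∑[ u ∈ 𝐕 ] (ξ u ℤ.* χ (a ∙ u))
    F² a = F a ℤ.* F a

    0≤F² : ∀ a → 0ℤ ℤ.≤ F² a
    0≤F² a = square (F a)
      where
      square : ∀ i → 0ℤ ℤ.≤ i ℤ.* i
      square (+ zero)     = ℤ.≤-refl
      square (+ suc _)    = ℤ.+≤+ ℕ.z≤n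
      square (ℤ.-[1+ _ ]) = ℤ.+≤+ ℕ.z≤n

    parseval : ∑ 𝐕 F² ≡ + N ℤ.* E
    parseval = begin
      ∑[ a ∈ 𝐕 ] F² a
        ≡⟨ ∑-cong (λ a → ℤ.*-identityˡ (F² a)) ⟨
      ∑[ a ∈ 𝐕 ] (1ℤ ℤ.* F² a)
        ≡⟨ ∑-gram 𝐕 𝐕 (λ _ → 1ℤ) (λ a u → χ (a ∙ u)) ξ ⟨
      ∑[ u ∈ 𝐕 ] (∑[ v ∈ 𝐕 ] (ξ u ℤ.* ξ v ℤ.* ∑[ a ∈ 𝐕 ] (1ℤ ℤ.* (χ (a ∙ u) ℤ.* χ (a ∙ v)))))
        ≡⟨ ∑-cong (λ u → ∑-cong (λ v → term u v)) ⟩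
      ∑[ u ∈ 𝐕 ] (∑[ v ∈ 𝐕 ] (𝟙 (v ≟V u) ℤ.* (+ N ℤ.* (ξ u ℤ.* ξ v))))
        ≡⟨ ∑-cong (λ u → ∑-𝟙 u (λ v → + N ℤ.* (ξ u ℤ.* ξ v))) ⟩
      ∑[ u ∈ 𝐕 ] (+ N ℤ.* (ξ u ℤ.* ξ u))
        ≡⟨ ∑-*ˡ (+ N) (λ u → ξ u ℤ.* ξ u) ⟩
      + N ℤ.* E ∎
      where
      open ≡-Reasoning
      term : ∀ u v → ξ u ℤ.* ξ v ℤ.* ∑[ a ∈ 𝐕 ] (1ℤ ℤ.* (χ (a ∙ u) ℤ.* χ (a ∙ v)))
            ≡ 𝟙 (v ≟V u) ℤ.* (+ N ℤ.* (ξ u ℤ.* ξ v))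
      term u v = begin
        ξ u ℤ.* ξ v ℤ.* ∑[ a ∈ 𝐕 ] (1ℤ ℤ.* (χ (a ∙ u) ℤ.* χ (a ∙ v)))
          ≡⟨ cong (ξ u ℤ.* ξ v ℤ.*_) (trans (∑-cong (λ a →
                ℤ.*-identityˡ (χ (a ∙ u) ℤ.* χ (a ∙ v)))) (orthogonality u v)) ⟩
        ξ u ℤ.* ξ v ℤ.* (+ N ℤ.* 𝟙 (u ≟V v))
          ≡⟨ cong (λ z → ξ u ℤ.* ξ v ℤ.* (+ N ℤ.* z)) (𝟙-⇔ sym sym (u ≟V v) (v ≟V u)) ⟩
        ξ u ℤ.* ξ v ℤ.* (+ N ℤ.* 𝟙 (v ≟V u))
          ≡⟨ ℤS.solve 3 (λ x n i → x ℤS.:* (n ℤS.:* i) ℤS.:= i ℤS.:* (n ℤS.:* x))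
                refl (ξ u ℤ.* ξ v) (+ N) (𝟙 (v ≟V u)) ⟩
        𝟙 (v ≟V u) ℤ.* (+ N ℤ.* (ξ u ℤ.* ξ v)) ∎

    F-0V : F 0V ≡ M
    F-0V = ∑-cong (λ u → trans (cong (ξ u ℤ.*_) (trans (cong χ (0∙z≡0 u)) χ-0#)) (ℤ.*-identityʳ (ξ u)))

    ∑𝟙F² : ∑[ a ∈ 𝐕 ] (𝟙 (a ≟V 0V) ℤ.* F² a) ≡ M ℤ.* M
    ∑𝟙F² = trans (∑-𝟙 0V F²) (cong₂ ℤ._*_ F-0V F-0V)

    spectral-form : + N ℤ.* (+ 2 ℤ.* Q) ≡ + q ℤ.* ∑[ a ∈ 𝐕 ] (μ a ℤ.* F² a)
    spectral-form = begin
      + N ℤ.* (+ 2 ℤ.* Q)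
        ≡⟨ ℤ.*-assoc (+ N) (+ 2) Q ⟨
      + N ℤ.* + 2 ℤ.* Q
        ≡⟨ ∑-*ˡ (+ N ℤ.* + 2) (λ u → ∑[ v ∈ 𝐕 ] (ξ u ℤ.* ξ v ℤ.* 𝟙 (S? (u ⊞ v)))) ⟨
      ∑[ u ∈ 𝐕 ] (+ N ℤ.* + 2 ℤ.* ∑[ v ∈ 𝐕 ] (ξ u ℤ.* ξ v ℤ.* 𝟙 (S? (u ⊞ v))))
        ≡⟨ ∑-cong (λ u → ∑-*ˡ (+ N ℤ.* + 2) (λ v → ξ u ℤ.* ξ v ℤ.* 𝟙 (S? (u ⊞ v)))) ⟨
      ∑[ u ∈ 𝐕 ] (∑[ v ∈ 𝐕 ] (+ N ℤ.* + 2 ℤ.* (ξ u ℤ.* ξ v ℤ.* 𝟙 (S? (u ⊞ v)))))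
        ≡⟨ ∑-cong (λ u → ∑-cong (λ v → term u v)) ⟩
      ∑[ u ∈ 𝐕 ] (∑[ v ∈ 𝐕 ] (ξ u ℤ.* ξ v ℤ.* ∑[ a ∈ 𝐕 ] (+ q ℤ.* μ a ℤ.* (χ (a ∙ u) ℤ.* χ (a ∙ v)))))
        ≡⟨ ∑-gram 𝐕 𝐕 (λ a → + q ℤ.* μ a) (λ a u → χ (a ∙ u)) ξ ⟩
      ∑[ a ∈ 𝐕 ] (+ q ℤ.* μ a ℤ.* F² a)
        ≡⟨ ∑-cong (λ a → ℤ.*-assoc (+ q) (μ a) (F² a)) ⟩
      ∑[ a ∈ 𝐕 ] (+ q ℤ.* (μ a ℤ.* F² a))
        ≡⟨ ∑-*ˡ (+ q) (λ a → μ a ℤ.* F² a) ⟩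
      + q ℤ.* ∑[ a ∈ 𝐕 ] (μ a ℤ.* F² a) ∎
      where
      open ≡-Reasoning
      term : ∀ u v → + N ℤ.* + 2 ℤ.* (ξ u ℤ.* ξ v ℤ.* 𝟙 (S? (u ⊞ v))) ≡
                     ξ u ℤ.* ξ v ℤ.* ∑[ a ∈ 𝐕 ] (+ q ℤ.* μ a ℤ.* (χ (a ∙ u) ℤ.* χ (a ∙ v)))
      term u v = begin
        + N ℤ.* + 2 ℤ.* (ξ u ℤ.* ξ v ℤ.* 𝟙 (S? (u ⊞ v)))
          ≡⟨ ℤS.solve 4 (λ n t x i → n ℤS.:* t ℤS.:* (x ℤS.:* i) ℤS.:= x ℤS.:* (n ℤS.:* (t ℤS.:* i)))
                refl (+ N) (+ 2) (ξ u ℤ.* ξ v) (𝟙 (S? (u ⊞ v))) ⟩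
        ξ u ℤ.* ξ v ℤ.* (+ N ℤ.* (+ 2 ℤ.* 𝟙 (S? (u ⊞ v))))
          ≡⟨ cong (ξ u ℤ.* ξ v ℤ.*_) (fourier-S (u ⊞ v)) ⟩
        ξ u ℤ.* ξ v ℤ.* ∑[ a ∈ 𝐕 ] (+ q ℤ.* μ a ℤ.* χ (a ∙ (u ⊞ v)))
          ≡⟨ cong (ξ u ℤ.* ξ v ℤ.*_) (∑-cong (λ a →
                cong (+ q ℤ.* μ a ℤ.*_) (trans (cong χ (∙-⊞ʳ a u v)) (χ-⊕ (a ∙ u) (a ∙ v))))) ⟩
        ξ u ℤ.* ξ v ℤ.* ∑[ a ∈ 𝐕 ] (+ q ℤ.* μ a ℤ.* (χ (a ∙ u) ℤ.* χ (a ∙ v))) ∎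

    ∑μF² : ∀ c → ∑[ a ∈ 𝐕 ] ((+ q ℤ.* 𝟙 (a ≟V 0V) ℤ.+ c) ℤ.* F² a) ≡ + q ℤ.* (M ℤ.* M) ℤ.+ c ℤ.* (+ N ℤ.* E)
    ∑μF² c = begin
      ∑[ a ∈ 𝐕 ] ((+ q ℤ.* 𝟙 (a ≟V 0V) ℤ.+ c) ℤ.* F² a)
        ≡⟨ ∑-cong (λ a → ℤS.solve 4 (λ q i c f →
              (q ℤS.:* i ℤS.:+ c) ℤS.:* f ℤS.:= q ℤS.:* (i ℤS.:* f) ℤS.:+ c ℤS.:* f)
                    refl (+ q) (𝟙 (a ≟V 0V)) c (F² a)) ⟩
      ∑[ a ∈ 𝐕 ] (+ q ℤ.* (𝟙 (a ≟V 0V) ℤ.* F² a) ℤ.+ c ℤ.* F² a)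
        ≡⟨ ∑-+ (λ a → + q ℤ.* (𝟙 (a ≟V 0V) ℤ.* F² a)) (λ a → c ℤ.* F² a) ⟩
      ∑[ a ∈ 𝐕 ] (+ q ℤ.* (𝟙 (a ≟V 0V) ℤ.* F² a)) ℤ.+ ∑[ a ∈ 𝐕 ] (c ℤ.* F² a)
        ≡⟨ cong₂ ℤ._+_ (∑-*ˡ (+ q) (λ a → 𝟙 (a ≟V 0V) ℤ.* F² a)) (∑-*ˡ c F²) ⟩
      + q ℤ.* ∑[ a ∈ 𝐕 ] (𝟙 (a ≟V 0V) ℤ.* F² a) ℤ.+ c ℤ.* ∑ 𝐕 F²
        ≡⟨ cong₂ (λ x y → + q ℤ.* x ℤ.+ c ℤ.* y) ∑𝟙F² parseval ⟩
      + q ℤ.* (M ℤ.* M) ℤ.+ c ℤ.* (+ N ℤ.* E) ∎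
      where open ≡-Reasoning

    -- Rewrites `N` as q³ to expose the factor q² that `cancel-q²` removes from both bounds below.
    spectral-form′ : + q ℤ.* + q ℤ.* (+ 2 ℤ.* + q ℤ.* Q) ≡ + q ℤ.* ∑[ a ∈ 𝐕 ] (μ a ℤ.* F² a)
    spectral-form′ = trans
      (ℤS.solve 2 (λ q x → q ℤS.:* q ℤS.:* (ℤS.con (+ 2) ℤS.:* q ℤS.:* x) ℤS.:= q ℤS.:* (q ℤS.:* q) ℤS.:*
            (ℤS.con (+ 2) ℤS.:* x)) refl (+ q) Q)
      (trans (cong (ℤ._* (+ 2 ℤ.* Q)) (sym N≡q³)) spectral-form)

    expand : ∀ c → + q ℤ.* (+ q ℤ.* (M ℤ.* M) ℤ.+ c ℤ.* (+ N ℤ.* E)) ≡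
                   + q ℤ.* + q ℤ.* (M ℤ.* M ℤ.+ c ℤ.* (+ q ℤ.* + q ℤ.* E))
    expand c = trans (cong (λ n → + q ℤ.* (+ q ℤ.* (M ℤ.* M) ℤ.+ c ℤ.* (n ℤ.* E))) N≡q³)
      (ℤS.solve 4 (λ q m c e → q ℤS.:* (q ℤS.:* m ℤS.:+ c ℤS.:* (q ℤS.:* (q ℤS.:* q) ℤS.:* e)) ℤS.:=
        q ℤS.:* q ℤS.:* (m ℤS.:+ c ℤS.:* (q ℤS.:* q ℤS.:* e))) refl (+ q) (M ℤ.* M) c E)

    -- Since `F²` is nonnegative, the pointwise bound `μ≤` may be summed against it. The trivial
    -- character contributes the main term M², as `F` at `0V` is M; Parseval turns the constant 2
    -- into the error term.
    upper : + 2 ℤ.* + q ℤ.* Q ℤ.≤ M ℤ.* M ℤ.+ + 2 ℤ.* (+ q ℤ.* + q ℤ.* E)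
    upper = cancel-q² (begin
      + q ℤ.* + q ℤ.* (+ 2 ℤ.* + q ℤ.* Q)
        ≡⟨ spectral-form′ ⟩
      + q ℤ.* ∑[ a ∈ 𝐕 ] (μ a ℤ.* F² a)
        ≤⟨ ℤ.*-monoˡ-≤-nonNeg (+ q) (∑-mono (λ a → ℤ.*-monoʳ-≤-nonNeg (F² a) {{ℤ.nonNegative (0≤F² a)}} (μ≤ a))) ⟩
      + q ℤ.* ∑[ a ∈ 𝐕 ] ((+ q ℤ.* 𝟙 (a ≟V 0V) ℤ.+ + 2) ℤ.* F² a)
        ≡⟨ cong (+ q ℤ.*_) (∑μF² (+ 2)) ⟩
      + q ℤ.* (+ q ℤ.* (M ℤ.* M) ℤ.+ + 2 ℤ.* (+ N ℤ.* E))
        ≡⟨ expand (+ 2) ⟩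
      + q ℤ.* + q ℤ.* (M ℤ.* M ℤ.+ + 2 ℤ.* (+ q ℤ.* + q ℤ.* E)) ∎)
      where open ℤ.≤-Reasoning

    lower : M ℤ.* M ℤ.+ ℤ.- + 3 ℤ.* (+ q ℤ.* + q ℤ.* E) ℤ.≤ + 2 ℤ.* + q ℤ.* Q
    lower = cancel-q² (begin
      + q ℤ.* + q ℤ.* (M ℤ.* M ℤ.+ ℤ.- + 3 ℤ.* (+ q ℤ.* + q ℤ.* E))
        ≡⟨ expand (ℤ.- + 3) ⟨
      + q ℤ.* (+ q ℤ.* (M ℤ.* M) ℤ.+ ℤ.- + 3 ℤ.* (+ N ℤ.* E))
        ≡⟨ cong (+ q ℤ.*_) (∑μF² (ℤ.- + 3)) ⟨
      + q ℤ.* ∑[ a ∈ 𝐕 ] ((+ q ℤ.* 𝟙 (a ≟V 0V) ℤ.- + 3) ℤ.* F² a)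
        ≤⟨ ℤ.*-monoˡ-≤-nonNeg (+ q) (∑-mono (λ a → ℤ.*-monoʳ-≤-nonNeg (F² a) {{ℤ.nonNegative (0≤F² a)}} (≤μ a))) ⟩
      + q ℤ.* ∑[ a ∈ 𝐕 ] (μ a ℤ.* F² a)
        ≡⟨ spectral-form′ ⟨
      + q ℤ.* + q ℤ.* (+ 2 ℤ.* + q ℤ.* Q) ∎)
      where open ℤ.≤-Reasoning

-- Counting edges

sumᴸ : {A : Set} → (A → ℤ) → List A → ℤ
sumᴸ f = foldr (λ x s → f x ℤ.+ s) 0ℤ

sumᴸ-++ : ∀ {A : Set} (f : A → ℤ) xs ys → sumᴸ f (xs ++ ys) ≡ sumᴸ f xs ℤ.+ sumᴸ f ys
sumᴸ-++ f []       ys = sym (ℤ.+-identityˡ (sumᴸ f ys))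
sumᴸ-++ f (x ∷ xs) ys = trans (cong (ℤ._+_ (f x)) (sumᴸ-++ f xs ys)) (sym (ℤ.+-assoc (f x) (sumᴸ f xs) (sumᴸ f ys)))

sumᴸ-map : ∀ {A B : Set} (f : A → ℤ) (g : B → A) xs → sumᴸ f (map g xs) ≡ sumᴸ (f ∘ g) xs
sumᴸ-map f g []       = refl
sumᴸ-map f g (x ∷ xs) = cong (ℤ._+_ (f (g x))) (sumᴸ-map f g xs)

sumᴸ-tabulate : ∀ {A : Set} {n} (f : A → ℤ) (g : Fin n → A) → sumᴸ f (tabulate g) ≡ ∑ (finite-Fin n) (f ∘ g)
sumᴸ-tabulate f g = trans (go f g) (sym (∑-Fin (f ∘ g)))
  where
  go : ∀ {A : Set} {n} (f : A → ℤ) (g : Fin n → A) → sumᴸ f (tabulate g) ≡ Sum.sum (f ∘ g)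
  go {n = zero}  f g = refl
  go {n = suc n} f g = cong (ℤ._+_ (f (g zero))) (go f (g ∘ suc))

length-filter : ∀ {A : Set} {P : A → Set} (P? : ∀ x → Dec (P x)) xs → + length (filter P? xs) ≡ sumᴸ (𝟙 ∘ P?) xs
length-filter P? [] = refl
length-filter P? (x ∷ xs) with P? x
... | yes _ = cong (ℤ._+_ 1ℤ) (length-filter P? xs)
... | no _  = trans (length-filter P? xs) (sym (ℤ.+-identityˡ (sumᴸ (𝟙 ∘ P?) xs)))

sumᴸ-cartesianProduct : ∀ {A B : Set} (f : A × B → ℤ) xs ys →
  sumᴸ f (cartesianProduct xs ys) ≡ sumᴸ (λ x → sumᴸ (λ y → f (x , y)) ys) xs
sumᴸ-cartesianProduct f []       ys = refl
sumᴸ-cartesianProduct f (x ∷ xs) ys = trans (sumᴸ-++ f (map (x ,_) ys) (cartesianProduct xs ys))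
  (cong₂ ℤ._+_ (sumᴸ-map f (x ,_) ys) (sumᴸ-cartesianProduct f xs ys))

length-filter-pairs : ∀ {n} {P : Fin n × Fin n → Set} (P? : ∀ x → Dec (P x)) →
  + length (filter P? (cartesianProduct (allFin n) (allFin n))) ≡
  ∑[ i ∈ finite-Fin n ] (∑[ j ∈ finite-Fin n ] 𝟙 (P? (i , j)))
length-filter-pairs {n} P? = begin
  + length (filter P? (cartesianProduct (allFin n) (allFin n)))
    ≡⟨ length-filter P? (cartesianProduct (allFin n) (allFin n)) ⟩
  sumᴸ (𝟙 ∘ P?) (cartesianProduct (allFin n) (allFin n))
    ≡⟨ sumᴸ-cartesianProduct (𝟙 ∘ P?) (allFin n) (allFin n) ⟩
  sumᴸ (λ i → sumᴸ (λ j → 𝟙 (P? (i , j))) (allFin n)) (allFin n)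
    ≡⟨ sumᴸ-tabulate (λ i → sumᴸ (λ j → 𝟙 (P? (i , j))) (allFin n)) id ⟩
  ∑[ i ∈ finite-Fin n ] sumᴸ (λ j → 𝟙 (P? (i , j))) (allFin n)
    ≡⟨ ∑-cong (λ i → sumᴸ-tabulate (λ j → 𝟙 (P? (i , j))) id) ⟩
  ∑[ i ∈ finite-Fin n ] (∑[ j ∈ finite-Fin n ] 𝟙 (P? (i , j))) ∎
  where open ≡-Reasoning

∑-membership : ∀ {n} (X : Subset n) → ∑[ i ∈ finite-Fin n ] 𝟙 (i ∈? X) ≡ + Subset.∣ X ∣
∑-membership X = trans (∑-Fin (λ i → 𝟙 (i ∈? X))) (go X)
  where
  go : ∀ {n} (X : Subset n) → Sum.sum (λ i → 𝟙 (i ∈? X)) ≡ + Subset.∣ X ∣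
  go []          = refl
  go (true ∷ X)  = cong (ℤ._+_ 1ℤ) (go X)
  go (false ∷ X) = trans (ℤ.+-identityˡ _) (go X)

𝟙-idem : {P : Set} (d : Dec P) → 𝟙 d ℤ.* 𝟙 d ≡ 𝟙 d
𝟙-idem (yes _) = refl
𝟙-idem (no _)  = refl

module _ {n} (G : Graph n) (X : Subset n) where

  private
    f : Fin n → Fin n → ℤ
    f i j = 𝟙 (i ∈? X) ℤ.* 𝟙 (j ∈? X) ℤ.* 𝟙 (adj? G i j)

    f-sym : ∀ i j → f i j ≡ f j i
    f-sym i j = cong₂ ℤ._*_ (ℤ.*-comm (𝟙 (i ∈? X)) (𝟙 (j ∈? X)))
      (𝟙-⇔ (symmetric G) (symmetric G) (adj? G i j) (adj? G j i))

    f-diagonal : ∀ i → f i i ≡ 0ℤ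
    f-diagonal i = trans (cong (𝟙 (i ∈? X) ℤ.* 𝟙 (i ∈? X) ℤ.*_) (𝟙-no (adj? G i i) (irreflexive G refl)))
      (ℤ.*-zeroʳ (𝟙 (i ∈? X) ℤ.* 𝟙 (i ∈? X)))

    split : ∀ i j → 𝟙 (i Fin.<? j) ℤ.* f i j ℤ.+ 𝟙 (j Fin.<? i) ℤ.* f j i ≡ f i j
    split i j with Fin.<-cmp i j
    ... | tri< i<j _ j≮i = trans
      (cong₂ (λ x y → x ℤ.* f i j ℤ.+ y ℤ.* f j i) (𝟙-yes (i Fin.<? j) i<j) (𝟙-no (j Fin.<? i) j≮i))
      (trans (ℤ.+-identityʳ (1ℤ ℤ.* f i j)) (ℤ.*-identityˡ (f i j)))
    ... | tri≈ i≮j refl _ = trans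
      (cong (λ x → x ℤ.* f i i ℤ.+ x ℤ.* f i i) (𝟙-no (i Fin.<? i) i≮j))
      (sym (f-diagonal i))
    ... | tri> i≮j _ j<i = trans
      (cong₂ (λ x y → x ℤ.* f i j ℤ.+ y ℤ.* f j i) (𝟙-no (i Fin.<? j) i≮j) (𝟙-yes (j Fin.<? i) j<i))
      (trans (ℤ.+-identityˡ (1ℤ ℤ.* f j i)) (trans (ℤ.*-identityˡ (f j i)) (f-sym j i)))

  e-∑ : + e G X ≡ ∑[ i ∈ finite-Fin n ] (∑[ j ∈ finite-Fin n ] (𝟙 (i Fin.<? j) ℤ.* f i j))
  e-∑ = trans
    (length-filter-pairs (λ (u , v) → u Fin.<? v ×-dec u ∈? X ×-dec v ∈? X ×-dec adj? G u v))
    (∑-cong (λ i → ∑-cong (λ j → begin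
      𝟙 (i Fin.<? j ×-dec i ∈? X ×-dec j ∈? X ×-dec adj? G i j)
        ≡⟨ 𝟙-×-dec (i Fin.<? j) (i ∈? X ×-dec j ∈? X ×-dec adj? G i j) ⟩
      𝟙 (i Fin.<? j) ℤ.* 𝟙 (i ∈? X ×-dec j ∈? X ×-dec adj? G i j)
        ≡⟨ cong (𝟙 (i Fin.<? j) ℤ.*_) (𝟙-×-dec (i ∈? X) (j ∈? X ×-dec adj? G i j)) ⟩
      𝟙 (i Fin.<? j) ℤ.* (𝟙 (i ∈? X) ℤ.* 𝟙 (j ∈? X ×-dec adj? G i j))
        ≡⟨ cong (λ x → 𝟙 (i Fin.<? j) ℤ.* (𝟙 (i ∈? X) ℤ.* x)) (𝟙-×-dec (j ∈? X) (adj? G i j)) ⟩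
      𝟙 (i Fin.<? j) ℤ.* (𝟙 (i ∈? X) ℤ.* (𝟙 (j ∈? X) ℤ.* 𝟙 (adj? G i j)))
        ≡⟨ cong (𝟙 (i Fin.<? j) ℤ.*_) (ℤ.*-assoc (𝟙 (i ∈? X)) (𝟙 (j ∈? X)) (𝟙 (adj? G i j))) ⟨
      𝟙 (i Fin.<? j) ℤ.* f i j ∎)))
    where open ≡-Reasoning

  -- Exchanging i and j in one of two copies of the edge count makes the copies cover both orders of
  -- every pair. The diagonal contributes nothing, by irreflexivity.
  handshake : + 2 ℤ.* + e G X ≡
    ∑[ i ∈ finite-Fin n ] (∑[ j ∈ finite-Fin n ] (𝟙 (i ∈? X) ℤ.* 𝟙 (j ∈? X) ℤ.* 𝟙 (adj? G i j)))
  handshake = begin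
    + 2 ℤ.* + e G X
      ≡⟨ solve 1 (λ x → con (+ 2) :* x := x :+ x) refl (+ e G X) ⟩
    + e G X ℤ.+ + e G X
      ≡⟨ cong₂ ℤ._+_ e-∑ (trans e-∑ (∑-swap (λ i j → 𝟙 (i Fin.<? j) ℤ.* f i j))) ⟩
    ∑[ i ∈ 𝐧 ] (∑[ j ∈ 𝐧 ] (𝟙 (i Fin.<? j) ℤ.* f i j)) ℤ.+ ∑[ i ∈ 𝐧 ] (∑[ j ∈ 𝐧 ] (𝟙 (j Fin.<? i) ℤ.* f j i))
      ≡⟨ ∑-+ (λ i → ∑[ j ∈ 𝐧 ] (𝟙 (i Fin.<? j) ℤ.* f i j)) (λ i → ∑[ j ∈ 𝐧 ] (𝟙 (j Fin.<? i) ℤ.* f j i)) ⟨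
    ∑[ i ∈ 𝐧 ] (∑[ j ∈ 𝐧 ] (𝟙 (i Fin.<? j) ℤ.* f i j) ℤ.+ ∑[ j ∈ 𝐧 ] (𝟙 (j Fin.<? i) ℤ.* f j i))
      ≡⟨ ∑-cong (λ i → ∑-+ (λ j → 𝟙 (i Fin.<? j) ℤ.* f i j) (λ j → 𝟙 (j Fin.<? i) ℤ.* f j i)) ⟨
    ∑[ i ∈ 𝐧 ] (∑[ j ∈ 𝐧 ] (𝟙 (i Fin.<? j) ℤ.* f i j ℤ.+ 𝟙 (j Fin.<? i) ℤ.* f j i))
      ≡⟨ ∑-cong (λ i → ∑-cong (split i)) ⟩
    ∑[ i ∈ 𝐧 ] (∑[ j ∈ 𝐧 ] f i j) ∎
    where
    open ≡-Reasoning
    open ℤS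
    𝐧 : Finite (Fin n)
    𝐧 = finite-Fin n

-- The Cayley graph and its edge counts.

module Construction (K : BinaryField) where

  open BinaryField K
  open Spectrum K
  open Finite 𝐕 using (element; index; index-element)

  graph : Graph N
  graph = record
    { Adj         = λ i j → S (element i ⊞ element j)
    ; adj?        = λ i j → S? (element i ⊞ element j)
    ; symmetric   = λ {i} {j} → subst S (⊞-comm (element i) (element j))
    ; irreflexive = λ { {i} refl i~i → 0∉S (subst S (u⊞u≡0 (element i)) i~i) }
    }

  -- Around a triangle every vertex occurs in two differences, so in characteristic 2 the three
  -- differences sum to zero, against `no-zero-sum`.
  triangleFree : TriangleFree graph
  triangleFree {i} {j} {k} i~j j~k k~i = no-zero-sum _ _ _ i~j j~k k~i (cycle (element i) (element j) (element k))
    where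
    cycle : ∀ u v w → (u ⊞ v) ⊞ (v ⊞ w) ⊞ (w ⊞ u) ≡ 0V
    cycle (a , b , c) (a′ , b′ , c′) (a″ , b″ , c″) =
      cong₂ _,_ (vanish a a′ a″) (cong₂ _,_ (vanish b b′ b″) (vanish c c′ c″))
      where
      vanish : ∀ x y z → (x ⊕ y) ⊕ (y ⊕ z) ⊕ (z ⊕ x) ≡ 0#
      vanish = solve 3 (λ x y z → (x :+ y) :+ (y :+ z) :+ (z :+ x) := con false) refl

  module _ (X : Subset N) where

    private
      ξ : V → ℤ
      ξ v = 𝟙 (index v ∈? X)

      ξ-element : ∀ i → ξ (element i) ≡ 𝟙 (i ∈? X)
      ξ-element i = cong (λ j → 𝟙 (j ∈? X)) (index-element i)

      x : ℕ
      x = Subset.∣ X ∣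

      M≡ : M ξ ≡ + x
      M≡ = trans (∑-element 𝐕 ξ) (trans (∑-cong ξ-element) (∑-membership X))

      E≡ : E ξ ≡ + x
      E≡ = trans (∑-cong (λ v → 𝟙-idem (index v ∈? X))) M≡

      Q≡ : Q ξ ≡ + 2 ℤ.* + e graph X
      Q≡ = begin
        Q ξ
          ≡⟨ ∑-cong (λ u → ∑-element 𝐕 (λ v → ξ u ℤ.* ξ v ℤ.* 𝟙 (S? (u ⊞ v)))) ⟩
        ∑[ u ∈ 𝐕 ] (∑[ j ∈ 𝐧 ] (ξ u ℤ.* ξ (element j) ℤ.* 𝟙 (S? (u ⊞ element j))))
          ≡⟨ ∑-element 𝐕 (λ u → ∑[ j ∈ 𝐧 ] (ξ u ℤ.* ξ (element j) ℤ.* 𝟙 (S? (u ⊞ element j)))) ⟩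
        ∑[ i ∈ 𝐧 ] (∑[ j ∈ 𝐧 ] (ξ (element i) ℤ.* ξ (element j) ℤ.* 𝟙 (S? (element i ⊞ element j))))
          ≡⟨ ∑-cong (λ i → ∑-cong (λ j → cong₂ (λ y z →
                y ℤ.* z ℤ.* 𝟙 (S? (element i ⊞ element j))) (ξ-element i) (ξ-element j))) ⟩
        ∑[ i ∈ 𝐧 ] (∑[ j ∈ 𝐧 ] (𝟙 (i ∈? X) ℤ.* 𝟙 (j ∈? X) ℤ.* 𝟙 (S? (element i ⊞ element j))))
          ≡⟨ handshake graph X ⟨
        + 2 ℤ.* + e graph X ∎
        where
        open ≡-Reasoning
        𝐧 : Finite (Fin N)
        𝐧 = finite-Fin N

    -- `Q` counts ordered pairs, hence twice the edges, so 2 q `Q` becomes 4 q e(X). With `e-lower`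
    -- this bounds the distance of e(X) from x² / 4q, denominators cleared.
    e-upper : 4 ℕ.* (q ℕ.* e graph X) ℕ.≤ x ℕ.* x ℕ.+ 2 ℕ.* (q ℕ.* q ℕ.* x)
    e-upper = ℤ.drop‿+≤+ (begin
      + (4 ℕ.* (q ℕ.* e graph X))
        ≡⟨ trans (ℤ.pos-* 4 (q ℕ.* e graph X)) (cong (+ 4 ℤ.*_) (ℤ.pos-* q (e graph X))) ⟩
      + 4 ℤ.* (+ q ℤ.* + e graph X)
        ≡⟨ ℤS.solve 2 (λ q e → ℤS.con (+ 4) ℤS.:* (q ℤS.:* e) ℤS.:=
             ℤS.con (+ 2) ℤS.:* q ℤS.:* (ℤS.con (+ 2) ℤS.:* e)) refl (+ q) (+ e graph X) ⟩
      + 2 ℤ.* + q ℤ.* (+ 2 ℤ.* + e graph X)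
        ≡⟨ cong (+ 2 ℤ.* + q ℤ.*_) Q≡ ⟨
      + 2 ℤ.* + q ℤ.* Q ξ
        ≤⟨ upper ξ ⟩
      M ξ ℤ.* M ξ ℤ.+ + 2 ℤ.* (+ q ℤ.* + q ℤ.* E ξ)
        ≡⟨ cong₂ (λ m e → m ℤ.* m ℤ.+ + 2 ℤ.* (+ q ℤ.* + q ℤ.* e)) M≡ E≡ ⟩
      + x ℤ.* + x ℤ.+ + 2 ℤ.* (+ q ℤ.* + q ℤ.* + x)
        ≡⟨ cong₂ (λ a b → a ℤ.+ + 2 ℤ.* b) (ℤ.pos-* x x) (trans (ℤ.pos-* (q ℕ.* q) x) (cong (ℤ._* + x)
              (ℤ.pos-* q q))) ⟨
      + (x ℕ.* x) ℤ.+ + 2 ℤ.* + (q ℕ.* q ℕ.* x)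
        ≡⟨ cong (ℤ._+_ (+ (x ℕ.* x))) (ℤ.pos-* 2 (q ℕ.* q ℕ.* x)) ⟨
      + (x ℕ.* x ℕ.+ 2 ℕ.* (q ℕ.* q ℕ.* x)) ∎)
      where open ℤ.≤-Reasoning

    e-lower : x ℕ.* x ℕ.≤ 4 ℕ.* (q ℕ.* e graph X) ℕ.+ 3 ℕ.* (q ℕ.* q ℕ.* x)
    e-lower = ℤ.drop‿+≤+ (begin
      + (x ℕ.* x)
        ≡⟨ ℤ.pos-* x x ⟩
      + x ℤ.* + x
        ≡⟨ ℤS.solve 2 (λ m e → m ℤS.:= m ℤS.:+ ℤS.con (ℤ.- + 3) ℤS.:* e ℤS.:+ ℤS.con (+ 3) ℤS.:* e)
             refl (+ x ℤ.* + x) (+ q ℤ.* + q ℤ.* + x) ⟩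
      + x ℤ.* + x ℤ.+ ℤ.- + 3 ℤ.* (+ q ℤ.* + q ℤ.* + x) ℤ.+ r
        ≡⟨ cong₂ (λ m e → m ℤ.* m ℤ.+ ℤ.- + 3 ℤ.* (+ q ℤ.* + q ℤ.* e) ℤ.+ r) M≡ E≡ ⟨
      M ξ ℤ.* M ξ ℤ.+ ℤ.- + 3 ℤ.* (+ q ℤ.* + q ℤ.* E ξ) ℤ.+ r
        ≤⟨ ℤ.+-monoˡ-≤ r (lower ξ) ⟩
      + 2 ℤ.* + q ℤ.* Q ξ ℤ.+ r
        ≡⟨ cong (λ z → + 2 ℤ.* + q ℤ.* z ℤ.+ r) Q≡ ⟩
      + 2 ℤ.* + q ℤ.* (+ 2 ℤ.* + e graph X) ℤ.+ r
        ≡⟨ cong (ℤ._+ r) (ℤS.solve 2 (λ q e → ℤS.con (+ 2) ℤS.:* q ℤS.:* (ℤS.con (+ 2) ℤS.:* e) ℤS.:=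
             ℤS.con (+ 4) ℤS.:* (q ℤS.:* e)) refl (+ q) (+ e graph X)) ⟩
      + 4 ℤ.* (+ q ℤ.* + e graph X) ℤ.+ r
        ≡⟨ cong₂ ℤ._+_
             (trans (ℤ.pos-* 4 (q ℕ.* e graph X)) (cong (+ 4 ℤ.*_) (ℤ.pos-* q (e graph X))))
             (trans (ℤ.pos-* 3 (q ℕ.* q ℕ.* x)) (cong (+ 3 ℤ.*_) (trans (ℤ.pos-* (q ℕ.* q) x) (cong (ℤ._* + x)
                   (ℤ.pos-* q q))))) ⟨
      + (4 ℕ.* (q ℕ.* e graph X) ℕ.+ 3 ℕ.* (q ℕ.* q ℕ.* x)) ∎)
      where
      open ℤ.≤-Reasoning
      r : ℤ
      r = + 3 ℤ.* (+ q ℤ.* + q ℤ.* + x)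

-- Real estimates

open ℚ-Lemmas
open Root-Lemmas
open Log-Lemmas
open Algebra.Definitions.RawSemiring ℚ.+-*-rawSemiring using () renaming (_^_ to _^ℚ_)

-- Passes from x², the main term of the spectral bounds, to the binomial coefficient in `Jumbled`;
-- the surplus x goes into the error.
2*nC2+n≡n*n : ∀ n → 2 ℕ.* (n C 2) ℕ.+ n ≡ n ℕ.* n
2*nC2+n≡n*n zero    = refl
2*nC2+n≡n*n (suc n) = begin
  2 ℕ.* (suc n C 2) ℕ.+ suc n              ≡⟨ cong (λ z → 2 ℕ.* z ℕ.+ suc n) (nCk+nC[k+1]≡[n+1]C[k+1] n 1) ⟨
  2 ℕ.* (n C 1 ℕ.+ n C 2) ℕ.+ suc n        ≡⟨ cong (λ z → 2 ℕ.* (z ℕ.+ n C 2) ℕ.+ suc n) (nC1≡n n) ⟩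
  2 ℕ.* (n ℕ.+ n C 2) ℕ.+ suc n            ≡⟨ solve 2 (λ n c → con 2 :* (n :+ c) :+ (con 1 :+ n) :=
                                                (con 2 :* c :+ n) :+ (con 2 :* n :+ con 1)) refl n (n C 2) ⟩
  (2 ℕ.* (n C 2) ℕ.+ n) ℕ.+ (2 ℕ.* n ℕ.+ 1) ≡⟨ cong (ℕ._+ (2 ℕ.* n ℕ.+ 1)) (2*nC2+n≡n*n n) ⟩
  n ℕ.* n ℕ.+ (2 ℕ.* n ℕ.+ 1)              ≡⟨ solve 1 (λ n → n :* n :+ (con 2 :* n :+ con 1) :=
                                                (con 1 :+ n) :* (con 1 :+ n)) refl n ⟩
  suc n ℕ.* suc n                          ∎
  where
  open ≡-Reasoning
  open ℕ-Solver

fromℕℚ-suc : ∀ n → fromℕℚ (suc n) ≡ fromℕℚ n ℚ.+ 1ℚ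
fromℕℚ-suc n = /-suc n 0

fromℕℚ-+ : ∀ m n → fromℕℚ (m ℕ.+ n) ≡ fromℕℚ m ℚ.+ fromℕℚ n
fromℕℚ-+ zero    n = sym (ℚ.+-identityˡ (fromℕℚ n))
fromℕℚ-+ (suc m) n = begin
  fromℕℚ (suc (m ℕ.+ n))           ≡⟨ fromℕℚ-suc (m ℕ.+ n) ⟩
  fromℕℚ (m ℕ.+ n) ℚ.+ 1ℚ          ≡⟨ cong (ℚ._+ 1ℚ) (fromℕℚ-+ m n) ⟩
  fromℕℚ m ℚ.+ fromℕℚ n ℚ.+ 1ℚ     ≡⟨ solve 2 (λ m n → m :+ n :+ con 1ℚ := m :+ con 1ℚ :+ n)
        refl (fromℕℚ m) (fromℕℚ n) ⟩
  fromℕℚ m ℚ.+ 1ℚ ℚ.+ fromℕℚ n     ≡⟨ cong (ℚ._+ fromℕℚ n) (fromℕℚ-suc m) ⟨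
  fromℕℚ (suc m) ℚ.+ fromℕℚ n      ∎
  where
  open ≡-Reasoning
  open ℚ-Solver

fromℕℚ-* : ∀ m n → fromℕℚ (m ℕ.* n) ≡ fromℕℚ m ℚ.* fromℕℚ n
fromℕℚ-* zero    n = sym (ℚ.*-zeroˡ (fromℕℚ n))
fromℕℚ-* (suc m) n = begin
  fromℕℚ (n ℕ.+ m ℕ.* n)               ≡⟨ fromℕℚ-+ n (m ℕ.* n) ⟩
  fromℕℚ n ℚ.+ fromℕℚ (m ℕ.* n)        ≡⟨ cong (ℚ._+_ (fromℕℚ n)) (fromℕℚ-* m n) ⟩
  fromℕℚ n ℚ.+ fromℕℚ m ℚ.* fromℕℚ n   ≡⟨ solve 2 (λ m n → n :+ m :* n := (m :+ con 1ℚ) :* n)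
        refl (fromℕℚ m) (fromℕℚ n) ⟩
  (fromℕℚ m ℚ.+ 1ℚ) ℚ.* fromℕℚ n       ≡⟨ cong (ℚ._* fromℕℚ n) (fromℕℚ-suc m) ⟨
  fromℕℚ (suc m) ℚ.* fromℕℚ n          ∎
  where
  open ≡-Reasoning
  open ℚ-Solver

fromℕℚ-mono : ∀ {m n} → m ℕ.≤ n → fromℕℚ m ℚ.≤ fromℕℚ n
fromℕℚ-mono {m} {n} m≤n = /-mono {m} {n} {0} {0} (ℕ.*-monoˡ-≤ 1 m≤n)

fromℕℚ*1/1+ : ∀ k m → fromℕℚ k ℚ.* 1/1+ m ≡ + k ℚ./ suc m
fromℕℚ*1/1+ zero    m = trans (ℚ.*-zeroˡ (1/1+ m)) (/-cong-≡ {0} {0} {0} {m} refl)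
fromℕℚ*1/1+ (suc k) m = begin
  fromℕℚ (suc k) ℚ.* 1/1+ m            ≡⟨ cong (ℚ._* 1/1+ m) (fromℕℚ-suc k) ⟩
  (fromℕℚ k ℚ.+ 1ℚ) ℚ.* 1/1+ m         ≡⟨ solve 2 (λ k i → (k :+ con 1ℚ) :* i := k :* i :+ i)
        refl (fromℕℚ k) (1/1+ m) ⟩
  fromℕℚ k ℚ.* 1/1+ m ℚ.+ 1/1+ m       ≡⟨ cong (ℚ._+ 1/1+ m) (fromℕℚ*1/1+ k m) ⟩
  + k ℚ./ suc m ℚ.+ 1/1+ m             ≡⟨ /-suc k m ⟨
  + suc k ℚ./ suc m                    ∎
  where
  open ≡-Reasoning
  open ℚ-Solver

*-1/ : ∀ n .{{_ : NonZero n}} → fromℕℚ n ℚ.* (+ 1 ℚ./ n) ≡ 1ℚ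
*-1/ (suc m) = trans (fromℕℚ*1/1+ (suc m) m)
  (/-cong-≡ {suc m} {1} {m} {0} (ℕ.*-comm (suc m) 1))

0<1/ : ∀ n .{{_ : NonZero n}} → 0ℚ ℚ.< (+ 1 ℚ./ n)
0<1/ (suc m) = ℚ.positive⁻¹ (+ 1 ℚ./ suc m) {{ℚ.normalize-pos 1 (suc m)}}

0≤fromℕℚ : ∀ n → 0ℚ ℚ.≤ fromℕℚ n
0≤fromℕℚ n = 0≤/ n 0

0<fromℕℚ : ∀ n .{{_ : NonZero n}} → 0ℚ ℚ.< fromℕℚ n
0<fromℕℚ n@(suc _) = ℚ.positive⁻¹ (fromℕℚ n) {{ℚ.normalize-pos n 1}}

-- Here `i` is 1 / d, given by its defining equation. Clearing the denominator reduces the estimate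
-- to two inequalities in ℕ.
∣-*∣≤ : ∀ {d i} .{{_ : NonZero d}} → fromℕℚ d ℚ.* i ≡ 1ℚ →
        ∀ a b c → d ℕ.* a ℕ.≤ b ℕ.+ d ℕ.* c → b ℕ.≤ d ℕ.* a ℕ.+ d ℕ.* c →
        ℚ.∣ fromℕℚ a ℚ.- i ℚ.* fromℕℚ b ∣ ℚ.≤ fromℕℚ c
∣-*∣≤ {d} {i} di≡1 a b c h₁ h₂ = ≤⇒∣-∣ A (i ℚ.* B) C′
  (cancel (begin
    D ℚ.* A                            ≡⟨ fromℕℚ-* d a ⟨
    fromℕℚ (d ℕ.* a)                   ≤⟨ fromℕℚ-mono h₁ ⟩
    fromℕℚ (b ℕ.+ d ℕ.* c)             ≡⟨ trans (fromℕℚ-+ b (d ℕ.* c)) (cong (ℚ._+_ B) (fromℕℚ-* d c)) ⟩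
    B ℚ.+ D ℚ.* C′                     ≡⟨ cong (ℚ._+ D ℚ.* C′) diB≡B ⟨
    D ℚ.* (i ℚ.* B) ℚ.+ D ℚ.* C′       ≡⟨ ℚ.*-distribˡ-+ D (i ℚ.* B) C′ ⟨
    D ℚ.* (i ℚ.* B ℚ.+ C′)             ∎))
  (cancel (begin
    D ℚ.* (i ℚ.* B)                    ≡⟨ diB≡B ⟩
    B                                  ≤⟨ fromℕℚ-mono h₂ ⟩
    fromℕℚ (d ℕ.* a ℕ.+ d ℕ.* c)      
          ≡⟨ trans (fromℕℚ-+ (d ℕ.* a) (d ℕ.* c)) (cong₂ ℚ._+_ (fromℕℚ-* d a) (fromℕℚ-* d c)) ⟩
    D ℚ.* A ℚ.+ D ℚ.* C′               ≡⟨ ℚ.*-distribˡ-+ D A C′ ⟨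
    D ℚ.* (A ℚ.+ C′)                   ∎))
  where
  open ℚ.≤-Reasoning
  A B C′ D : ℚ
  A = fromℕℚ a
  B = fromℕℚ b
  C′ = fromℕℚ c
  D = fromℕℚ d
  diB≡B : D ℚ.* (i ℚ.* B) ≡ B
  diB≡B = trans (sym (ℚ.*-assoc D i B)) (trans (cong (ℚ._* B) di≡1) (ℚ.*-identityˡ B))
  cancel : ∀ {x y} → D ℚ.* x ℚ.≤ D ℚ.* y → x ℚ.≤ y
  cancel = ℚ.*-cancelˡ-≤-pos D {{ℚ.positive (0<fromℕℚ d)}}

≤-fromℚ : ∀ {x y} → x ℚ.≤ y → ∀ {ε} → 0ℚ ℚ.< ε → x ℚ.≤ y ℚ.+ ε
≤-fromℚ {x} {y} x≤y {ε} 0<ε = ℚ.≤-trans x≤y (≤-+ʳ y ε (ℚ.<⇒≤ 0<ε))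

-- The approximation is either 0, hence below s, or has a cube of at most y; cubing is strictly
-- increasing.
cbrt-upper : ∀ {y s} m → 0ℚ ℚ.< s → y ℚ.≤ s ^ℚ 3 → rootApprox 3 y m ℚ.≤ s
cbrt-upper {y} {s} m 0<s y≤s³ = ℚ.≮⇒≥ (λ s<r → go s<r (rootApprox-lower 3 y m))
  where
  open ℚ.≤-Reasoning
  r : ℚ
  r = rootApprox 3 y m
  go : s ℚ.< r → ¬ (r ≡ 0ℚ ⊎ r ^ℚ 3 ℚ.≤ y)
  go s<r (inj₁ r≡0)  = ℚ.<-asym 0<s (subst (s ℚ.<_) r≡0 s<r)
  go s<r (inj₂ r³≤y) = ℚ.<-irrefl refl (begin-strict
    s ℚ.* s ^ℚ 2  <⟨ ℚ.*-monoˡ-<-pos (s ^ℚ 2) {{ℚ.positive (^-pos 2 0<s)}} s<r ⟩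
    r ℚ.* s ^ℚ 2  ≤⟨ *-mono-≤ (ℚ.<⇒≤ (ℚ.<-trans 0<s s<r)) ℚ.≤-refl (^-nonNeg 2 (ℚ.<⇒≤ 0<s)) (^-mono-≤ 2
          (ℚ.<⇒≤ 0<s) (ℚ.<⇒≤ s<r)) ⟩
    r ℚ.* r ^ℚ 2  ≤⟨ r³≤y ⟩
    y             ≤⟨ y≤s³ ⟩
    s ^ℚ 3        ∎)

root₃≤ : ∀ {y s} → 0ℚ ℚ.< s → y ℚ.≤ s ^ℚ 3 → ∀ m → seq (root 3 (fromℚ y)) m ℚ.≤ s
root₃≤ 0<s y≤s³ m = cbrt-upper m 0<s y≤s³

sqrt-lower : ∀ {y s} m → 0ℚ ℚ.≤ s → s ^ℚ 2 ℚ.≤ y → s ℚ.≤ rootApprox 2 y m ℚ.+ 1/1+ m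
sqrt-lower {y} {s} m 0≤s s²≤y = ℚ.≮⇒≥ (λ r<s → ℚ.<-irrefl refl (begin-strict
  y                                  <⟨ rootApprox-upper 2 y m ⟩
  (rootApprox 2 y m ℚ.+ 1/1+ m) ^ℚ 2 ≤⟨ ^-mono-≤ 2 (0≤+ (rootApprox-nonNeg 2 y m) (0≤/ 1 m)) (ℚ.<⇒≤ r<s) ⟩
  s ^ℚ 2                             ≤⟨ s²≤y ⟩
  y                                  ∎))
  where open ℚ.≤-Reasoning

¼ : ℚ
¼ = + 1 ℚ./ 4

-- The error 1 / (m + 1) of the approximation is at most ½ ≤ ¼ x.
¼≤√ : ∀ {a n x} → fromℕℚ 2 ℚ.≤ x → (½ ℚ.* x) ^ℚ 2 ℚ.≤ a ℚ.* fromℕℚ n →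
      ∀ m → 1 ℕ.≤ m → ¼ ℚ.* x ℚ.≤ seq (√ (fromℚ a * fromℕ n)) m
¼≤√ {a} {n} {x} 2≤x h m 1≤m = ≤-cancel {½ ℚ.* x} {rootApprox 2 (a ℚ.* fromℕℚ n) m} {¼ ℚ.* x} (1/1+ m)
  (sqrt-lower m (0≤* (0≤/ 1 1) (ℚ.≤-trans (0≤fromℕℚ 2) 2≤x)) h)
  (begin
    ¼ ℚ.* x ℚ.+ 1/1+ m  
          ≤⟨ ℚ.+-monoʳ-≤ (¼ ℚ.* x) (ℚ.≤-trans (1/1+-antitone 1 m 1≤m) (*-mono-≤ {¼} {¼} {fromℕℚ 2} {x}
                (0≤/ 1 3) ℚ.≤-refl (0≤fromℕℚ 2) 2≤x)) ⟩
    ¼ ℚ.* x ℚ.+ ¼ ℚ.* x  ≡⟨ solve 1 (λ x → con ¼ :* x :+ con ¼ :* x := con ½ :* x) refl x ⟩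
    ½ ℚ.* x              ∎)
  where
  open ℚ.≤-Reasoning
  open ℚ-Solver
  ≤-cancel : ∀ {a b c} i → a ℚ.≤ b ℚ.+ i → c ℚ.+ i ℚ.≤ a → c ℚ.≤ b
  ≤-cancel i h₁ h₂ = ℚ.≮⇒≥ (λ b<c → ℚ.<-irrefl refl (ℚ.<-≤-trans (ℚ.+-monoˡ-< i b<c) (ℚ.≤-trans h₂ h₁)))

*≤-fromℚ : ∀ {c s p} (x : ℝ) → 0ℚ ℚ.≤ c → (∀ m → 0ℚ ℚ.≤ seq x m) → (∀ m → seq x m ℚ.≤ s) → c ℚ.* s ℚ.≤ p →
      fromℚ c * x ≤ fromℚ p
*≤-fromℚ {c} {s} {p} x 0≤c 0≤x x≤s cs≤p {ε} 0<ε = 0 , λ {m} _ →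
  ≤-fromℚ {c ℚ.* seq x m} {p} (ℚ.≤-trans (*-mono-≤ {c} {c} {seq x m} {s} 0≤c ℚ.≤-refl (0≤x m) (x≤s m)) cs≤p) 0<ε

-- The threshold `m₀` lets the bound on the first factor hold only eventually: `¼≤√` starts at index
-- 1.
fromℕ≤-* : ∀ {q c r l m₀} (x y : ℝ) → 0ℚ ℚ.≤ r → 0ℚ ℚ.≤ l →
  (∀ m → m₀ ℕ.≤ m → r ℚ.≤ seq x m) → (∀ m → l ℚ.≤ seq y m) → fromℕℚ q ℚ.≤ fromℕℚ c ℚ.* r ℚ.* l →
        fromℕ q ≤ fromℕ c * x * y
fromℕ≤-* {q} {c} {r} {l} {m₀} x y 0≤r 0≤l r≤x l≤y q≤crl {ε} 0<ε = m₀ , λ {m} m₀≤m →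
  ≤-fromℚ {fromℕℚ q} {c′ ℚ.* seq x m ℚ.* seq y m} (ℚ.≤-trans q≤crl
    (*-mono-≤ {c′ ℚ.* r} {c′ ℚ.* seq x m} {l} {seq y m} (0≤* (0≤fromℕℚ c) 0≤r)
      (*-mono-≤ {c′} {c′} {r} {seq x m} (0≤fromℕℚ c) ℚ.≤-refl 0≤r (r≤x m m₀≤m)) 0≤l (l≤y m))) 0<ε
  where
  c′ : ℚ
  c′ = fromℕℚ c

0≤root₃ : ∀ x m → 0ℚ ℚ.≤ seq (root 3 x) m
0≤root₃ x m = rootApprox-nonNeg 3 (seq x m) m

½*root₃≤ : ∀ {s p} y → 0ℚ ℚ.< s → y ℚ.≤ s ^ℚ 3 → ½ ℚ.* s ℚ.≤ p → fromℚ ½ * root 3 (fromℚ y) ≤ fromℚ p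
½*root₃≤ {s} {p} y 0<s y≤s³ = *≤-fromℚ {½} {s} {p} (root 3 (fromℚ y)) (0≤/ 1 1) (0≤root₃ (fromℚ y))
      (root₃≤ {y} {s} 0<s y≤s³)

root₃≡^-⅓ : ∀ n .{{_ : NonZero n}} → root 3 (fromℚ (+ 1 ℚ./ n)) ≡ n ^-⅓
root₃≡^-⅓ n = refl

½*^-⅓≤ : ∀ n .{{n≢0 : NonZero n}} {s p} → 0ℚ ℚ.< s → + 1 ℚ./ n ℚ.≤ s ^ℚ 3 → ½ ℚ.* s ℚ.≤ p → fromℚ ½ * n ^-⅓ ≤ fromℚ p
½*^-⅓≤ n {{n≢0}} {s} {p} 0<s 1/n≤s³ ½s≤p =
  subst (λ x → fromℚ ½ * x ≤ fromℚ p) (root₃≡^-⅓ n {{n≢0}}) (½*root₃≤ {s} {p} ((+ 1 ℚ./ n) {{n≢0}}) 0<s 1/n≤s³ ½s≤p)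

-- Refining the mesh increases the lower Riemann sums, and the coarsest one begins with the term
-- 1/2.
½≤logApprox : ∀ w .{{_ : NonZero w}} t → ½ ℚ.≤ logApprox w t
½≤logApprox (suc w) t = ℚ.≤-trans (head≤sum (w ℕ.* 1))
  (subst (λ s → logApprox (suc w) 0 ℚ.≤ logApprox (suc w) s) (ℕ.+-identityʳ t) (logApprox-mono (suc w) 0 t))
  where
  f : ℕ → ℚ
  f j = 1/1+ (1 ℕ.+ j)
  head≤sum : ∀ k → ½ ℚ.≤ sumℚ (suc k) f
  head≤sum zero    = ℚ.≤-reflexive (sym (ℚ.+-identityˡ ½))
  head≤sum (suc k) = ℚ.≤-trans (head≤sum k) (≤-+ʳ (sumℚ (suc k) f) (f (suc k)) (0≤/ 1 (suc (suc k))))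

½≤log : ∀ n .{{n≢0 : NonZero n}} → 2 ℕ.≤ n → ∀ m → ½ ℚ.≤ seq (log n) m
½≤log n 2≤n = ½≤logApprox (ℕ.pred n) {{ℕ.>-nonZero (ℕ.pred-mono-≤ 2≤n)}}

abstract
  reciprocal : ∀ n .{{_ : NonZero n}} → ∃[ i ] (0ℚ ℚ.< i × fromℕℚ n ℚ.* i ≡ 1ℚ)
  reciprocal n = + 1 ℚ./ n , 0<1/ n , *-1/ n

-- Comparison of p and q with powers of n.

module _ {q n p} (2≤q : 2 ℕ.≤ q) (n≡q³ : n ≡ q ℕ.* (q ℕ.* q)) (2qp≡1 : fromℕℚ (2 ℕ.* q) ℚ.* p ≡ 1ℚ) where

  private
    𝐪 s : ℚ
    𝐪 = fromℕℚ q
    s = fromℕℚ 2 ℚ.* p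

    𝐧≡ : fromℕℚ n ≡ 𝐪 ℚ.* (𝐪 ℚ.* 𝐪)
    𝐧≡ = trans (cong fromℕℚ n≡q³) (trans (fromℕℚ-* q (q ℕ.* q)) (cong (𝐪 ℚ.*_) (fromℕℚ-* q q)))

    qs≡1 : 𝐪 ℚ.* s ≡ 1ℚ
    qs≡1 = begin
      𝐪 ℚ.* (fromℕℚ 2 ℚ.* p)      ≡⟨ solve 2 (λ q p → q :* (con (fromℕℚ 2) :* p) := con (fromℕℚ 2) :* q :* p)
            refl 𝐪 p ⟩
      fromℕℚ 2 ℚ.* 𝐪 ℚ.* p        ≡⟨ cong (ℚ._* p) (fromℕℚ-* 2 q) ⟨
      fromℕℚ (2 ℕ.* q) ℚ.* p      ≡⟨ 2qp≡1 ⟩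
      1ℚ                          ∎
      where
      open ≡-Reasoning
      open ℚ-Solver

  -- With `s` = 2 p = 1 / q, the cube s³ is exactly 1 / n, and p = s / 2 gives the constant 1/2.
  density : .{{n≢0 : NonZero n}} → 0ℚ ℚ.< p → fromℚ ½ * n ^-⅓ ≤ fromℚ p
  density {{n≢0}} 0<p = ½*^-⅓≤ n {{n≢0}} {s} {p} 0<s (ℚ.≤-reflexive (1/n≡s³ (+ 1 ℚ./ n) (*-1/ n)))
    (ℚ.≤-reflexive (solve 1 (λ p → con ½ :* (con (fromℕℚ 2) :* p) := p) refl p))
    where
    open ≡-Reasoning
    open ℚ-Solver
    0<s : 0ℚ ℚ.< s
    0<s = ℚ.positive⁻¹ s {{ℚ.pos*pos⇒pos (fromℕℚ 2) p {{ℚ.positive 0<p}}}}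
    1/n≡s³ : ∀ i → fromℕℚ n ℚ.* i ≡ 1ℚ → i ≡ s ^ℚ 3
    1/n≡s³ i ni≡1 = begin
      i                                             
            ≡⟨ solve 1 (λ i → i := i :* (con 1ℚ :* (con 1ℚ :* con 1ℚ))) refl i ⟩
      i ℚ.* (1ℚ ℚ.* (1ℚ ℚ.* 1ℚ))                     ≡⟨ cong (λ z → i ℚ.* (z ℚ.* (z ℚ.* z))) qs≡1 ⟨
      i ℚ.* (𝐪 ℚ.* s ℚ.* (𝐪 ℚ.* s ℚ.* (𝐪 ℚ.* s)))    ≡⟨ solve 3 (λ i q s → i :* (q :* s :* (q :* s :* (q :* s))) :=
                                                        (q :* (q :* q) :* i) :* (s :* (s :*
                                                              (s :* con 1ℚ)))) refl i 𝐪 s ⟩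
      𝐪 ℚ.* (𝐪 ℚ.* 𝐪) ℚ.* i ℚ.* s ^ℚ 3               ≡⟨ cong (λ z → z ℚ.* i ℚ.* s ^ℚ 3) 𝐧≡ ⟨
      fromℕℚ n ℚ.* i ℚ.* s ^ℚ 3                      ≡⟨ cong (ℚ._* s ^ℚ 3) ni≡1 ⟩
      1ℚ ℚ.* s ^ℚ 3                                  ≡⟨ ℚ.*-identityˡ (s ^ℚ 3) ⟩
      s ^ℚ 3                                         ∎

  -- As p n = q² / 2, the root exceeds q / 2, and its rational approximations are at least q / 4
  -- from index 1 on. With 1/2 for the logarithm, 8 · q/4 · 1/2 = q.
  discrepancy : .{{n≢0 : NonZero n}} → fromℕ q ≤ fromℕ 8 * √ (fromℚ p * fromℕ n) * log n
  discrepancy {{n≢0}} = fromℕ≤-* {q} {8} {¼ ℚ.* 𝐪} {½} {1} (√ (fromℚ p * fromℕ n)) ((log n) {{n≢0}})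
    (0≤* (0≤/ 1 3) 0≤𝐪) (0≤/ 1 1)
    (¼≤√ {p} {n} {𝐪} (fromℕℚ-mono 2≤q) ¼q²≤pn) (½≤log n {{n≢0}} 2≤n)
    (ℚ.≤-reflexive (solve 1 (λ q → q := con (fromℕℚ 8) :* (con ¼ :* q) :* con ½) refl 𝐪))
    where
    open ℚ.≤-Reasoning
    open ℚ-Solver
    instance
      q²≢0 : NonZero (q ℕ.* q)
      q²≢0 = ℕ.>-nonZero (ℕ.*-mono-≤ {1} {q} {1} {q} (ℕ.≤-trans (ℕ.n≤1+n 1) 2≤q) (ℕ.≤-trans (ℕ.n≤1+n 1) 2≤q))
    2≤n : 2 ℕ.≤ n
    2≤n = ℕ.≤-trans 2≤q (subst (q ℕ.≤_) (sym n≡q³) (ℕ.m≤m*n q (q ℕ.* q)))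
    0≤𝐪 : 0ℚ ℚ.≤ 𝐪
    0≤𝐪 = 0≤fromℕℚ q
    ¼q²≤pn : (½ ℚ.* 𝐪) ^ℚ 2 ℚ.≤ p ℚ.* fromℕℚ n
    ¼q²≤pn = begin
      (½ ℚ.* 𝐪) ^ℚ 2                  
            ≡⟨ solve 1 (λ q → con ½ :* q :* (con ½ :* q :* con 1ℚ) := con ¼ :* (q :* q)) refl 𝐪 ⟩
      ¼ ℚ.* (𝐪 ℚ.* 𝐪)                 
            ≤⟨ *-mono-≤ {¼} {½} (0≤/ 1 3) (/-mono {1} {1} {3} {1} (ℕ.s≤s (ℕ.s≤s ℕ.z≤n))) (0≤* 0≤𝐪 0≤𝐪) ℚ.≤-refl ⟩
      ½ ℚ.* (𝐪 ℚ.* 𝐪)                  ≡⟨ trans (cong (ℚ._* (½ ℚ.* (𝐪 ℚ.* 𝐪))) qs≡1) (ℚ.*-identityˡ _) ⟨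
      𝐪 ℚ.* s ℚ.* (½ ℚ.* (𝐪 ℚ.* 𝐪))   
            ≡⟨ solve 2 (λ q p → q :* (con (fromℕℚ 2) :* p) :* (con ½ :* (q :* q)) := p :* (q :* (q :* q))) refl 𝐪 p ⟩
      p ℚ.* (𝐪 ℚ.* (𝐪 ℚ.* 𝐪))          ≡⟨ cong (p ℚ.*_) 𝐧≡ ⟨
      p ℚ.* fromℕℚ n                   ∎

-- Jumbledness, growth of the orders, and the final assembly.

module _ (K : BinaryField) .{{_ : NonZero (BinaryField.q K)}} where

  open BinaryField K using (q)
  open Construction K using (e-upper; e-lower)

  -- After clearing 2 q and doubling, 4 q e(X) and 2 c must differ by at most 4 q² x. Above, the
  -- spectrum costs 2 q² x, and the surplus x = x² - 2 c is at most another 2 q² x. Below, the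
  -- spectrum costs 3 q² x and the surplus helps.
  jumbled : ∀ {p} → fromℕℚ (2 ℕ.* q) ℚ.* p ≡ 1ℚ → Jumbled (Construction.graph K) (fromℚ p) (fromℕ q)
  jumbled {p} 2qp≡1 X {ε} 0<ε = 0 , λ _ →
        ≤-fromℚ (subst (ℚ.∣ fromℕℚ (e graph X) ℚ.- p ℚ.* fromℕℚ (x C 2) ∣ ℚ.≤_) (fromℕℚ-* q x)
    (∣-*∣≤ {2 ℕ.* q} {p} 2qp≡1 (e graph X) (x C 2) (q ℕ.* x) above below)) 0<ε
    where
    open ℕ.≤-Reasoning
    open ℕ-Solver
    graph : Graph (Spectrum.N K)
    graph = Construction.graph K
    instance
      2q≢0 : NonZero (2 ℕ.* q)
      2q≢0 = ℕ.m*n≢0 2 q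
      q²≢0 : NonZero (q ℕ.* q)
      q²≢0 = ℕ.m*n≢0 q q
    x c : ℕ
    x = Subset.∣ X ∣
    c = x C 2
    above : 2 ℕ.* q ℕ.* e graph X ℕ.≤ c ℕ.+ 2 ℕ.* q ℕ.* (q ℕ.* x)
    above = ℕ.*-cancelˡ-≤ 2 (begin
      2 ℕ.* (2 ℕ.* q ℕ.* e graph X)
        ≡⟨ solve 2 (λ q e → con 2 :* (con 2 :* q :* e) := con 4 :* (q :* e)) refl q (e graph X) ⟩
      4 ℕ.* (q ℕ.* e graph X)
        ≤⟨ e-upper X ⟩
      x ℕ.* x ℕ.+ 2 ℕ.* (q ℕ.* q ℕ.* x)
        ≡⟨ cong (ℕ._+ 2 ℕ.* (q ℕ.* q ℕ.* x)) (2*nC2+n≡n*n x) ⟨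
      2 ℕ.* c ℕ.+ x ℕ.+ 2 ℕ.* (q ℕ.* q ℕ.* x)
        ≤⟨ ℕ.+-monoˡ-≤ (2 ℕ.* (q ℕ.* q ℕ.* x)) (ℕ.+-monoʳ-≤ (2 ℕ.* c) (ℕ.≤-trans (ℕ.m≤n*m x (q ℕ.* q))
              (ℕ.m≤n*m (q ℕ.* q ℕ.* x) 2))) ⟩
      2 ℕ.* c ℕ.+ 2 ℕ.* (q ℕ.* q ℕ.* x) ℕ.+ 2 ℕ.* (q ℕ.* q ℕ.* x)
        ≡⟨ solve 3 (λ q c x → con 2 :* c :+ con 2 :* (q :* q :* x) :+ con 2 :* (q :* q :* x) :=
             con 2 :* (c :+ con 2 :* q :* (q :* x))) refl q c x ⟩
      2 ℕ.* (c ℕ.+ 2 ℕ.* q ℕ.* (q ℕ.* x)) ∎)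
    below : c ℕ.≤ 2 ℕ.* q ℕ.* e graph X ℕ.+ 2 ℕ.* q ℕ.* (q ℕ.* x)
    below = ℕ.*-cancelˡ-≤ 2 (begin
      2 ℕ.* c
        ≤⟨ ℕ.m≤m+n (2 ℕ.* c) x ⟩
      2 ℕ.* c ℕ.+ x
        ≡⟨ 2*nC2+n≡n*n x ⟩
      x ℕ.* x
        ≤⟨ e-lower X ⟩
      4 ℕ.* (q ℕ.* e graph X) ℕ.+ 3 ℕ.* (q ℕ.* q ℕ.* x)
        ≤⟨ ℕ.+-monoʳ-≤ (4 ℕ.* (q ℕ.* e graph X)) (ℕ.*-monoˡ-≤ (q ℕ.* q ℕ.* x) (ℕ.n≤1+n 3)) ⟩
      4 ℕ.* (q ℕ.* e graph X) ℕ.+ 4 ℕ.* (q ℕ.* q ℕ.* x)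
        ≡⟨ solve 3 (λ q e x → con 4 :* (q :* e) :+ con 4 :* (q :* q :* x) :=
             con 2 :* (con 2 :* q :* e :+ con 2 :* q :* (q :* x))) refl q (e graph X) x ⟩
      2 ℕ.* (2 ℕ.* q ℕ.* e graph X ℕ.+ 2 ℕ.* q ℕ.* (q ℕ.* x)) ∎)

-- Far below the true order 2^(2^i), but it yields both 2 ≤ q and unboundedness; the induction uses
-- q² ≥ 2 q ≥ q + 1.
2+i≤order : ∀ i → 2 ℕ.+ i ℕ.≤ BinaryField.q (𝔽 i)
2+i≤order zero    = ℕ.≤-refl
2+i≤order (suc i) = begin
  1 ℕ.+ (2 ℕ.+ i)  ≤⟨ ℕ.+-mono-≤ {1} {q} (ℕ.≤-trans (ℕ.s≤s ℕ.z≤n) (2+i≤order i)) (2+i≤order i) ⟩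
  q ℕ.+ q          ≡⟨ cong (ℕ._+_ q) (ℕ.+-identityʳ q) ⟨
  2 ℕ.* q          ≤⟨ ℕ.*-monoˡ-≤ q (ℕ.≤-trans (ℕ.m≤m+n 2 i) (2+i≤order i)) ⟩
  q ℕ.* q          ∎
  where
  open ℕ.≤-Reasoning
  q : ℕ
  q = BinaryField.q (𝔽 i)

theorem1 : Σ[ n ∈ (ℕ → ℕ) ] Σ[ n≢0 ∈ (∀ i → NonZero (n i)) ] (TendsToInfinity n ×
    (∃[ c ] ∃[ C ] (0ℝ < c × 0ℝ < C ×
    (∀ i → let instance _ = n≢0 i in
    Σ[ G ∈ Graph (n i) ] (TriangleFree G ×
    (∃[ p ] ∃[ β ] (Jumbled G p β ×
    c * n i ^-⅓ ≤ p ×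
    β ≤ C * √ (p * fromℕ (n i)) * log (n i))))))))
theorem1 =
  (λ i → Spectrum.N (𝔽 i)) , N≢0 , unbounded ,
  fromℚ ½ , fromℕ 8 , positive ½ (ℚ.positive⁻¹ ½) , positive (fromℕℚ 8) (0<fromℕℚ 8) ,
  λ i → Construction.graph (𝔽 i) , Construction.triangleFree (𝔽 i) ,
    fromℚ (p i) , fromℕ (BinaryField.q (𝔽 i)) ,
    jumbled (𝔽 i) {{q≢0 i}} (2qp≡1 i) ,
    density {BinaryField.q (𝔽 i)} {Spectrum.N (𝔽 i)} {p i} (2≤order i) (Spectrum.size-𝐕 (𝔽 i))
          (2qp≡1 i) {{N≢0 i}} (0<p i) ,
    discrepancy {BinaryField.q (𝔽 i)} {Spectrum.N (𝔽 i)} {p i} (2≤order i) (Spectrum.size-𝐕 (𝔽 i)) (2qp≡1 i) {{N≢0 i}}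
  where
  2≤order : ∀ i → 2 ℕ.≤ BinaryField.q (𝔽 i)
  2≤order i = ℕ.≤-trans (ℕ.m≤m+n 2 i) (2+i≤order i)
  q≢0 : ∀ i → NonZero (BinaryField.q (𝔽 i))
  q≢0 i = ℕ.>-nonZero (ℕ.≤-trans (ℕ.n≤1+n 1) (2≤order i))
  2q≢0 : ∀ i → NonZero (2 ℕ.* BinaryField.q (𝔽 i))
  2q≢0 i = ℕ.m*n≢0 2 (BinaryField.q (𝔽 i)) {{_}} {{q≢0 i}}
  p : ℕ → ℚ
  p i = proj₁ (reciprocal (2 ℕ.* BinaryField.q (𝔽 i)) {{2q≢0 i}})
  0<p : ∀ i → 0ℚ ℚ.< p i
  0<p i = proj₁ (proj₂ (reciprocal (2 ℕ.* BinaryField.q (𝔽 i)) {{2q≢0 i}}))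
  2qp≡1 : ∀ i → fromℕℚ (2 ℕ.* BinaryField.q (𝔽 i)) ℚ.* p i ≡ 1ℚ
  2qp≡1 i = proj₂ (proj₂ (reciprocal (2 ℕ.* BinaryField.q (𝔽 i)) {{2q≢0 i}}))
  q≤N : ∀ i → BinaryField.q (𝔽 i) ℕ.≤ Spectrum.N (𝔽 i)
  q≤N i = subst (BinaryField.q (𝔽 i) ℕ.≤_) (sym (Spectrum.size-𝐕 (𝔽 i)))
    (ℕ.m≤m*n (BinaryField.q (𝔽 i)) _ {{ℕ.m*n≢0 _ _ {{q≢0 i}} {{q≢0 i}}}})
  N≢0 : ∀ i → NonZero (Spectrum.N (𝔽 i))
  N≢0 i = ℕ.>-nonZero (ℕ.≤-trans (ℕ.n≤1+n 1) (ℕ.≤-trans (2≤order i) (q≤N i)))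
  unbounded : TendsToInfinity (λ i → Spectrum.N (𝔽 i))
  unbounded M = M , λ {i} M≤i → ℕ.≤-trans M≤i (ℕ.≤-trans (ℕ.m≤n+m i 2) (ℕ.≤-trans (2+i≤order i) (q≤N i)))
  positive : ∀ x → 0ℚ ℚ.< x → 0ℝ < fromℚ x
  positive x 0<x = x , 0<x , 0 , λ _ → ℚ.≤-reflexive (ℚ.+-identityˡ x)
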